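{- Let $N>2$ be even and let $q>8$ be a power of $2$. Then $$t_2(N,q)\le (t_2(2,q)+3)\, q^{\frac{N-2}{2}}+3\sum_{j=1}^{(N-4)/2}q^{j}-N+3,$$ and $$t_2(N,q)\le (t_2^A(2,q)+3)\, q^{\frac{N-2}{2}}+3\sum_{j=1}^{(N-4)/2}q^{j}-N+5,$$ where empty sums are $0$.
   Context: A cap in $PG(N,q)$ is a set of points no three collinear; it is complete if not contained in a larger cap. An arc is a cap in $PG(2,q)$. $t_2(N,q)$ denotes the smallest size of a complete cap in $PG(N,q)$. In $PG(2,q)$ with homogeneous coordinates $(X_0,X_1,X_2)$, let $l_\infty$ be the line $X_0=0$. An affine arc is an arc containing no point of $l_\infty$; an affinely complete arc is an affine arc such that every point of $PG(2,q)\setminus l_\infty$ lies on a line joining two distinct points of the arc (equivalently is covered by its secants). $t_2^A(2,q)$ denotes the size of the smallest affinely complete arc in $PG(2,q)$ (so $t_2^A(2,q)\le t_2(2,q)$). The sum $3\sum_{j=1}^{(N-4)/2}q^j$ is the paper's $3(q^{\frac{N-4}{2}}+q^{\frac{N-6}{2}}+\dots+q)$. -}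

module Defs where

open import Data.Nat as ℕ using (ℕ; suc; _≤_; _^_; ⌊_/2⌋; _∸_)
open import Data.Fin using (Fin; zero)
open import Data.List using (List; length; lookup; _∷_)
open import Data.Product using (_×_; ∃; ∃-syntax; Σ)
open import Relation.Binary.PropositionalEquality using (_≡_)
open import Relation.Nullary using (¬_)
open import Algebra.Core using (Op₂)
open import Algebra.Structures using (IsCommutativeRing)
open import Function.Bundles using (_↔_)

record FiniteField (q : ℕ) : Set₁ where
  infixl 6 _+_
  infixl 7 _*_
  field
    Carrier : Set
    _+_ _*_ : Op₂ Carrier
    -_ : Carrier → Carrier
    0# 1# : Carrier
    isCommutativeRing : IsCommutativeRing _≡_ _+_ _*_ -_ 0# 1#
    0≢1 : ¬ (0# ≡ 1#)
    inverse : ∀ x → ¬ (x ≡ 0#) → ∃[ y ] (x * y ≡ 1#)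
    enum : Carrier ↔ Fin q

-- Projective geometry PG(n,F): points are nonzero vectors of F^(n+1),
-- identified up to nonzero scalar multiples.
module Geometry {q : ℕ} (F : FiniteField q) where
  open FiniteField F

  Vect : ℕ → Set
  Vect n = Fin (suc n) → Carrier

  NonZeroV : ∀ {n} → Vect n → Set
  NonZeroV v = ∃[ i ] ¬ (v i ≡ 0#)

  SamePoint : ∀ {n} → Vect n → Vect n → Set
  SamePoint u v = ∃[ c ] (∀ i → u i ≡ c * v i)

  Collinear : ∀ {n} → Vect n → Vect n → Vect n → Set
  Collinear u v w = ∃[ a ] ∃[ b ] ∃[ c ]
    (¬ (a ≡ 0# × b ≡ 0# × c ≡ 0#) × (∀ i → (a * u i + b * v i) + c * w i ≡ 0#))

  Cap : (n : ℕ) → List (Vect n) → Set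
  Cap n C =
    (∀ i → NonZeroV (lookup C i)) ×
    (∀ i j → ¬ (i ≡ j) → ¬ SamePoint (lookup C i) (lookup C j)) ×
    (∀ i j k → ¬ (i ≡ j) → ¬ (j ≡ k) → ¬ (i ≡ k) →
       ¬ Collinear (lookup C i) (lookup C j) (lookup C k))

  CompleteCap : (n : ℕ) → List (Vect n) → Set
  CompleteCap n C = Cap n C ×
    (∀ (x : Vect n) → NonZeroV x → (∀ i → ¬ SamePoint x (lookup C i)) → ¬ Cap n (x ∷ C))

  IsT2 : ℕ → ℕ → Set
  IsT2 n m = (∃[ C ] (CompleteCap n C × length C ≡ m)) ×
             (∀ C → CompleteCap n C → m ≤ length C)

  AffineArc : List (Vect 2) → Set
  AffineArc C = Cap 2 C × (∀ i → ¬ (lookup C i zero ≡ 0#))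

  AffinelyComplete : List (Vect 2) → Set
  AffinelyComplete C = AffineArc C ×
    (∀ (x : Vect 2) → NonZeroV x → ¬ (x zero ≡ 0#) →
       ∃[ i ] ∃[ j ] (¬ (i ≡ j) × Collinear x (lookup C i) (lookup C j)))

  IsT2A : ℕ → Set
  IsT2A m = (∃[ C ] (AffinelyComplete C × length C ≡ m)) ×
            (∀ C → AffinelyComplete C → m ≤ length C)

sumPow : ℕ → ℕ → ℕ
sumPow q ℕ.zero = 0
sumPow q (suc k) = sumPow q k ℕ.+ q ^ suc k

{-# OPTIONS --safe #-}
module Submission where

-- Write N = 2s + 2 and let P = {(x, x²)} be the affine parabola. A point (λx + μx′, λx² + μx′²) with λ, μ, λ + μ ≠ 0 can be prescribed
-- arbitrarily, because square roots exist in characteristic 2; so for an affinely complete arc K the product K × Pˢ is a cap of AG(N,q)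
-- covering all affine points. Its secants meet the hyperplane at infinity in points (w; y, z) with y_j² = c z_j for one c ≠ 0 and
-- w ∈ c(K + K). To these one adds three "arms" (v_i; x, x²), x ≠ 0, where v₂ = κ(v₀ + v₁), κ³ ≠ 1 and v_i ∉ K + K: they cover every
-- (w; y, z) with w ≠ 0 and (y, z) ≠ 0. In the subspace w = 0 only the points on no conic y_j² = c z_j are left, and these are handled by
-- the same three arms recursively, with v₀ = (κ², 1), v₁ = (κ² + 1, 1), v₂ = (κ, 0) and the extra point (0, 1; 0).
-- The line (w; 0) is covered by the secants of K when K is complete; otherwise at most two of its points have to be added.
-- The v_i exist since a direction contains at most |K|/2 differences of K and one may assume |K| ≤ q, replacing K by P if necessary;
-- this is where q > 8 enters.

open import Defs
import Algebra.Properties.CommutativeMonoid.Sum as MonoidSum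
import Algebra.Properties.Group as GroupProperties
import Algebra.Properties.Semiring.Mult as SemiringMult
import Algebra.Solver.Ring as RingSolver
open import Algebra.Solver.Ring.AlmostCommutativeRing using (fromCommutativeRing; _-Raw-AlmostCommutative⟶_)
open import Algebra.Bundles using (CommutativeRing; RawRing)
open import Data.Bool using (Bool; true; false; _∧_; _xor_)
import Data.Bool.Properties as Bool
open import Data.Empty using (⊥)
open import Data.Fin using (Fin; zero; suc; punchOut; punchIn; toℕ; combine; remQuot; join; splitAt; _↑ˡ_; _↑ʳ_)
open import Data.Fin.Patterns using (0F; 1F; 2F; 3F)
open import Data.Fin.Permutation using (Permutation; permutation)
import Data.Fin.Properties as Fin
open import Data.List as List using (List; []; _∷_; length; map; _++_; cartesianProductWith; allFin; filter)
import Data.List.Properties as List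
open import Data.List.Membership.Propositional using (_∈_; lose)
open import Data.List.Membership.Propositional.Properties using (∈-map⁺; ∈-map⁻; ∈-++⁺ˡ; ∈-++⁺ʳ; ∈-++⁻; ∈-cartesianProductWith⁺; ∈-cartesianProductWith⁻; ∈-allFin; ∈-filter⁺; ∈-filter⁻)
open import Data.List.Relation.Unary.All as All using ([]; _∷_)
open import Data.List.Relation.Unary.AllPairs using ([]; _∷_)
open import Data.List.Relation.Unary.Any using (here; there)
open import Data.List.Relation.Unary.Unique.Propositional using (Unique)
import Data.List.Relation.Unary.Unique.Propositional.Properties as Unique
open import Data.Maybe as Maybe using (Maybe; just; nothing)
open import Data.Nat as ℕ using (ℕ)
import Data.Nat.Properties as ℕ
open import Data.Nat.Tactic.RingSolver using (solve-∀)
open import Data.Product using (∃; ∃-syntax; _×_; _,_; proj₁; proj₂)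
open import Data.Sum as Sum using (_⊎_; inj₁; inj₂)
open import Data.Sum.Properties using (inj₁-injective; inj₂-injective)
open import Data.Unit using (⊤; tt)
open import Data.Vec using (Vec; []; _∷_; lookup; tabulate; replicate)
import Data.Vec.Properties as Vec
open import Function using (_∘_; Injective)
open import Function.Bundles using (module Inverse)
open import Level using (0ℓ)
open import Relation.Binary.Consequences using (dec⇒weaklyDec)
open import Relation.Binary.Definitions using (DecidableEquality)
open import Relation.Binary.PropositionalEquality using (_≡_; _≢_; refl; sym; trans; cong; cong₂; subst; subst₂; module ≡-Reasoning)
open import Relation.Nullary using (¬_; Dec; yes; no; contradiction; ¬?; _×-dec_)
import Relation.Nullary.Decidable as Dec

-- Squaring is additive, so parabola parts with equal weights merge: a (x, x²) + a (x′, x′²) = a (x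
-- + x′, (x + x′)²). This settles the mixed collinearities, and it is why the points with w = 0 must
-- avoid the conics. A chord with weights l and m reaches any tail (y, z), but an end gets parameter
-- 0 when the tail lies on the conic of the other weight. The arms omit that parameter, since the
-- three points (v_i; 0) would be collinear; the third arm offers other weights when the chord
-- between two arms is spoilt in this way. Collinear points on three different arms would have
-- weights κ, κ, 1, and the nonzero tails then force κ = 1; replacing a spoilt chord needs κ² + κ +
-- 1 ≠ 0. Together this is κ³ ≠ 1. A complete arc need not be affine. If it has at most q points,
-- some line misses it and is moved to infinity; if it has more, the parabola has at least one point
-- less, which outweighs the two points added on the line (w; 0). The term N - 3 counts omissions:
-- each level of arms saves three zero parameters, each level below the top gives one back for its
-- extra point, and the recursion ends with the two basis points of a line.

injective⇒surjective : ∀ {n} {f : Fin n → Fin n} → Injective _≡_ _≡_ f → ∀ y → ∃[ x ] f x ≡ y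
injective⇒surjective {ℕ.suc n} {f} inj y with Fin.any? (λ x → f x Fin.≟ y)
... | yes hit = hit
... | no miss = contradiction (Fin.injective⇒≤ avoid-injective) ℕ.1+n≰n
  where
  off : ∀ x → y ≢ f x
  off x y≡fx = miss (x , sym y≡fx)

  avoid-injective : Injective _≡_ _≡_ (λ x → punchOut (off x))
  avoid-injective {x} {x′} eq = inj (Fin.punchOut-injective (off x) (off x′) eq)

-- Finite fields of even order

HasChar2 : ∀ {q} → FiniteField q → Set
HasChar2 F = 1# + 1# ≡ 0#
  where open FiniteField F

module Field {q : ℕ} (F : FiniteField q) where
  open FiniteField F

  commutativeRing : CommutativeRing 0ℓ 0ℓ
  commutativeRing = record { isCommutativeRing = isCommutativeRing }

  open CommutativeRing commutativeRing using (+-assoc; +-identityʳ; *-identityˡ; *-assoc; *-comm; zeroʳ; -‿inverseʳ; -‿inverseˡ; +-group; +-commutativeMonoid; semiring)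
  open MonoidSum +-commutativeMonoid using (sum; sum-permute; ∑-distrib-+; sum-replicate; sum-cong-≗)
  open GroupProperties +-group using (∙-cancelˡ)
  open SemiringMult semiring using (×1-homo-*) renaming (_×_ to _·_)
  open Inverse enum using (to; from; strictlyInverseˡ; strictlyInverseʳ)

  to-injective : ∀ {x y} → to x ≡ to y → x ≡ y
  to-injective {x} {y} eq = trans (sym (strictlyInverseʳ x)) (trans (cong from eq) (strictlyInverseʳ y))

  infix 4 _≟_
  _≟_ : DecidableEquality Carrier
  x ≟ y = Dec.map′ to-injective (cong to) (to x Fin.≟ to y)

  any? : {P : Carrier → Set} → (∀ x → Dec (P x)) → Dec (∃ P)
  any? {P} P? = Dec.map′
    (λ (i , p) → from i , p)
    (λ (x , p) → to x , subst P (sym (strictlyInverseʳ x)) p)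
    (Fin.any? (P? ∘ from))

  *-cancel-0 : ∀ {a x} → a ≢ 0# → a * x ≡ 0# → x ≡ 0#
  *-cancel-0 {a} {x} a≢0 ax≡0 = begin
    x            ≡⟨ *-identityˡ x ⟨
    1# * x       ≡⟨ cong (_* x) (trans (*-comm a⁻¹ a) aa⁻¹) ⟨
    a⁻¹ * a * x  ≡⟨ *-assoc a⁻¹ a x ⟩
    a⁻¹ * (a * x) ≡⟨ cong (a⁻¹ *_) ax≡0 ⟩
    a⁻¹ * 0#     ≡⟨ zeroʳ a⁻¹ ⟩
    0#           ∎
    where
    open ≡-Reasoning
    a⁻¹ = proj₁ (inverse a a≢0)
    aa⁻¹ = proj₂ (inverse a a≢0)

  *-≢0 : ∀ {a b} → a ≢ 0# → b ≢ 0# → a * b ≢ 0#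
  *-≢0 a≢0 b≢0 ab≡0 = b≢0 (*-cancel-0 a≢0 ab≡0)

  -- Translation by 1 permutes the field, so Σ x = Σ (x + 1) = Σ x + q · 1.
  order×1≡0 : q · 1# ≡ 0#
  order×1≡0 = ∙-cancelˡ (sum from) _ _ (begin
    sum from + q · 1#                     ≡⟨ cong (sum from +_) (sum-replicate q) ⟨
    sum from + sum {q} (λ _ → 1#)       ≡⟨ ∑-distrib-+ from (λ _ → 1#) ⟨
    sum (λ i → from i + 1#)             ≡⟨ sum-cong-≗ (λ i → strictlyInverseʳ (from i + 1#)) ⟨
    sum (λ i → from (to (from i + 1#))) ≡⟨ sum-permute from shift ⟨
    sum from                            ≡⟨ +-identityʳ _ ⟨
    sum from + 0#                       ∎)
    where
    open ≡-Reasoning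
    cancel : ∀ {c d} x → c + d ≡ 0# → x + c + d ≡ x
    cancel x c+d≡0 = trans (+-assoc x _ _) (trans (cong (x +_) c+d≡0) (+-identityʳ x))

    inv : ∀ {c d} → d + c ≡ 0# → ∀ i → to (from (to (from i + d)) + c) ≡ i
    inv {c} {d} d+c≡0 i = begin
      to (from (to (from i + d)) + c) ≡⟨ cong (λ x → to (x + c)) (strictlyInverseʳ _) ⟩
      to (from i + d + c)             ≡⟨ cong to (cancel (from i) d+c≡0) ⟩
      to (from i)                     ≡⟨ strictlyInverseˡ i ⟩
      i                               ∎

    shift : Permutation q q
    shift = permutation (λ i → to (from i + 1#)) (λ i → to (from i + - 1#)) (inv (-‿inverseˡ 1#)) (inv (-‿inverseʳ 1#))

  -- By `order×1≡0` the k-th power of `1# + 1#` vanishes. Cancelling one nonzero factor at a time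
  -- would end at `1# ≡ 0#`.
  even⇒char2 : ∀ k → q ≡ 2 ℕ.^ k → 1# + 1# ≡ 0#
  even⇒char2 k q≡2^k = root k (trans (cong (_· 1#) (sym q≡2^k)) order×1≡0)
    where
    root : ∀ k → (2 ℕ.^ k) · 1# ≡ 0# → 1# + 1# ≡ 0#
    root ℕ.zero e = contradiction (trans (sym e) (+-identityʳ 1#)) 0≢1
    root (ℕ.suc k) e with 1# + 1# ≟ 0#
    ... | yes 2≡0 = 2≡0
    ... | no 2≢0 = root k (*-cancel-0 2≢0 (trans (cong (_* ((2 ℕ.^ k) · 1#)) (cong (1# +_) (sym (+-identityʳ 1#)))) (trans (sym (×1-homo-* 2 (2 ℕ.^ k))) e)))

-- Algebra and the parabola in characteristic 2

module Char2 {q : ℕ} (F : FiniteField q) (2≡0 : HasChar2 F) where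
  open FiniteField F
  open Field F
  open CommutativeRing commutativeRing using (+-assoc; +-identityˡ; +-identityʳ; *-identityˡ; *-identityʳ; zeroˡ; zeroʳ; distribˡ; -‿inverseʳ)
  open Inverse enum using (to; from; strictlyInverseˡ)

  x+x≡0 : ∀ x → x + x ≡ 0#
  x+x≡0 x = begin
    x + x           ≡⟨ cong₂ _+_ (*-identityʳ x) (*-identityʳ x) ⟨
    x * 1# + x * 1# ≡⟨ distribˡ x 1# 1# ⟨
    x * (1# + 1#)   ≡⟨ cong (x *_) 2≡0 ⟩
    x * 0#          ≡⟨ zeroʳ x ⟩
    0#              ∎
    where open ≡-Reasoning

  +≡0⇒≡ : ∀ {x y} → x + y ≡ 0# → x ≡ y
  +≡0⇒≡ {x} {y} x+y≡0 = begin
    x           ≡⟨ +-identityʳ x ⟨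
    x + 0#      ≡⟨ cong (x +_) (x+x≡0 y) ⟨
    x + (y + y) ≡⟨ +-assoc x y y ⟨
    x + y + y   ≡⟨ cong (_+ y) x+y≡0 ⟩
    0# + y      ≡⟨ +-identityˡ y ⟩
    y           ∎
    where open ≡-Reasoning

  ≡⇒+≡0 : ∀ {x y} → x ≡ y → x + y ≡ 0#
  ≡⇒+≡0 refl = x+x≡0 _

  GF2 : RawRing 0ℓ 0ℓ
  GF2 = record { Carrier = Bool ; _≈_ = _≡_ ; _+_ = _xor_ ; _*_ = _∧_ ; -_ = λ b → b ; 0# = false ; 1# = true }

  -- Ring solver with coefficients in GF(2), so that it normalises modulo x + x = 0.
  prime-subfield : GF2 -Raw-AlmostCommutative⟶ fromCommutativeRing commutativeRing
  prime-subfield = record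
    { ⟦_⟧ = ⟦_⟧
    ; +-homo = +-homo
    ; *-homo = *-homo
    ; -‿homo = neg-homo
    ; 0-homo = refl
    ; 1-homo = refl
    }
    where
    ⟦_⟧ : Bool → Carrier
    ⟦ false ⟧ = 0#
    ⟦ true ⟧ = 1#

    +-homo : ∀ a b → ⟦ a xor b ⟧ ≡ ⟦ a ⟧ + ⟦ b ⟧
    +-homo false b = sym (+-identityˡ _)
    +-homo true false = sym (+-identityʳ _)
    +-homo true true = sym 2≡0

    *-homo : ∀ a b → ⟦ a ∧ b ⟧ ≡ ⟦ a ⟧ * ⟦ b ⟧
    *-homo false b = sym (zeroˡ _)
    *-homo true b = sym (*-identityˡ _)

    neg-homo : ∀ a → ⟦ a ⟧ ≡ - ⟦ a ⟧
    neg-homo a = +≡0⇒≡ (-‿inverseʳ ⟦ a ⟧)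

  open RingSolver GF2 (fromCommutativeRing commutativeRing) prime-subfield
    (λ a b → Maybe.map (cong (_-Raw-AlmostCommutative⟶_.⟦_⟧ prime-subfield)) (dec⇒weaklyDec Bool._≟_ a b)) public
    using (solve; _:=_; _:+_; _:*_; con; Polynomial)

  :0 :1 : ∀ {n} → Polynomial n
  :0 = con false
  :1 = con true

  -- The identity expressing e through the eᵢ is left to the solver, which cannot use the eᵢ ≡ 0# itself.
  lc₁ : ∀ {e e₁} c₁ → e ≡ c₁ * e₁ → e₁ ≡ 0# → e ≡ 0#
  lc₁ c₁ e refl = trans e (zeroʳ c₁)

  lc₂ : ∀ {e e₁ e₂} c₁ c₂ → e ≡ c₁ * e₁ + c₂ * e₂ → e₁ ≡ 0# → e₂ ≡ 0# → e ≡ 0#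
  lc₂ c₁ c₂ e refl refl = trans e (trans (cong₂ _+_ (zeroʳ c₁) (zeroʳ c₂)) (+-identityʳ 0#))

  lc₃ : ∀ {e e₁ e₂ e₃} c₁ c₂ c₃ → e ≡ c₁ * e₁ + c₂ * e₂ + c₃ * e₃ → e₁ ≡ 0# → e₂ ≡ 0# → e₃ ≡ 0# → e ≡ 0#
  lc₃ c₁ c₂ c₃ e refl refl h = lc₂ 1# c₃ (trans e (cong₂ _+_ (trans (lc₂ c₁ c₂ refl refl refl) (sym (zeroʳ 1#))) refl)) refl h

  infix 8 _²
  _² : Carrier → Carrier
  x ² = x * x

  x²≡0⇒x≡0 : ∀ {x} → x ² ≡ 0# → x ≡ 0#
  x²≡0⇒x≡0 {x} x²≡0 with x ≟ 0#
  ... | yes x≡0 = x≡0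
  ... | no x≢0 = *-cancel-0 x≢0 x²≡0

  ²-injective : ∀ {x y} → x ² ≡ y ² → x ≡ y
  ²-injective {x} {y} x²≡y² = +≡0⇒≡ (x²≡0⇒x≡0 (trans (solve 2 (λ x y → (x :+ y) :* (x :+ y) := x :* x :+ y :* y) refl x y) (≡⇒+≡0 x²≡y²)))

  -- Squaring is injective, hence onto, once the enumeration turns it into a self-map of `Fin q`.
  √ : ∀ x → ∃[ y ] y ² ≡ x
  √ x with injective⇒surjective {f = λ i → to (from i ²)} from²-injective (to x)
    where
    from²-injective : Injective _≡_ _≡_ (λ i → to (from i ²))
    from²-injective {i} {j} eq = trans (sym (strictlyInverseˡ i)) (trans (cong to (²-injective (to-injective eq))) (strictlyInverseˡ j))
  ... | i , to≡ = from i , to-injective to≡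

  -- x and x′ are recovered from δ = x + x′, for which y² + (l + m) z = l m δ².
  parabola-chord : ∀ l m → l ≢ 0# → m ≢ 0# → l + m ≢ 0# → ∀ y z →
    ∃[ x ] ∃[ x′ ] (y ≡ l * x + m * x′ × z ≡ l * x ² + m * x′ ²)
  parabola-chord l m l≢0 m≢0 l+m≢0 y z = x , x + δ
    , sym (+≡0⇒≡ (lc₁ (y + m * δ) (solve 5 (λ l m y σ δ → l :* (σ :* (y :+ m :* δ)) :+ m :* (σ :* (y :+ m :* δ) :+ δ) :+ y := (y :+ m :* δ) :* ((l :+ m) :* σ :+ :1)) refl l m y σ δ) A≡0))
    , sym (+≡0⇒≡ (lc₃ (σ * (y ² + m ² * δ ²) + m * δ ² + z) (σ * (l * m)) (σ * (y ² + (l + m) * z))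
        (solve 7 (λ l m y z σ ν δ → l :* ((σ :* (y :+ m :* δ)) :* (σ :* (y :+ m :* δ))) :+ m :* ((σ :* (y :+ m :* δ) :+ δ) :* (σ :* (y :+ m :* δ) :+ δ)) :+ z
          := (σ :* (y :* y :+ m :* m :* (δ :* δ)) :+ m :* (δ :* δ) :+ z) :* ((l :+ m) :* σ :+ :1) :+ σ :* (l :* m) :* (δ :* δ :+ ν :* (y :* y :+ (l :+ m) :* z)) :+ σ :* (y :* y :+ (l :+ m) :* z) :* (l :* m :* ν :+ :1)) refl l m y z σ ν δ)
        A≡0 (≡⇒+≡0 δ²≡) G≡0))
    where
    σ = proj₁ (inverse (l + m) l+m≢0)
    ν = proj₁ (inverse (l * m) (*-≢0 l≢0 m≢0))
    δ = proj₁ (√ (ν * (y ² + (l + m) * z)))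
    δ²≡ = proj₂ (√ (ν * (y ² + (l + m) * z)))
    A≡0 = ≡⇒+≡0 (proj₂ (inverse (l + m) l+m≢0))
    G≡0 = ≡⇒+≡0 (proj₂ (inverse (l * m) (*-≢0 l≢0 m≢0)))
    x = σ * (y + m * δ)

  -- Eliminating `a` from the two equations leaves b y (x + y) = 0.
  parabola-pair : ∀ {a b x y} → a ≢ 0# → b ≢ 0# → a * x + b * y ≡ 0# → a * x ² + b * y ² ≡ 0# → x ≡ y
  parabola-pair {a} {b} {x} {y} a≢0 b≢0 e₁ e₂ with y ≟ 0#
  ... | yes refl = *-cancel-0 a≢0 (trans (solve 3 (λ a b x → a :* x := a :* x :+ b :* :0) refl a b x) e₁)
  ... | no y≢0 = +≡0⇒≡ (*-cancel-0 (*-≢0 b≢0 y≢0) (lc₂ x 1# (solve 4 (λ a b x y → b :* y :* (x :+ y) := x :* (a :* x :+ b :* y) :+ :1 :* (a :* (x :* x) :+ b :* (y :* y))) refl a b x y) e₁ e₂))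

  parabola-pair-weights : ∀ {a b x y} → a ≢ 0# → b ≢ 0# → y ≢ 0# → a * x + b * y ≡ 0# → a * x ² + b * y ² ≡ 0# → a ≡ b
  parabola-pair-weights {a} {b} {x} {y} a≢0 b≢0 y≢0 e₁ e₂ with parabola-pair a≢0 b≢0 e₁ e₂
  ... | refl = +≡0⇒≡ (*-cancel-0 y≢0 (trans (solve 3 (λ a b x → x :* (a :+ b) := a :* x :+ b :* x) refl a b x) e₁))

  -- The parabola is an arc. As squaring is additive and the weights sum to zero, translating by `z`
  -- kills the third term and leaves a relation for `parabola-pair`.
  parabola-triple : ∀ {a b c x y z} → a ≢ 0# → b ≢ 0# → c ≢ 0# → a + b + c ≡ 0# →
    a * x + b * y + c * z ≡ 0# → a * x ² + b * y ² + c * z ² ≡ 0# → x ≡ y × y ≡ z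
  parabola-triple {a} {b} {c} {x} {y} {z} a≢0 b≢0 c≢0 e₀ e₁ e₂ = x≡y , trans (sym x≡y) x≡z
    where
    shifted : x + z ≡ y + z
    shifted = parabola-pair a≢0 b≢0
      (lc₂ z 1# (solve 6 (λ a b c x y z → a :* (x :+ z) :+ b :* (y :+ z) := z :* (a :+ b :+ c) :+ :1 :* (a :* x :+ b :* y :+ c :* z)) refl a b c x y z) e₀ e₁)
      (lc₂ (z ²) 1# (solve 6 (λ a b c x y z → a :* ((x :+ z) :* (x :+ z)) :+ b :* ((y :+ z) :* (y :+ z)) := z :* z :* (a :+ b :+ c) :+ :1 :* (a :* (x :* x) :+ b :* (y :* y) :+ c :* (z :* z))) refl a b c x y z) e₀ e₂)
    x≡y : x ≡ y
    x≡y = +≡0⇒≡ (trans (solve 3 (λ x y z → x :+ y := x :+ z :+ (y :+ z)) refl x y z) (≡⇒+≡0 shifted))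
    x≡z : x ≡ z
    x≡z = +≡0⇒≡ (*-cancel-0 c≢0 (lc₃ x 1# b (solve 6 (λ a b c x y z → c :* (x :+ z) := x :* (a :+ b :+ c) :+ :1 :* (a :* x :+ b :* y :+ c :* z) :+ b :* (x :+ y)) refl a b c x y z) e₀ e₁ (≡⇒+≡0 x≡y)))

-- Positions of a mapped list and the labels behind them

module Labels {A B : Set} (f : A → B) where
  label : ∀ xs → Fin (length (map f xs)) → A
  label (x ∷ xs) zero = x
  label (x ∷ xs) (suc i) = label xs i

  lookup-label : ∀ xs i → List.lookup (map f xs) i ≡ f (label xs i)
  lookup-label (x ∷ xs) zero = refl
  lookup-label (x ∷ xs) (suc i) = lookup-label xs i

  label-∈ : ∀ xs i → label xs i ∈ xs
  label-∈ (x ∷ xs) zero = here refl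
  label-∈ (x ∷ xs) (suc i) = there (label-∈ xs i)

  label-surjective : ∀ {xs x} → x ∈ xs → ∃[ i ] label xs i ≡ x
  label-surjective (here refl) = zero , refl
  label-surjective (there x∈xs) with label-surjective x∈xs
  ... | i , eq = suc i , eq

  label-injective : ∀ {xs} → Unique xs → ∀ i j → label xs i ≡ label xs j → i ≡ j
  label-injective {x ∷ xs} (x∉ ∷ u) zero zero eq = refl
  label-injective {x ∷ xs} (x∉ ∷ u) zero (suc j) eq = contradiction eq (All.lookup x∉ (label-∈ xs j))
  label-injective {x ∷ xs} (x∉ ∷ u) (suc i) zero eq = contradiction (sym eq) (All.lookup x∉ (label-∈ xs i))
  label-injective {x ∷ xs} (x∉ ∷ u) (suc i) (suc j) eq = cong suc (label-injective u i j eq)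

-- Caps as labelled families, and covering as completeness

module Caps {q : ℕ} (F : FiniteField q) (2≡0 : HasChar2 F) where
  open FiniteField F
  open Field F
  open Char2 F 2≡0
  open Geometry F
  open CommutativeRing commutativeRing using (+-comm; *-identityˡ; zeroˡ)

  -- A cap with structured labels and coordinates. All weights are nonzero, so each dependence is
  -- met with its exact support; `V` selects the labels in use, such as arm points with nonzero
  -- parameter.
  record IsCapFamily {I J : Set} (V : I → Set) (pt : I → J → Carrier) : Set where
    field
      nonzero : ∀ {i} → V i → ∃[ n ] pt i n ≢ 0#
      pair : ∀ {i j} → V i → V j → i ≢ j → ∀ {a b} → a ≢ 0# → b ≢ 0# → ¬ (∀ n → a * pt i n + b * pt j n ≡ 0#)
      triple : ∀ {i j k} → V i → V j → V k → i ≢ j → j ≢ k → i ≢ k → ∀ {a b c} → a ≢ 0# → b ≢ 0# → c ≢ 0# →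
        ¬ (∀ n → a * pt i n + b * pt j n + c * pt k n ≡ 0#)

  open IsCapFamily

  -- The conditions are symmetric in the points, so relations between points of several kinds need
  -- be refuted in one order of the kinds only.
  sorted⇒cap : ∀ {I J} {V : I → Set} {pt : I → J → Carrier} (rank : I → ℕ) →
    (∀ {i} → V i → ∃[ n ] pt i n ≢ 0#) →
    (∀ {i j} → rank i ℕ.≤ rank j → V i → V j → i ≢ j → ∀ {a b} → a ≢ 0# → b ≢ 0# → ¬ (∀ n → a * pt i n + b * pt j n ≡ 0#)) →
    (∀ {i j k} → rank i ℕ.≤ rank j → rank j ℕ.≤ rank k → V i → V j → V k → i ≢ j → j ≢ k → i ≢ k → ∀ {a b c} → a ≢ 0# → b ≢ 0# → c ≢ 0# →
      ¬ (∀ n → a * pt i n + b * pt j n + c * pt k n ≡ 0#)) →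
    IsCapFamily V pt
  sorted⇒cap {I} {J} {V} {pt} rank nz pr tr = record { nonzero = nz ; pair = pair′ ; triple = triple′ }
    where
    pair′ : ∀ {i j} → V i → V j → i ≢ j → ∀ {a b} → a ≢ 0# → b ≢ 0# → ¬ (∀ n → a * pt i n + b * pt j n ≡ 0#)
    pair′ {i} {j} vi vj i≢j a≢0 b≢0 e with ℕ.≤-total (rank i) (rank j)
    ... | inj₁ i≤j = pr i≤j vi vj i≢j a≢0 b≢0 e
    ... | inj₂ j≤i = pr j≤i vj vi (i≢j ∘ sym) b≢0 a≢0 (λ n → trans (+-comm _ _) (e n))

    Triple : I → I → I → Set
    Triple i j k = V i → V j → V k → i ≢ j → j ≢ k → i ≢ k → ∀ {a b c} → a ≢ 0# → b ≢ 0# → c ≢ 0# →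
        ¬ (∀ n → a * pt i n + b * pt j n + c * pt k n ≡ 0#)

    swap₁₂ : ∀ {i j k} → Triple j i k → Triple i j k
    swap₁₂ t vi vj vk i≢j j≢k i≢k a≢0 b≢0 c≢0 e = t vj vi vk (i≢j ∘ sym) i≢k j≢k b≢0 a≢0 c≢0
      (λ n → trans (solve 3 (λ x y z → y :+ x :+ z := x :+ y :+ z) refl _ _ _) (e n))

    swap₂₃ : ∀ {i j k} → Triple i k j → Triple i j k
    swap₂₃ t vi vj vk i≢j j≢k i≢k a≢0 b≢0 c≢0 e = t vi vk vj i≢k (j≢k ∘ sym) i≢j a≢0 c≢0 b≢0
      (λ n → trans (solve 3 (λ x y z → x :+ z :+ y := x :+ y :+ z) refl _ _ _) (e n))

    triple′ : ∀ {i j k} → Triple i j k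
    triple′ {i} {j} {k} with ℕ.≤-total (rank i) (rank j) | ℕ.≤-total (rank j) (rank k) | ℕ.≤-total (rank i) (rank k)
    ... | inj₁ i≤j | inj₁ j≤k | _        = tr i≤j j≤k
    ... | inj₁ i≤j | inj₂ k≤j | inj₁ i≤k = swap₂₃ (tr i≤k k≤j)
    ... | inj₁ i≤j | inj₂ k≤j | inj₂ k≤i = swap₂₃ (swap₁₂ (tr k≤i i≤j))
    ... | inj₂ j≤i | inj₁ j≤k | inj₁ i≤k = swap₁₂ (tr j≤i i≤k)
    ... | inj₂ j≤i | inj₁ j≤k | inj₂ k≤i = swap₁₂ (swap₂₃ (tr j≤k k≤i))
    ... | inj₂ j≤i | inj₂ k≤j | _        = swap₁₂ (swap₂₃ (swap₁₂ (tr k≤j j≤i)))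

  -- A relation between the new points restricts along `χ` to a relation between the old ones. This
  -- takes a family from structured labels to list positions.
  reindex : ∀ {I I′ J J′ : Set} {V : I → Set} {V′ : I′ → Set} {pt : I → J → Carrier} {pt′ : I′ → J′ → Carrier}
    (ρ : I′ → I) (χ : J → J′) → (∀ {i} → V′ i → V (ρ i)) → (∀ {i j} → V′ i → V′ j → ρ i ≡ ρ j → i ≡ j) →
    (∀ i n → pt′ i (χ n) ≡ pt (ρ i) n) → IsCapFamily V pt → IsCapFamily V′ pt′
  reindex {V = V} {V′} {pt} {pt′} ρ χ valid inj agree fam = record
    { nonzero = λ {i} vi → let (n , p≢0) = nonzero fam (valid vi) in χ n , λ e → p≢0 (trans (sym (agree i n)) e)
    ; pair = λ {i} {j} vi vj i≢j {a} {b} a≢0 b≢0 e → pair fam (valid vi) (valid vj) (i≢j ∘ inj vi vj) a≢0 b≢0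
        (λ n → trans (sym (cong₂ (λ x y → a * x + b * y) (agree i n) (agree j n))) (e (χ n)))
    ; triple = λ {i} {j} {k} vi vj vk i≢j j≢k i≢k {a} {b} {c} a≢0 b≢0 c≢0 e →
        triple fam (valid vi) (valid vj) (valid vk) (i≢j ∘ inj vi vj) (j≢k ∘ inj vj vk) (i≢k ∘ inj vi vk) a≢0 b≢0 c≢0
        (λ n → trans (sym (cong₂ _+_ (cong₂ (λ x y → a * x + b * y) (agree i n) (agree j n)) (cong (c *_) (agree k n)))) (e (χ n)))
    }

  Cap⇒family : ∀ {n} {C : List (Vect n)} → Cap n C → IsCapFamily (λ _ → ⊤) (List.lookup C)
  Cap⇒family {n} {C} (nz , pr , tr) = record
    { nonzero = λ {i} _ → nz i
    ; pair = λ {i} {j} _ _ i≢j {a} {b} a≢0 b≢0 e → pr i j i≢j (same i j a b a≢0 e)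
    ; triple = λ {i} {j} {k} _ _ _ i≢j j≢k i≢k {a} {b} {c} a≢0 b≢0 c≢0 e → tr i j k i≢j j≢k i≢k (a , b , c , (λ (a≡0 , _) → a≢0 a≡0) , e)
    }
    where
    same : ∀ i j a b → a ≢ 0# → (∀ n → a * List.lookup C i n + b * List.lookup C j n ≡ 0#) → SamePoint (List.lookup C i) (List.lookup C j)
    same i j a b a≢0 e with inverse a a≢0
    ... | a⁻¹ , aa⁻¹ = a⁻¹ * b , λ n → +≡0⇒≡ (lc₂ a⁻¹ (List.lookup C i n)
      (solve 5 (λ a b d x y → x :+ d :* b :* y := d :* (a :* x :+ b :* y) :+ x :* (a :* d :+ :1)) refl a b a⁻¹ _ _) (e n) (≡⇒+≡0 aa⁻¹))

  -- `Collinear` admits zero weights. Each pattern of zeros leaves a relation of support one, two or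
  -- three, refuted by `nonzero`, `pair` or `triple`.
  family⇒Cap : ∀ {n} {C : List (Vect n)} → IsCapFamily (λ _ → ⊤) (List.lookup C) → Cap n C
  family⇒Cap {n} {C} fam = (λ i → nonzero fam tt) , distinct , noncollinear
    where
    P = List.lookup C

    distinct : ∀ i j → i ≢ j → ¬ SamePoint (P i) (P j)
    distinct i j i≢j (c , e) = pair fam tt tt i≢j (0≢1 ∘ sym) c≢0 (λ n → trans (cong (_+ c * P j n) (trans (*-identityˡ _) (e n))) (x+x≡0 _))
      where
      c≢0 : c ≢ 0#
      c≢0 refl = let (n , p≢0) = nonzero fam {i} tt in p≢0 (trans (e n) (zeroˡ _))

    noncollinear : ∀ i j k → i ≢ j → j ≢ k → i ≢ k → ¬ Collinear (P i) (P j) (P k)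
    noncollinear i j k i≢j j≢k i≢k (a , b , c , abc≢0 , e) with a ≟ 0# | b ≟ 0# | c ≟ 0#
    ... | yes a≡0 | yes b≡0 | yes c≡0 = abc≢0 (a≡0 , b≡0 , c≡0)
    ... | yes refl | yes refl | no c≢0 = let (n , p≢0) = nonzero fam {k} tt in
      *-≢0 c≢0 p≢0 (trans (solve 4 (λ c x y z → c :* z := :0 :* x :+ :0 :* y :+ c :* z) refl c (P i n) (P j n) (P k n)) (e n))
    ... | yes refl | no b≢0 | yes refl = let (n , p≢0) = nonzero fam {j} tt in
      *-≢0 b≢0 p≢0 (trans (solve 4 (λ b x y z → b :* y := :0 :* x :+ b :* y :+ :0 :* z) refl b (P i n) (P j n) (P k n)) (e n))
    ... | no a≢0 | yes refl | yes refl = let (n , p≢0) = nonzero fam {i} tt in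
      *-≢0 a≢0 p≢0 (trans (solve 4 (λ a x y z → a :* x := a :* x :+ :0 :* y :+ :0 :* z) refl a (P i n) (P j n) (P k n)) (e n))
    ... | yes refl | no b≢0 | no c≢0 = pair fam tt tt j≢k b≢0 c≢0 (λ n → trans (solve 5 (λ b c x y z → b :* y :+ c :* z := :0 :* x :+ b :* y :+ c :* z) refl b c (P i n) (P j n) (P k n)) (e n))
    ... | no a≢0 | yes refl | no c≢0 = pair fam tt tt i≢k a≢0 c≢0 (λ n → trans (solve 5 (λ a c x y z → a :* x :+ c :* z := a :* x :+ :0 :* y :+ c :* z) refl a c (P i n) (P j n) (P k n)) (e n))
    ... | no a≢0 | no b≢0 | yes refl = pair fam tt tt i≢j a≢0 b≢0 (λ n → trans (solve 5 (λ a b x y z → a :* x :+ b :* y := a :* x :+ b :* y :+ :0 :* z) refl a b (P i n) (P j n) (P k n)) (e n))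
    ... | no a≢0 | no b≢0 | no c≢0 = triple fam tt tt tt i≢j j≢k i≢k a≢0 b≢0 c≢0 e

  Covered : ∀ {n} → List (Vect n) → Vect n → Set
  Covered C x = ∃[ i ] ∃[ j ] ∃[ a ] ∃[ b ] (∀ n → x n ≡ a * List.lookup C i n + b * List.lookup C j n)

  covered? : ∀ {n} (C : List (Vect n)) x → Dec (Covered C x)
  covered? C x = Fin.any? λ i → Fin.any? λ j → any? λ a → any? λ b → Fin.all? λ n → x n ≟ a * List.lookup C i n + b * List.lookup C j n

  covering⇒complete : ∀ {n} {C : List (Vect n)} → Cap n C → (∀ x → NonZeroV x → Covered C x) → CompleteCap n C
  covering⇒complete {n} {C} cap cover = cap , full
    where
    full : ∀ x → NonZeroV x → (∀ i → ¬ SamePoint x (List.lookup C i)) → ¬ Cap n (x ∷ C)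
    full x x≢0 new (_ , _ , tr) with cover x x≢0
    ... | i , j , a , b , e with i Fin.≟ j
    ...   | yes refl = new i (a + b , λ n → trans (e n) (solve 3 (λ a b x → a :* x :+ b :* x := (a :+ b) :* x) refl a b _))
    ...   | no i≢j = tr zero (suc i) (suc j) (λ ()) (i≢j ∘ Fin.suc-injective) (λ ())
      (1# , a , b , (λ (1≡0 , _) → 0≢1 (sym 1≡0)) , λ n → trans (solve 3 (λ x y z → :1 :* x :+ y :+ z := x :+ (y :+ z)) refl _ _ _) (≡⇒+≡0 (e n)))

  -- A relation that involves `x` can be divided by the weight of `x`, and then exhibits `x` as
  -- covered.
  extend-cap : ∀ {n} {C : List (Vect n)} {x} → Cap n C → NonZeroV x → ¬ Covered C x → Cap n (x ∷ C)
  extend-cap {n} {C} {x} cap x≢0 uncovered = family⇒Cap {C = x ∷ C} (sorted⇒cap toℕ (λ {i} → nz {i}) pr tr)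
    where
    fam = Cap⇒family {C = C} cap
    P = List.lookup (x ∷ C)

    nz : ∀ {i} → ⊤ → ∃[ n ] P i n ≢ 0#
    nz {zero} _ = x≢0
    nz {suc i} _ = nonzero fam {i} tt

    pr : ∀ {i j} → toℕ i ℕ.≤ toℕ j → ⊤ → ⊤ → i ≢ j → ∀ {a b} → a ≢ 0# → b ≢ 0# → ¬ (∀ n → a * P i n + b * P j n ≡ 0#)
    pr {zero} {zero} _ _ _ i≢j _ _ _ = i≢j refl
    pr {zero} {suc j} _ _ _ _ {a} {b} a≢0 _ e with inverse a a≢0
    ... | d , ad≡1 = uncovered (j , j , d * b , 0# , λ n → +≡0⇒≡ (lc₂ d (x n)
      (solve 5 (λ a b d x y → x :+ (d :* b :* y :+ :0 :* y) := d :* (a :* x :+ b :* y) :+ x :* (a :* d :+ :1)) refl a b d _ _) (e n) (≡⇒+≡0 ad≡1)))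
    pr {suc i} {suc j} _ _ _ i≢j a≢0 b≢0 e = pair fam tt tt (i≢j ∘ cong suc) a≢0 b≢0 e

    tr : ∀ {i j k} → toℕ i ℕ.≤ toℕ j → toℕ j ℕ.≤ toℕ k → ⊤ → ⊤ → ⊤ → i ≢ j → j ≢ k → i ≢ k → ∀ {a b c} → a ≢ 0# → b ≢ 0# → c ≢ 0# →
      ¬ (∀ n → a * P i n + b * P j n + c * P k n ≡ 0#)
    tr {zero} {zero} _ _ _ _ _ i≢j _ _ _ _ _ _ = i≢j refl
    tr {zero} {suc j} {suc k} _ _ _ _ _ _ _ _ {a} {b} {c} a≢0 _ _ e with inverse a a≢0
    ... | d , ad≡1 = uncovered (j , k , d * b , d * c , λ n → +≡0⇒≡ (lc₂ d (x n)
      (solve 7 (λ a b c d x y z → x :+ (d :* b :* y :+ d :* c :* z) := d :* (a :* x :+ b :* y :+ c :* z) :+ x :* (a :* d :+ :1)) refl a b c d _ _ _) (e n) (≡⇒+≡0 ad≡1)))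
    tr {suc i} {suc j} {suc k} _ _ _ _ _ i≢j j≢k i≢k a≢0 b≢0 c≢0 e = triple fam tt tt tt (i≢j ∘ cong suc) (j≢k ∘ cong suc) (i≢k ∘ cong suc) a≢0 b≢0 c≢0 e

  complete⇒covering : ∀ {n} {C : List (Vect n)} → CompleteCap n C → ∀ x → NonZeroV x → Covered C x
  complete⇒covering {n} {C} (cap , full) x x≢0 with covered? C x
  ... | yes covered = covered
  ... | no uncovered = contradiction (extend-cap cap x≢0 uncovered) (full x x≢0
    (λ i (c , e) → uncovered (i , i , c , 0# , λ n → trans (e n) (solve 2 (λ c x → c :* x := c :* x :+ :0 :* x) refl c _))))

increasing-triple : ∀ {i j k : Fin 3} → toℕ i ℕ.< toℕ j → toℕ j ℕ.< toℕ k → i ≡ 0F × j ≡ 1F × k ≡ 2F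
increasing-triple {0F} {1F} {2F} _ _ = refl , refl , refl
increasing-triple {_} {0F} () _
increasing-triple {suc _} {1F} (ℕ.s≤s ()) _
increasing-triple {_} {1F} {0F} _ ()
increasing-triple {_} {1F} {1F} _ (ℕ.s≤s ())
increasing-triple {_} {2F} {0F} _ ()
increasing-triple {_} {2F} {1F} _ (ℕ.s≤s ())
increasing-triple {_} {2F} {2F} _ (ℕ.s≤s (ℕ.s≤s ()))

-- Products of parabolas, conics and the three arms

module Parabola {q : ℕ} (F : FiniteField q) (2≡0 : HasChar2 F) where
  open FiniteField F
  open Field F
  open Char2 F 2≡0
  open Inverse enum using (to; from; strictlyInverseˡ)

  fresh : ∀ {n} → n ℕ.< q → (f : Fin n → Carrier) → ∃[ x ] ∀ i → f i ≢ x
  fresh {n} n<q f with any? (λ x → Fin.all? (λ i → ¬? (f i ≟ x)))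
  ... | yes found = found
  ... | no none = contradiction (Fin.injective⇒≤ {f = g ∘ from} injective) (ℕ.<⇒≱ n<q)
    where
    hit : ∀ x → ∃[ i ] f i ≡ x
    hit x with Fin.any? (λ i → f i ≟ x)
    ... | yes found = found
    ... | no miss = contradiction (x , λ i fi≡x → miss (i , fi≡x)) none

    g : Carrier → Fin n
    g x = proj₁ (hit x)

    injective : Injective _≡_ _≡_ (g ∘ from)
    injective {i} {j} eq = trans (sym (strictlyInverseˡ i)) (trans (cong to (trans (sym (proj₂ (hit (from i)))) (trans (cong f eq) (proj₂ (hit (from j)))))) (strictlyInverseˡ j))

  -- The two coordinates of the parabola point (x, x²), selected by the tag.
  sq : Bool → Carrier → Carrier
  sq false x = x
  sq true x = x ²

  NonZeroVec : ∀ {s} → Vec Carrier s → Set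
  NonZeroVec x = ∃[ j ] lookup x j ≢ 0#

  nonZeroVec? : ∀ {s} (x : Vec Carrier s) → Dec (NonZeroVec x)
  nonZeroVec? x = Fin.any? (λ j → ¬? (lookup x j ≟ 0#))

  ¬nonZero⇒0 : ∀ {s} {f : Fin s → Carrier} → ¬ (∃[ j ] f j ≢ 0#) → ∀ j → f j ≡ 0#
  ¬nonZero⇒0 {f = f} all0 j = Dec.decidable-stable (f j ≟ 0#) (λ fj≢0 → all0 (j , fj≢0))

  lookup-ext : ∀ {s} {x y : Vec Carrier s} → (∀ j → lookup x j ≡ lookup y j) → x ≡ y
  lookup-ext {x = x} {y} eq = trans (sym (Vec.tabulate∘lookup x)) (trans (Vec.tabulate-cong eq) (Vec.tabulate∘lookup y))

  -- For nonzero `c` these are the vectors c (x, x²) with x in the vector space: the directions of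
  -- the chords of the product of parabolas.
  OnConic : ∀ {s} → Carrier → (Bool × Fin s → Carrier) → Set
  OnConic c p = ∀ j → p (false , j) ² ≡ c * p (true , j)

  onConic? : ∀ {s} c (p : Bool × Fin s → Carrier) → Dec (OnConic c p)
  onConic? c p = Fin.all? (λ j → p (false , j) ² ≟ c * p (true , j))

  -- On a conic a nonzero y_j comes with a nonzero z_j, so a nonzero point has some z_j ≠ 0, and
  -- there c = y_j² / z_j. A given tail can therefore spoil only one weight.
  onConic-unique : ∀ {s c d} {p : Bool × Fin s → Carrier} → (∃[ n ] p n ≢ 0#) → OnConic c p → OnConic d p → c ≡ d
  onConic-unique {c = c} {d} {p} ((b , j) , p≢0) onc ond = +≡0⇒≡ (*-cancel-0 (z≢0 b p≢0) (trans
      (solve 3 (λ c d z → z :* (c :+ d) := c :* z :+ d :* z) refl c d (p (true , j)))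
      (≡⇒+≡0 (trans (sym (onc j)) (ond j)))))
    where
    z≢0 : ∀ b → p (b , j) ≢ 0# → p (true , j) ≢ 0#
    z≢0 true p≢0 z≡0 = p≢0 z≡0
    z≢0 false p≢0 z≡0 = p≢0 (x²≡0⇒x≡0 (trans (onc j) (trans (cong (c *_) z≡0) (solve 1 (λ c → c :* :0 := :0) refl c))))

  parabola-chords : ∀ {s l m} → l ≢ 0# → m ≢ 0# → l + m ≢ 0# → (p : Bool × Fin s → Carrier) →
    ∃[ x ] ∃[ y ] (∀ b j → p (b , j) ≡ l * sq b (lookup x j) + m * sq b (lookup y j))
  parabola-chords {s} {l} {m} l≢0 m≢0 l+m≢0 p = tabulate x , tabulate y , agree
    where
    chord = λ j → parabola-chord l m l≢0 m≢0 l+m≢0 (p (false , j)) (p (true , j))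
    x y : Fin s → Carrier
    x j = proj₁ (chord j)
    y j = proj₁ (proj₂ (chord j))

    agree′ : ∀ b j → p (b , j) ≡ l * sq b (x j) + m * sq b (y j)
    agree′ false j = proj₁ (proj₂ (proj₂ (chord j)))
    agree′ true j = proj₂ (proj₂ (proj₂ (chord j)))

    agree : ∀ b j → p (b , j) ≡ l * sq b (lookup (tabulate x) j) + m * sq b (lookup (tabulate y) j)
    agree b j = trans (agree′ b j) (sym (cong₂ (λ u v → l * sq b u + m * sq b v) (Vec.lookup∘tabulate x j) (Vec.lookup∘tabulate y j)))

  -- With the first end at 0 the chord degenerates to `m` times a parabola point. This is the only
  -- way in which a chord can miss an arm.
  chord-end₁-zero⇒onConic : ∀ {l m x y u v} → u ≡ l * x + m * y → v ≡ l * x ² + m * y ² → x ≡ 0# → u ² ≡ m * v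
  chord-end₁-zero⇒onConic {l} {m} {y = y} refl refl refl =
    solve 3 (λ l m y → (l :* :0 :+ m :* y) :* (l :* :0 :+ m :* y) := m :* (l :* (:0 :* :0) :+ m :* (y :* y))) refl l m y

  chord-end₂-zero⇒onConic : ∀ {l m x y u v} → u ≡ l * x + m * y → v ≡ l * x ² + m * y ² → y ≡ 0# → u ² ≡ l * v
  chord-end₂-zero⇒onConic {l} {m} {x} refl refl refl =
    solve 3 (λ l m x → (l :* x :+ m :* :0) :* (l :* x :+ m :* :0) := l :* (l :* (x :* x) :+ m :* (:0 :* :0))) refl l m x

  module Vertices (κ : Carrier) (κ≢0 : κ ≢ 0#) (κ≢1 : κ ≢ 1#) (κ²+κ+1≢0 : κ ² + κ + 1# ≢ 0#) where
    -- Coordinates of the three vertices in the basis `v₀`, `v₁`; the last one is κ (v₀ + v₁).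
    A B : Fin 3 → Carrier
    A 0F = 1#
    A 1F = 0#
    A 2F = κ
    B 0F = 0#
    B 1F = 1#
    B 2F = κ

    vertex-nonzero : ∀ i {α} → α * A i ≡ 0# → α * B i ≡ 0# → α ≡ 0#
    vertex-nonzero 0F {α} eA eB = trans (solve 1 (λ α → α := α :* :1) refl α) eA
    vertex-nonzero 1F {α} eA eB = trans (solve 1 (λ α → α := α :* :1) refl α) eB
    vertex-nonzero 2F {α} eA eB = *-cancel-0 κ≢0 (trans (solve 2 (λ α κ → κ :* α := α :* κ) refl α κ) eA)

    vertex-pair : ∀ i j → i ≢ j → ∀ {α β} → α * A i + β * A j ≡ 0# → α * B i + β * B j ≡ 0# → α ≡ 0# × β ≡ 0#
    vertex-pair 0F 0F i≢j _ _ = contradiction refl i≢j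
    vertex-pair 1F 1F i≢j _ _ = contradiction refl i≢j
    vertex-pair 2F 2F i≢j _ _ = contradiction refl i≢j
    vertex-pair 0F 1F _ {α} {β} eA eB = trans (solve 2 (λ α β → α := α :* :1 :+ β :* :0) refl α β) eA , trans (solve 2 (λ α β → β := α :* :0 :+ β :* :1) refl α β) eB
    vertex-pair 1F 0F _ {α} {β} eA eB = trans (solve 2 (λ α β → α := α :* :1 :+ β :* :0) refl α β) eB , trans (solve 2 (λ α β → β := α :* :0 :+ β :* :1) refl α β) eA
    vertex-pair 0F 2F _ {α} {β} eA eB = lc₂ 1# 1# (solve 3 (λ α β κ → α := :1 :* (α :* :1 :+ β :* κ) :+ :1 :* (α :* :0 :+ β :* κ)) refl α β κ) eA eB
      , *-cancel-0 κ≢0 (trans (solve 3 (λ α β κ → κ :* β := α :* :0 :+ β :* κ) refl α β κ) eB)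
    vertex-pair 1F 2F _ {α} {β} eA eB = lc₂ 1# 1# (solve 3 (λ α β κ → α := :1 :* (α :* :0 :+ β :* κ) :+ :1 :* (α :* :1 :+ β :* κ)) refl α β κ) eA eB
      , *-cancel-0 κ≢0 (trans (solve 3 (λ α β κ → κ :* β := α :* :0 :+ β :* κ) refl α β κ) eA)
    vertex-pair 2F 0F _ {α} {β} eA eB = *-cancel-0 κ≢0 (trans (solve 3 (λ α β κ → κ :* α := α :* κ :+ β :* :0) refl α β κ) eB)
      , lc₂ 1# 1# (solve 3 (λ α β κ → β := :1 :* (α :* κ :+ β :* :1) :+ :1 :* (α :* κ :+ β :* :0)) refl α β κ) eA eB
    vertex-pair 2F 1F _ {α} {β} eA eB = *-cancel-0 κ≢0 (trans (solve 3 (λ α β κ → κ :* α := α :* κ :+ β :* :0) refl α β κ) eA)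
      , lc₂ 1# 1# (solve 3 (λ α β κ → β := :1 :* (α :* κ :+ β :* :0) :+ :1 :* (α :* κ :+ β :* :1)) refl α β κ) eA eB

    module Arms (v₀ v₁ : Bool → Carrier) (independent : ∀ {α β} → (∀ b → α * v₀ b + β * v₁ b ≡ 0#) → α ≡ 0# × β ≡ 0#) where
      vertex : Fin 3 → Bool → Carrier
      vertex i b = A i * v₀ b + B i * v₁ b

      arm : ∀ {s} → Fin 3 → Vec Carrier s → Bool × Fin (ℕ.suc s) → Carrier
      arm i x (b , zero) = vertex i b
      arm i x (b , suc j) = sq b (lookup x j)

      vertex≢0 : ∀ i {α} → (∀ b → α * vertex i b ≡ 0#) → α ≡ 0#
      vertex≢0 i {α} e = vertex-nonzero i (proj₁ ind) (proj₂ ind)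
        where
        ind = independent {α * A i} {α * B i} (λ b → trans (solve 5 (λ α a b v w → α :* a :* v :+ α :* b :* w := α :* (a :* v :+ b :* w)) refl α (A i) (B i) _ _) (e b))

      vertex-independent : ∀ {i j} → i ≢ j → ∀ {α β} → (∀ b → α * vertex i b + β * vertex j b ≡ 0#) → α ≡ 0# × β ≡ 0#
      vertex-independent {i} {j} i≢j {α} {β} e = vertex-pair i j i≢j (proj₁ ind) (proj₂ ind)
        where
        ind = independent {α * A i + β * A j} {α * B i + β * B j} (λ b → trans (solve 8 (λ α β a b a′ b′ v w →
          (α :* a :+ β :* a′) :* v :+ (α :* b :+ β :* b′) :* w := α :* (a :* v :+ b :* w) :+ β :* (a′ :* v :+ b′ :* w)) refl α β (A i) (B i) (A j) (B j) _ _) (e b))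

      vertex-triangle : ∀ {a b c} → (∀ n → a * vertex 0F n + b * vertex 1F n + c * vertex 2F n ≡ 0#) → a ≡ κ * c × b ≡ κ * c
      vertex-triangle {a} {b} {c} e = +≡0⇒≡ (proj₁ ind) , +≡0⇒≡ (proj₂ ind)
        where
        ind = independent {a + κ * c} {b + κ * c} (λ n → trans (solve 6 (λ a b c κ v w →
          (a :+ κ :* c) :* v :+ (b :+ κ :* c) :* w := a :* (:1 :* v :+ :0 :* w) :+ b :* (:0 :* v :+ :1 :* w) :+ c :* (κ :* v :+ κ :* w)) refl a b c κ (v₀ n) (v₁ n)) (e n))

      same-vertex : ∀ {i j} {α β} → α ≢ 0# → (∀ n → α * vertex i n + β * vertex j n ≡ 0#) → i ≡ j × α ≡ β
      same-vertex {i} {j} {α} {β} α≢0 e with i Fin.≟ j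
      ... | no i≢j = contradiction (proj₁ (vertex-independent i≢j e)) α≢0
      ... | yes refl = refl , +≡0⇒≡ (vertex≢0 i (λ n → trans (solve 3 (λ α β v → (α :+ β) :* v := α :* v :+ β :* v) refl α β _) (e n)))

      arm-pair : ∀ {s i j} {x y : Vec Carrier s} {a b} → a ≢ 0# → b ≢ 0# → (∀ n → a * arm i x n + b * arm j y n ≡ 0#) → i ≡ j × x ≡ y
      arm-pair a≢0 b≢0 e = proj₁ (same-vertex a≢0 (λ b → e (b , zero))) , lookup-ext (λ j → parabola-pair a≢0 b≢0 (e (false , suc j)) (e (true , suc j)))

      -- On one arm this is `parabola-triple`. If exactly two points share an arm, the independence
      -- of two vertices kills a weight. On three arms the vertices force weights κc, κc, c; the
      -- first two tails then merge into one with parameter x + y, and comparing it with z ≠ 0 gives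
      -- κ = 1.
      arm-triple : ∀ {s i j k} {x y z : Vec Carrier s} {a b c} → toℕ i ℕ.≤ toℕ j → toℕ j ℕ.≤ toℕ k → NonZeroVec z →
        (i ≡ j → x ≢ y) → a ≢ 0# → b ≢ 0# → c ≢ 0# → ¬ (∀ n → a * arm i x n + b * arm j y n + c * arm k z n ≡ 0#)
      arm-triple {s} {i} {j} {k} {x} {y} {z} {a} {b} {c} i≤j j≤k (n , z≢0) x≢y a≢0 b≢0 c≢0 e with i Fin.≟ j | j Fin.≟ k
      ... | yes refl | yes refl = x≢y refl (lookup-ext (λ n → proj₁ (parabola-triple a≢0 b≢0 c≢0
        (vertex≢0 i (λ n → trans (solve 4 (λ a b c v → (a :+ b :+ c) :* v := a :* v :+ b :* v :+ c :* v) refl a b c _) (e (n , zero))))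
        (e (false , suc n)) (e (true , suc n)))))
      ... | yes refl | no j≢k = c≢0 (proj₂ (vertex-independent j≢k {a + b} {c} (λ n → trans (solve 5 (λ a b c v w → (a :+ b) :* v :+ c :* w := a :* v :+ b :* v :+ c :* w) refl a b c _ _) (e (n , zero)))))
      ... | no i≢j | yes refl = a≢0 (proj₁ (vertex-independent i≢j {a} {b + c} (λ n → trans (solve 5 (λ a b c v w → a :* v :+ (b :+ c) :* w := a :* v :+ b :* w :+ c :* w) refl a b c _ _) (e (n , zero)))))
      ... | no i≢j | no j≢k with increasing-triple (ℕ.≤∧≢⇒< i≤j (i≢j ∘ Fin.toℕ-injective)) (ℕ.≤∧≢⇒< j≤k (j≢k ∘ Fin.toℕ-injective))
      ...   | refl , refl , refl = κ≢1 (+≡0⇒≡ (*-cancel-0 c≢0 (trans (solve 2 (λ κ c → c :* (κ :+ :1) := κ :* c :+ c) refl κ c) (≡⇒+≡0 κc≡c))))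
        where
        weights : a ≡ κ * c × b ≡ κ * c
        weights = vertex-triangle (λ n → e (n , zero))
        a≡κc = proj₁ weights
        b≡κc = proj₂ weights
        κc≡c : κ * c ≡ c
        κc≡c = parabola-pair-weights {x = lookup x n + lookup y n} (*-≢0 κ≢0 c≢0) c≢0 z≢0
          (lc₃ 1# (lookup x n) (lookup y n) (solve 7 (λ a b c κ x y z → κ :* c :* (x :+ y) :+ c :* z := :1 :* (a :* x :+ b :* y :+ c :* z) :+ x :* (a :+ κ :* c) :+ y :* (b :+ κ :* c)) refl a b c κ _ _ _)
            (e (false , suc n)) (≡⇒+≡0 a≡κc) (≡⇒+≡0 b≡κc))
          (lc₃ 1# (lookup x n ²) (lookup y n ²) (solve 7 (λ a b c κ x y z → κ :* c :* ((x :+ y) :* (x :+ y)) :+ c :* (z :* z) := :1 :* (a :* (x :* x) :+ b :* (y :* y) :+ c :* (z :* z)) :+ x :* x :* (a :+ κ :* c) :+ y :* y :* (b :+ κ :* c)) refl a b c κ _ _ _)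
            (e (true , suc n)) (≡⇒+≡0 a≡κc) (≡⇒+≡0 b≡κc))

      ArmCovered : ∀ {s} → (Bool × Fin (ℕ.suc s) → Carrier) → Set
      ArmCovered {s} p = ∃[ i ] ∃[ j ] ∃[ x ] ∃[ y ] ∃[ a ] ∃[ b ] (NonZeroVec x × NonZeroVec y × ∀ n → p n ≡ a * arm {s} i x n + b * arm j y n)

      module Cover {s} (4<q : 4 ℕ.< q) (p : Bool × Fin (ℕ.suc s) → Carrier) (tail≢0 : ∃[ b ] ∃[ j ] p (b , suc j) ≢ 0#) where
        tail : Bool × Fin s → Carrier
        tail (b , j) = p (b , suc j)

        tail-nonzero : ∃[ n ] tail n ≢ 0#
        tail-nonzero = let (b , j , p≢0) = tail≢0 in (b , j) , p≢0

        -- The head fixes the weights and `parabola-chords` realises the tail. The two conic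
        -- hypotheses are what keeps the ends away from parameter 0.
        chord : ∀ {i j l m} → l ≢ 0# → m ≢ 0# → l + m ≢ 0# → ¬ OnConic l tail → ¬ OnConic m tail →
          (∀ b → p (b , zero) ≡ l * vertex i b + m * vertex j b) → ArmCovered p
        chord {i} {j} {l} {m} l≢0 m≢0 l+m≢0 offl offm head = i , j , x , y , l , m , x-nonzero , y-nonzero , agree
          where
          chords = parabola-chords l≢0 m≢0 l+m≢0 tail
          x = proj₁ chords
          y = proj₁ (proj₂ chords)
          agree-tail = proj₂ (proj₂ chords)

          agree : ∀ n → p n ≡ l * arm i x n + m * arm j y n
          agree (b , zero) = head b
          agree (b , suc j) = agree-tail b j

          x-nonzero : NonZeroVec x
          x-nonzero = Dec.decidable-stable (nonZeroVec? x) (λ x≡0 →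
            offm (λ j → chord-end₁-zero⇒onConic (agree-tail false j) (agree-tail true j) (¬nonZero⇒0 x≡0 j)))

          y-nonzero : NonZeroVec y
          y-nonzero = Dec.decidable-stable (nonZeroVec? y) (λ y≡0 →
            offl (λ j → chord-end₂-zero⇒onConic (agree-tail false j) (agree-tail true j) (¬nonZero⇒0 y≡0 j)))

        -- A name for the only weight the tail can spoil, with `0#` as a dummy if there is none, so
        -- that avoiding it becomes an inequation.
        the-conic : ∃[ c ] ∀ {d} → OnConic d tail → d ≡ c
        the-conic with any? (λ c → onConic? c tail)
        ... | yes (c , onc) = c , λ ond → onConic-unique tail-nonzero ond onc
        ... | no none = 0# , λ {d} ond → contradiction (d , ond) none

        -- Both ends go on the same arm, with γ split as l + (l + γ). That both weights are nonzero
        -- and off the conic excludes four values of `l`, whence 4 < q.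
        single-arm : ∀ i γ → γ ≢ 0# → (∀ b → p (b , zero) ≡ γ * vertex i b) → ArmCovered p
        single-arm i γ γ≢0 head = chord {i} {i} {l} {l + γ} (off 0F ∘ sym) (off 1F ∘ sym ∘ +≡0⇒≡)
            (λ e → γ≢0 (trans (solve 2 (λ l γ → γ := l :+ (l :+ γ)) refl l γ) e))
            (off 2F ∘ sym ∘ is-c)
            (λ on → off 3F (trans (cong (_+ γ) (sym (is-c on))) (solve 2 (λ l γ → l :+ γ :+ γ := l) refl l γ)))
            (λ b → trans (head b) (solve 3 (λ l γ v → γ :* v := l :* v :+ (l :+ γ) :* v) refl l γ _))
          where
          c = proj₁ the-conic
          is-c : ∀ {d} → OnConic d tail → d ≡ c
          is-c = proj₂ the-conic
          bad : Fin 4 → Carrier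
          bad 0F = 0#
          bad 1F = γ
          bad 2F = c
          bad 3F = c + γ
          l = proj₁ (fresh 4<q bad)
          off : ∀ i → bad i ≢ l
          off = proj₂ (fresh 4<q bad)

        ι = proj₁ (inverse κ κ≢0)
        κι+1≡0 = ≡⇒+≡0 (proj₂ (inverse κ κ≢0))

        ι≢0 : ι ≢ 0#
        ι≢0 ι≡0 = 0≢1 (trans (trans (solve 1 (λ κ → :0 := κ :* :0) refl κ) (cong (κ *_) (sym ι≡0))) (proj₂ (inverse κ κ≢0)))

        -- The chord from j fails only if α + β = α/κ; the one from i fails only if α + β = β/κ or β/κ = α. Together they force α = β or κ² + κ + 1 = 0.
        two-arms-on-conic : ∀ i j → (∀ b → vertex 2F b ≡ κ * (vertex i b + vertex j b)) → ∀ α β → α ≢ 0# → β ≢ 0# → α ≢ β →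
          OnConic α tail → (∀ b → p (b , zero) ≡ α * vertex i b + β * vertex j b) → ArmCovered p
        two-arms-on-conic i j v₂≡ α β α≢0 β≢0 α≢β onα head with α + β + α * ι ≟ 0#
        ... | no ≢0 = chord {j} {2F} {α + β} {α * ι} (α≢β ∘ +≡0⇒≡) (*-≢0 α≢0 ι≢0) ≢0 off-sum
            (λ on → κ≢1 (+≡0⇒≡ (*-cancel-0 α≢0 (lc₂ α κ
              (solve 3 (λ α κ ι → α :* (κ :+ :1) := α :* (κ :* ι :+ :1) :+ κ :* (α :+ α :* ι)) refl α κ ι) κι+1≡0 (≡⇒+≡0 (onConic-unique tail-nonzero onα on))))))
            (λ b → +≡0⇒≡ (lc₃ 1# (α * ι) (α * (vertex i b + vertex j b))
              (solve 8 (λ α β κ ι p v w u → p :+ ((α :+ β) :* w :+ α :* ι :* u) := :1 :* (p :+ (α :* v :+ β :* w)) :+ α :* ι :* (u :+ κ :* (v :+ w)) :+ α :* (v :+ w) :* (κ :* ι :+ :1)) refl α β κ ι _ _ _ _)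
              (≡⇒+≡0 (head b)) (≡⇒+≡0 (v₂≡ b)) κι+1≡0))
          where
          off-sum : ¬ OnConic (α + β) tail
          off-sum on = β≢0 (trans (solve 2 (λ α β → β := α :+ (α :+ β)) refl α β) (≡⇒+≡0 (onConic-unique tail-nonzero onα on)))
        ... | yes ≡0 = chord {i} {2F} {α + β} {β * ι} (α≢β ∘ +≡0⇒≡) (*-≢0 β≢0 ι≢0)
            (λ e → *-≢0 (α≢β ∘ +≡0⇒≡) ι≢0 (lc₂ 1# 1# (solve 3 (λ α β ι → (α :+ β) :* ι := :1 :* (α :+ β :+ α :* ι) :+ :1 :* (α :+ β :+ β :* ι)) refl α β ι) ≡0 e))
            (λ on → β≢0 (trans (solve 2 (λ α β → β := α :+ (α :+ β)) refl α β) (≡⇒+≡0 (onConic-unique tail-nonzero onα on))))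
            (λ on → contra (≡⇒+≡0 (onConic-unique tail-nonzero onα on)))
            (λ b → +≡0⇒≡ (lc₃ 1# (β * ι) (β * (vertex i b + vertex j b))
              (solve 8 (λ α β κ ι p v w u → p :+ ((α :+ β) :* v :+ β :* ι :* u) := :1 :* (p :+ (α :* v :+ β :* w)) :+ β :* ι :* (u :+ κ :* (v :+ w)) :+ β :* (v :+ w) :* (κ :* ι :+ :1)) refl α β κ ι _ _ _ _)
              (≡⇒+≡0 (head b)) (≡⇒+≡0 (v₂≡ b)) κι+1≡0))
          where
          contra : α + β * ι ≢ 0#
          contra e = *-≢0 α≢0 κ²+κ+1≢0 (lc₃ (κ ²) κ (α + κ * β)
            (solve 4 (λ α β κ ι → α :* (κ :* κ :+ κ :+ :1) := κ :* κ :* (α :+ β :* ι) :+ κ :* (α :+ β :+ α :* ι) :+ (α :+ κ :* β) :* (κ :* ι :+ :1)) refl α β κ ι) e ≡0 κι+1≡0)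

        -- A head proportional to a vertex is reached from a single arm. Otherwise α, β and α + β
        -- are nonzero and the chord from `v₀` to `v₁` works, unless the tail lies on the conic of α
        -- or of β; then one end moves to the third arm.
        cover : ∀ α β → ¬ (α ≡ 0# × β ≡ 0#) → (∀ b → p (b , zero) ≡ α * v₀ b + β * v₁ b) → ArmCovered p
        cover α β αβ≢0 head with α ≟ 0# | β ≟ 0# | α ≟ β
        ... | yes refl | yes refl | _ = contradiction (refl , refl) αβ≢0
        ... | yes refl | no β≢0 | _ = single-arm 1F β β≢0 (λ b → trans (head b) (solve 3 (λ β v w → :0 :* v :+ β :* w := β :* (:0 :* v :+ :1 :* w)) refl β _ _))
        ... | no α≢0 | yes refl | _ = single-arm 0F α α≢0 (λ b → trans (head b) (solve 3 (λ α v w → α :* v :+ :0 :* w := α :* (:1 :* v :+ :0 :* w)) refl α _ _))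
        ... | no α≢0 | no β≢0 | yes refl = single-arm 2F (α * ι) (*-≢0 α≢0 ι≢0) (λ b → trans (head b) (+≡0⇒≡ (lc₁ (α * (v₀ b + v₁ b))
          (solve 5 (λ α κ ι v w → α :* v :+ α :* w :+ α :* ι :* (κ :* v :+ κ :* w) := α :* (v :+ w) :* (κ :* ι :+ :1)) refl α κ ι _ _) κι+1≡0)))
        ... | no α≢0 | no β≢0 | no α≢β with onConic? α tail | onConic? β tail
        ...   | yes onα | _ = two-arms-on-conic 0F 1F (λ b → solve 3 (λ κ v w → κ :* v :+ κ :* w := κ :* (:1 :* v :+ :0 :* w :+ (:0 :* v :+ :1 :* w))) refl κ _ _) α β α≢0 β≢0 α≢β onα
                (λ b → trans (head b) (solve 4 (λ α β v w → α :* v :+ β :* w := α :* (:1 :* v :+ :0 :* w) :+ β :* (:0 :* v :+ :1 :* w)) refl α β _ _))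
        ...   | _ | yes onβ = two-arms-on-conic 1F 0F (λ b → solve 3 (λ κ v w → κ :* v :+ κ :* w := κ :* (:0 :* v :+ :1 :* w :+ (:1 :* v :+ :0 :* w))) refl κ _ _) β α β≢0 α≢0 (α≢β ∘ sym) onβ
                (λ b → trans (head b) (solve 4 (λ α β v w → α :* v :+ β :* w := β :* (:0 :* v :+ :1 :* w) :+ α :* (:1 :* v :+ :0 :* w)) refl α β _ _))
        ...   | no offα | no offβ = chord {0F} {1F} α≢0 β≢0 (α≢β ∘ +≡0⇒≡) offα offβ
                (λ b → trans (head b) (solve 4 (λ α β v w → α :* v :+ β :* w := α :* (:1 :* v :+ :0 :* w) :+ β :* (:0 :* v :+ :1 :* w)) refl α β _ _))

-- Enumeration and counting of vectors

length-cartesianProductWith : {A B C : Set} (f : A → B → C) (xs : List A) (ys : List B) →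
  length (cartesianProductWith f xs ys) ≡ length xs ℕ.* length ys
length-cartesianProductWith f [] ys = refl
length-cartesianProductWith f (x ∷ xs) ys = trans (List.length-++ (map (f x) ys))
  (cong₂ ℕ._+_ (List.length-map (f x) ys) (length-cartesianProductWith f xs ys))

record Enumeration {A : Set} (V : A → Set) : Set where
  field
    list : List A
    unique : Unique list
    sound : ∀ {x} → x ∈ list → V x
    complete : ∀ {x} → V x → x ∈ list

module Vectors {q : ℕ} (F : FiniteField q) (2≡0 : HasChar2 F) where
  open FiniteField F
  open Field F
  open Char2 F 2≡0
  open Parabola F 2≡0
  open Inverse enum using (to; from; strictlyInverseˡ; strictlyInverseʳ)
  open Enumeration

  elements : List Carrier
  elements = map from (allFin q)

  elements-unique : Unique elements
  elements-unique = Unique.map⁺ (λ {i} {j} eq → trans (sym (strictlyInverseˡ i)) (trans (cong to eq) (strictlyInverseˡ j))) (Unique.allFin⁺ q)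

  ∈-elements : ∀ x → x ∈ elements
  ∈-elements x = subst (_∈ elements) (strictlyInverseʳ x) (∈-map⁺ from (∈-allFin (to x)))

  vectors : ∀ m → List (Vec Carrier m)
  vectors ℕ.zero = [] ∷ []
  vectors (ℕ.suc m) = cartesianProductWith _∷_ elements (vectors m)

  vectors-unique : ∀ m → Unique (vectors m)
  vectors-unique ℕ.zero = [] ∷ []
  vectors-unique (ℕ.suc m) = Unique.cartesianProductWith⁺ _∷_ Vec.∷-injective elements-unique (vectors-unique m)

  ∈-vectors : ∀ {m} (x : Vec Carrier m) → x ∈ vectors m
  ∈-vectors [] = here refl
  ∈-vectors (a ∷ x) = ∈-cartesianProductWith⁺ _∷_ (∈-elements a) (∈-vectors x)

  length-vectors : ∀ m → length (vectors m) ≡ q ℕ.^ m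
  length-vectors ℕ.zero = refl
  length-vectors (ℕ.suc m) = trans (length-cartesianProductWith _∷_ elements (vectors m))
    (cong₂ ℕ._*_ (trans (List.length-map from (allFin q)) (List.length-tabulate {n = q} (λ i → i))) (length-vectors m))

  nonzero-vectors : ∀ m → Enumeration {Vec Carrier m} NonZeroVec
  nonzero-vectors m = record
    { list = filter nonZeroVec? (vectors m)
    ; unique = Unique.filter⁺ nonZeroVec? (vectors-unique m)
    ; sound = λ x∈ → proj₂ (∈-filter⁻ nonZeroVec? {xs = vectors m} x∈)
    ; complete = λ {x} x≢0 → ∈-filter⁺ nonZeroVec? (∈-vectors x) x≢0
    }

  -- The strictness comes from the omitted zero vector. Used once for each arm, it contributes to
  -- the -N of the bounds.
  length-nonzero-vectors : ∀ m → length (list (nonzero-vectors m)) ℕ.< q ℕ.^ m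
  length-nonzero-vectors m = subst (length (list (nonzero-vectors m)) ℕ.<_) (length-vectors m)
    (List.filter-notAll nonZeroVec? (vectors m) (lose (∈-vectors (replicate m 0#)) (λ (j , ≢0) → ≢0 (Vec.lookup-replicate j 0#))))

  Conic : ∀ {s} → (Bool × Fin s → Carrier) → Set
  Conic p = ∃[ c ] (c ≢ 0# × OnConic c p)

  -- Equal weights merge the two parabola points into a (x + y, (x + y)²), so `p` is a multiple of a
  -- single parabola point. This separates points off the conics from all secants with equal
  -- weights.
  secant⇒conic : ∀ {s a b c} {x y : Vec Carrier s} {p : Bool × Fin s → Carrier} → a ≢ 0# → c ≢ 0# → a ≡ b →
    (∀ β j → a * sq β (lookup x j) + b * sq β (lookup y j) + c * p (β , j) ≡ 0#) → Conic p
  secant⇒conic {s} {a} {b} {c} {x} {y} {p} a≢0 c≢0 refl e with inverse c c≢0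
  ... | d , cd≡1 = a * d , *-≢0 a≢0 d≢0 , λ j → on (coordinate (e false j)) (coordinate (e true j))
    where
    d≢0 : d ≢ 0#
    d≢0 refl = 0≢1 (trans (solve 1 (λ c → :0 := c :* :0) refl c) cd≡1)

    coordinate : ∀ {u v w} → a * u + a * v + c * w ≡ 0# → w ≡ a * d * (u + v)
    coordinate {u} {v} {w} e = +≡0⇒≡ (lc₂ d w (solve 6 (λ a c d u v w → w :+ a :* d :* (u :+ v) := d :* (a :* u :+ a :* v :+ c :* w) :+ w :* (c :* d :+ :1)) refl a c d u v w) e (≡⇒+≡0 cd≡1))

    on : ∀ {u v w z} → u ≡ a * d * (w + z) → v ≡ a * d * (w ² + z ²) → u ² ≡ a * d * v
    on {w = w} {z} refl refl = solve 4 (λ a d w z → a :* d :* (w :+ z) :* (a :* d :* (w :+ z)) := a :* d :* (a :* d :* (w :* w :+ z :* z))) refl a d w z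

  unit : Bool → Bool → Carrier
  unit false false = 1#
  unit false true = 0#
  unit true false = 0#
  unit true true = 1#

  -- The recursive cap in the subspace w = 0

  module Lower (4<q : 4 ℕ.< q) (κ : Carrier) (κ≢0 : κ ≢ 0#) (κ≢1 : κ ≢ 1#) (κ²+κ+1≢0 : κ ² + κ + 1# ≢ 0#) where
    open Vertices κ κ≢0 κ≢1 κ²+κ+1≢0
    open Caps F 2≡0
    open IsCapFamily
    open CommutativeRing commutativeRing using (*-comm)

    -- Here v₂ = κ (v₀ + v₁) = (κ, 0). The choice keeps all vertices off y² = z and makes their
    -- y-coordinates κ², κ² + 1, κ nonzero and distinct, the pairwise sums being 1, κ² + κ and κ² +
    -- κ + 1. Relations of arms with `pole` or with lifted points fail on these y-coordinates.
    v₀ v₁ : Bool → Carrier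
    v₀ false = κ ²
    v₀ true = 1#
    v₁ false = κ ² + 1#
    v₁ true = 1#

    independent : ∀ {α β} → (∀ b → α * v₀ b + β * v₁ b ≡ 0#) → α ≡ 0# × β ≡ 0#
    independent {α} {β} e =
      lc₂ 1# (κ ² + 1#) (solve 3 (λ α β k → α := :1 :* (α :* k :+ β :* (k :+ :1)) :+ (k :+ :1) :* (α :* :1 :+ β :* :1)) refl α β (κ ²)) (e false) (e true) ,
      lc₂ 1# (κ ²) (solve 3 (λ α β k → β := :1 :* (α :* k :+ β :* (k :+ :1)) :+ k :* (α :* :1 :+ β :* :1)) refl α β (κ ²)) (e false) (e true)

    open Arms v₀ v₁ independent

    -- Low m indexes a cap of PG(2m+1,q), in coordinates (y₀,…,y_m; z₀,…,z_m) tagged by false and true.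
    data Low : ℕ → Set where
      axis : Bool → Low ℕ.zero
      armᴸ : ∀ {m} → Fin 3 → Vec Carrier (ℕ.suc m) → Low (ℕ.suc m)
      pole : ∀ {m} → Low (ℕ.suc m)
      lift : ∀ {m} → Low m → Low (ℕ.suc m)

    pointᴸ : ∀ {m} → Low m → Bool × Fin (ℕ.suc m) → Carrier
    pointᴸ (axis c) (b , _) = unit c b
    pointᴸ (armᴸ i x) n = arm i x n
    pointᴸ pole (b , zero) = unit true b
    pointᴸ pole (b , suc j) = 0#
    pointᴸ (lift l) (b , zero) = 0#
    pointᴸ (lift l) (b , suc j) = pointᴸ l (b , j)

    Valid : ∀ {m} → Low m → Set
    Valid (axis c) = ⊤
    Valid (armᴸ i x) = NonZeroVec x
    Valid pole = ⊤
    Valid (lift l) = Valid l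

    -- This makes the recursion possible: secants that leave the larger coordinates with equal
    -- weights meet the smaller space in conic points only. On an arm the tail (x, x²) with x ≠ 0
    -- forces c = 1, so the vertex would have to satisfy y² = z.
    low-off-conic : ∀ {m} {l : Low m} → Valid l → ¬ Conic (pointᴸ l)
    low-off-conic {l = axis false} _ (c , c≢0 , on) = 0≢1 (trans (solve 1 (λ c → :0 := c :* :0) refl c) (trans (sym (on zero)) (solve 0 (:1 :* :1 := :1) refl)))
    low-off-conic {l = axis true} _ (c , c≢0 , on) = c≢0 (trans (solve 1 (λ c → c := c :* :1) refl c) (trans (sym (on zero)) (solve 0 (:0 :* :0 := :0) refl)))
    low-off-conic {l = pole} _ (c , c≢0 , on) = c≢0 (trans (solve 1 (λ c → c := c :* :1) refl c) (trans (sym (on zero)) (solve 0 (:0 :* :0 := :0) refl)))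
    low-off-conic {l = lift l} v (c , c≢0 , on) = low-off-conic {l = l} v (c , c≢0 , on ∘ suc)
    low-off-conic {l = armᴸ i x} (j , x≢0) (c , c≢0 , on) = vertex-off i (trans (on zero) (trans (cong (_* vertex i true) c≡1) (solve 1 (λ v → :1 :* v := v) refl _)))
      where
      c≡1 : c ≡ 1#
      c≡1 = +≡0⇒≡ (*-cancel-0 (*-≢0 x≢0 x≢0) (trans (solve 2 (λ c x → x :* x :* (c :+ :1) := x :* x :+ c :* (x :* x)) refl c (lookup x j)) (≡⇒+≡0 (on (suc j)))))

      vertex-off : ∀ i → vertex i false ² ≢ vertex i true
      -- The three cases amount to κ⁴ = 1, κ⁴ = 0 and κ² = 0.
      vertex-off 0F e = κ≢1 (²-injective (²-injective (+≡0⇒≡ (trans (solve 1 (λ κ → κ :* κ :* (κ :* κ) :+ :1 :* :1 :* (:1 :* :1) :=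
        (:1 :* (κ :* κ) :+ :0 :* (κ :* κ :+ :1)) :* (:1 :* (κ :* κ) :+ :0 :* (κ :* κ :+ :1)) :+ (:1 :* :1 :+ :0 :* :1)) refl κ) (≡⇒+≡0 e)))))
      vertex-off 1F e = κ≢0 (x²≡0⇒x≡0 (x²≡0⇒x≡0 (trans (solve 1 (λ κ → κ :* κ :* (κ :* κ) :=
        (:0 :* (κ :* κ) :+ :1 :* (κ :* κ :+ :1)) :* (:0 :* (κ :* κ) :+ :1 :* (κ :* κ :+ :1)) :+ (:0 :* :1 :+ :1 :* :1)) refl κ) (≡⇒+≡0 e))))
      vertex-off 2F e = κ≢0 (x²≡0⇒x≡0 (trans (solve 1 (λ κ → κ :* κ :=
        (κ :* (κ :* κ) :+ κ :* (κ :* κ :+ :1)) :* (κ :* (κ :* κ) :+ κ :* (κ :* κ :+ :1)) :+ (κ :* :1 :+ κ :* :1)) refl κ) (≡⇒+≡0 e)))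

    rank : ∀ {m} → Low m → ℕ
    rank (axis false) = 0
    rank (axis true) = 1
    rank (armᴸ i x) = toℕ i
    rank pole = 3
    rank (lift l) = 4

    3≰toℕ : ∀ {i : Fin 3} → ¬ (3 ℕ.≤ toℕ i)
    3≰toℕ {i} = ℕ.<⇒≱ (Fin.toℕ<n i)

    4≰toℕ : ∀ {i : Fin 3} → ¬ (4 ℕ.≤ toℕ i)
    4≰toℕ {i} 4≤i = 3≰toℕ (ℕ.≤-trans (ℕ.n≤1+n 3) 4≤i)

    +c*0 : ∀ c x → x ≡ x + c * 0#
    +c*0 = solve 2 (λ c x → x := x :+ c :* :0) refl

    +b*0+c*0 : ∀ b c x → x ≡ x + b * 0# + c * 0#
    +b*0+c*0 = solve 3 (λ b c x → x := x :+ b :* :0 :+ c :* :0) refl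

    vertex-y≢0 : ∀ i → vertex i false ≢ 0#
    vertex-y≢0 0F e = κ≢0 (x²≡0⇒x≡0 (trans (solve 1 (λ κ → κ :* κ := :1 :* (κ :* κ) :+ :0 :* (κ :* κ :+ :1)) refl κ) e))
    vertex-y≢0 1F e = κ≢1 (²-injective (+≡0⇒≡ (trans (solve 1 (λ κ → κ :* κ :+ :1 :* :1 := :0 :* (κ :* κ) :+ :1 :* (κ :* κ :+ :1)) refl κ) e)))
    vertex-y≢0 2F e = κ≢0 (trans (solve 1 (λ κ → κ := κ :* (κ :* κ) :+ κ :* (κ :* κ :+ :1)) refl κ) e)

    κ²+κ≢0 : κ ² + κ ≢ 0#
    κ²+κ≢0 e = *-≢0 κ≢0 (κ≢1 ∘ +≡0⇒≡) (trans (solve 1 (λ κ → κ :* (κ :+ :1) := κ :* κ :+ κ) refl κ) e)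

    vertices-distinct-y : ∀ i j → i ≢ j → vertex i false + vertex j false ≢ 0#
    vertices-distinct-y 0F 0F i≢j _ = i≢j refl
    vertices-distinct-y 1F 1F i≢j _ = i≢j refl
    vertices-distinct-y 2F 2F i≢j _ = i≢j refl
    vertices-distinct-y 0F 1F _ e = 0≢1 (sym (trans (solve 1 (λ κ → :1 := :1 :* (κ :* κ) :+ :0 :* (κ :* κ :+ :1) :+ (:0 :* (κ :* κ) :+ :1 :* (κ :* κ :+ :1))) refl κ) e))
    vertices-distinct-y 0F 2F _ e = κ²+κ≢0 (trans (solve 1 (λ κ → κ :* κ :+ κ := :1 :* (κ :* κ) :+ :0 :* (κ :* κ :+ :1) :+ (κ :* (κ :* κ) :+ κ :* (κ :* κ :+ :1))) refl κ) e)
    vertices-distinct-y 1F 2F _ e = κ²+κ+1≢0 (trans (solve 1 (λ κ → κ :* κ :+ κ :+ :1 := :0 :* (κ :* κ) :+ :1 :* (κ :* κ :+ :1) :+ (κ :* (κ :* κ) :+ κ :* (κ :* κ :+ :1))) refl κ) e)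
    vertices-distinct-y 1F 0F _ e = vertices-distinct-y 0F 1F (λ ()) (trans (solve 2 (λ x y → y :+ x := x :+ y) refl (vertex 1F false) (vertex 0F false)) e)
    vertices-distinct-y 2F 0F _ e = vertices-distinct-y 0F 2F (λ ()) (trans (solve 2 (λ x y → y :+ x := x :+ y) refl (vertex 2F false) (vertex 0F false)) e)
    vertices-distinct-y 2F 1F _ e = vertices-distinct-y 1F 2F (λ ()) (trans (solve 2 (λ x y → y :+ x := x :+ y) refl (vertex 2F false) (vertex 1F false)) e)

    -- The pole has zero tail, so the tails of the arms give x = y and, since y ≠ 0, equal weights.
    -- As the pole also has y₀ = 0, the two vertices would share their y-coordinate, hence be the
    -- same.
    arm-arm-pole : ∀ {m i j} {x y : Vec Carrier (ℕ.suc m)} {a b c} → NonZeroVec y → armᴸ i x ≢ armᴸ j y → a ≢ 0# → b ≢ 0# →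
      ¬ (∀ n → a * arm i x n + b * arm j y n + c * pointᴸ (pole {m}) n ≡ 0#)
    arm-arm-pole {i = i} {j} {x} {y} {a} {b} {c} (k , y≢0) i≢j a≢0 b≢0 e =
      *-≢0 a≢0 (vertices-distinct-y i j (λ i≡j → i≢j (cong₂ armᴸ i≡j x≡y)))
        (lc₂ 1# (vertex j false) (solve 5 (λ a b c v w → a :* (v :+ w) := :1 :* (a :* v :+ b :* w :+ c :* :0) :+ w :* (a :+ b)) refl a b c (vertex i false) (vertex j false)) (e (false , zero)) (≡⇒+≡0 a≡b))
      where
      tail : ∀ β k → a * sq β (lookup x k) + b * sq β (lookup y k) ≡ 0#
      tail β k = trans (+c*0 c _) (e (β , suc k))

      x≡y : x ≡ y
      x≡y = lookup-ext (λ k → parabola-pair a≢0 b≢0 (tail false k) (tail true k))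

      a≡b : a ≡ b
      a≡b = parabola-pair-weights a≢0 b≢0 y≢0 (tail false k) (tail true k)

    -- The lifted point has zero head, so the heads of the arms agree, with equal weights; the tails
    -- then put the lifted point on a conic.
    arm-arm-lift : ∀ {m i j} {x y : Vec Carrier (ℕ.suc m)} {l : Low m} {a b c} → Valid l → a ≢ 0# → c ≢ 0# →
      ¬ (∀ n → a * arm i x n + b * arm j y n + c * pointᴸ (lift l) n ≡ 0#)
    arm-arm-lift {i = i} {j} {x} {y} {l} {c = c} v a≢0 c≢0 e = low-off-conic {l = l} v
      (secant⇒conic {x = x} {y} a≢0 c≢0 (proj₂ (same-vertex {i} {j} a≢0 (λ b → trans (+c*0 c _) (e (b , zero))))) (λ β j → e (β , suc j)))

    -- In the y-coordinate of the head only the arm point is nonzero.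
    arm-point-lift : ∀ {m i} {x : Vec Carrier (ℕ.suc m)} {l : Low m} {n : Low (ℕ.suc m)} {a b c} → a ≢ 0# → pointᴸ n (false , zero) ≡ 0# →
      ¬ (∀ k → a * arm i x k + b * pointᴸ n k + c * pointᴸ (lift l) k ≡ 0#)
    arm-point-lift {i = i} {a = a} {b} {c} a≢0 n≡0 e = *-≢0 a≢0 (vertex-y≢0 i)
      (trans (+b*0+c*0 b c _) (trans (cong (λ z → a * vertex i false + b * z + c * 0#) (sym n≡0)) (e (false , zero))))

    low-cap : ∀ m → IsCapFamily (Valid {m}) pointᴸ
    low-cap ℕ.zero = sorted⇒cap rank (λ {l} → nz {l}) pr tr
      where
      nz : ∀ {l : Low 0} → Valid l → ∃[ n ] pointᴸ l n ≢ 0#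
      nz {axis false} _ = (false , zero) , 0≢1 ∘ sym
      nz {axis true} _ = (true , zero) , 0≢1 ∘ sym

      pr : ∀ {i j : Low 0} → rank i ℕ.≤ rank j → Valid i → Valid j → i ≢ j → ∀ {a b} → a ≢ 0# → b ≢ 0# → ¬ (∀ n → a * pointᴸ i n + b * pointᴸ j n ≡ 0#)
      pr {axis false} {axis false} _ _ _ i≢j = contradiction refl i≢j
      pr {axis true} {axis true} _ _ _ i≢j = contradiction refl i≢j
      pr {axis true} {axis false} ()
      pr {axis false} {axis true} _ _ _ _ {a} {b} a≢0 _ e = a≢0 (trans (solve 2 (λ a b → a := a :* :1 :+ b :* :0) refl a b) (e (false , zero)))

      tr : ∀ {i j k : Low 0} → rank i ℕ.≤ rank j → rank j ℕ.≤ rank k → Valid i → Valid j → Valid k → i ≢ j → j ≢ k → i ≢ k → ∀ {a b c} → a ≢ 0# → b ≢ 0# → c ≢ 0# →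
        ¬ (∀ n → a * pointᴸ i n + b * pointᴸ j n + c * pointᴸ k n ≡ 0#)
      tr {axis false} {axis false} _ _ _ _ _ i≢j = contradiction refl i≢j
      tr {axis true} {axis true} _ _ _ _ _ i≢j = contradiction refl i≢j
      tr {axis true} {axis false} ()
      tr {axis false} {axis true} {axis true} _ _ _ _ _ _ j≢k = contradiction refl j≢k
      tr {axis false} {axis true} {axis false} _ ()
    low-cap (ℕ.suc m) = sorted⇒cap rank (λ {l} → nz {l}) pr tr
      where
      nz : ∀ {l : Low (ℕ.suc m)} → Valid l → ∃[ n ] pointᴸ l n ≢ 0#
      nz {armᴸ i x} (j , x≢0) = (false , suc j) , x≢0
      nz {pole} _ = (true , zero) , 0≢1 ∘ sym
      nz {lift l} v with nonzero (low-cap m) {l} v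
      ... | (b , j) , p≢0 = (b , suc j) , p≢0

      pr : ∀ {i j : Low (ℕ.suc m)} → rank i ℕ.≤ rank j → Valid i → Valid j → i ≢ j → ∀ {a b} → a ≢ 0# → b ≢ 0# → ¬ (∀ n → a * pointᴸ i n + b * pointᴸ j n ≡ 0#)
      pr {armᴸ i x} {armᴸ j y} _ _ _ i≢j a≢0 b≢0 e with arm-pair a≢0 b≢0 e
      ... | refl , refl = i≢j refl
      pr {armᴸ i x} {pole} _ _ _ _ {b = b} a≢0 _ e = *-≢0 a≢0 (vertex-y≢0 i) (trans (+c*0 b _) (e (false , zero)))
      pr {armᴸ i x} {lift l} _ _ _ _ {b = b} a≢0 _ e = *-≢0 a≢0 (vertex-y≢0 i) (trans (+c*0 b _) (e (false , zero)))
      pr {pole} {armᴸ _ _} r = contradiction r 3≰toℕ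
      pr {pole} {pole} _ _ _ i≢j = contradiction refl i≢j
      pr {pole} {lift l} _ _ _ _ {b = b} a≢0 _ e = *-≢0 a≢0 (0≢1 ∘ sym) (trans (+c*0 b _) (e (true , zero)))
      pr {lift _} {armᴸ _ _} r = contradiction r 4≰toℕ
      pr {lift _} {pole} (ℕ.s≤s (ℕ.s≤s (ℕ.s≤s ())))
      pr {lift l} {lift l′} _ v v′ i≢j a≢0 b≢0 e = pair (low-cap m) {l} {l′} v v′ (i≢j ∘ cong lift) a≢0 b≢0 (λ (b , j) → e (b , suc j))

      tr : ∀ {i j k : Low (ℕ.suc m)} → rank i ℕ.≤ rank j → rank j ℕ.≤ rank k → Valid i → Valid j → Valid k → i ≢ j → j ≢ k → i ≢ k → ∀ {a b c} → a ≢ 0# → b ≢ 0# → c ≢ 0# →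
        ¬ (∀ n → a * pointᴸ i n + b * pointᴸ j n + c * pointᴸ k n ≡ 0#)
      tr {armᴸ i x} {armᴸ j y} {armᴸ k z} i≤j j≤k _ _ vz i≢j _ _ a≢0 b≢0 c≢0 e = arm-triple i≤j j≤k vz (λ i≡j x≡y → i≢j (cong₂ armᴸ i≡j x≡y)) a≢0 b≢0 c≢0 e
      tr {armᴸ i x} {armᴸ j y} {pole} _ _ _ vy _ i≢j _ _ a≢0 b≢0 c≢0 e = arm-arm-pole vy i≢j a≢0 b≢0 e
      tr {armᴸ i x} {armᴸ j y} {lift l} _ _ _ _ vl _ _ _ a≢0 b≢0 c≢0 e = arm-arm-lift {l = l} vl a≢0 c≢0 e
      tr {armᴸ i x} {pole} {lift l} _ _ _ _ _ _ _ _ a≢0 b≢0 c≢0 e = arm-point-lift {l = l} {pole} a≢0 refl e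
      tr {armᴸ i x} {lift l} {lift l′} _ _ _ _ _ _ _ _ a≢0 b≢0 c≢0 e = arm-point-lift {l = l′} {lift l} a≢0 refl e
      tr {pole} {lift l} {lift l′} _ _ _ _ _ _ _ _ {a} {b} {c} a≢0 b≢0 c≢0 e = *-≢0 a≢0 (0≢1 ∘ sym) (trans (+b*0+c*0 b c _) (e (true , zero)))
      tr {lift l} {lift l′} {lift l″} _ _ v v′ v″ i≢j j≢k i≢k a≢0 b≢0 c≢0 e =
        triple (low-cap m) {l} {l′} {l″} v v′ v″ (i≢j ∘ cong lift) (j≢k ∘ cong lift) (i≢k ∘ cong lift) a≢0 b≢0 c≢0 (λ (b , j) → e (b , suc j))
      tr {pole} {pole} _ _ _ _ _ i≢j = contradiction refl i≢j
      tr {_} {pole} {pole} _ _ _ _ _ _ j≢k = contradiction refl j≢k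
      tr {pole} {armᴸ _ _} r = contradiction r 3≰toℕ
      tr {lift _} {armᴸ _ _} r = contradiction r 4≰toℕ
      tr {lift _} {pole} (ℕ.s≤s (ℕ.s≤s (ℕ.s≤s ())))
      tr {_} {pole} {armᴸ _ _} _ r = contradiction r 3≰toℕ
      tr {_} {lift _} {armᴸ _ _} _ r = contradiction r 4≰toℕ
      tr {_} {lift _} {pole} _ (ℕ.s≤s (ℕ.s≤s (ℕ.s≤s ())))

    LowCovered : ∀ {m} → (Bool × Fin (ℕ.suc m) → Carrier) → Set
    LowCovered {m} p = ∃[ l ] ∃[ l′ ] ∃[ a ] ∃[ b ] (Valid {m} l × Valid l′ × ∀ n → p n ≡ a * pointᴸ l n + b * pointᴸ l′ n)

    tail-nonzero? : ∀ {s} (p : Bool × Fin (ℕ.suc s) → Carrier) → (∃[ b ] ∃[ j ] p (b , suc j) ≢ 0#) ⊎ (∀ b j → p (b , suc j) ≡ 0#)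
    tail-nonzero? p with Fin.any? (λ j → ¬? (p (false , suc j) ≟ 0#)) | Fin.any? (λ j → ¬? (p (true , suc j) ≟ 0#))
    ... | yes (j , p≢0) | _ = inj₁ (false , j , p≢0)
    ... | no _ | yes (j , p≢0) = inj₁ (true , j , p≢0)
    ... | no y≡0 | no z≡0 = inj₂ λ { false → ¬nonZero⇒0 y≡0 ; true → ¬nonZero⇒0 z≡0 }

    arms-cover : ∀ {m} (p : Bool × Fin (ℕ.suc (ℕ.suc m)) → Carrier) → (∃[ b ] ∃[ j ] p (b , suc j) ≢ 0#) →
      ¬ (p (false , zero) ≡ 0# × p (true , zero) ≡ 0#) → LowCovered p
    arms-cover p tail≢0 head≢0 = let (i , j , x , y , a , b , x≢0 , y≢0 , e) = Cover.cover 4<q p tail≢0 α β αβ≢0 head in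
        armᴸ i x , armᴸ j y , a , b , x≢0 , y≢0 , e
      where
      w = p (false , zero)
      w′ = p (true , zero)
      -- Cramer's rule without division: the determinant of `v₀` and `v₁` is κ² + (κ² + 1) = 1.
      α = w + (κ ² + 1#) * w′
      β = w + κ ² * w′

      head : ∀ b → p (b , zero) ≡ α * v₀ b + β * v₁ b
      head false = solve 3 (λ w w′ k → w := (w :+ (k :+ :1) :* w′) :* k :+ (w :+ k :* w′) :* (k :+ :1)) refl w w′ (κ ²)
      head true = solve 3 (λ w w′ k → w′ := (w :+ (k :+ :1) :* w′) :* :1 :+ (w :+ k :* w′) :* :1) refl w w′ (κ ²)

      αβ≢0 : ¬ (α ≡ 0# × β ≡ 0#)
      αβ≢0 (α≡0 , β≡0) = head≢0 (lc₂ (v₀ false) (v₁ false) (trans (head false) (cong₂ _+_ (*-comm α _) (*-comm β _))) α≡0 β≡0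
        , lc₂ (v₀ true) (v₁ true) (trans (head true) (cong₂ _+_ (*-comm α _) (*-comm β _))) α≡0 β≡0)

    -- A zero head satisfies every conic equation, so the tail is still off the conics and the
    -- recursion applies to it. If head and tail are both nonzero, the arms suffice. If the tail is
    -- zero, a head (y, z) with y and z nonzero lies on the conic of y²/z, the head (y, 0) is on a
    -- secant of two arms, and (0, z) is the reason for `pole`.
    low-covers : ∀ {m} (p : Bool × Fin (ℕ.suc m) → Carrier) → ¬ Conic p → LowCovered p
    low-covers {ℕ.zero} p _ = axis false , axis true , p (false , zero) , p (true , zero) , tt , tt , λ where
      (false , zero) → solve 2 (λ x y → x := x :* :1 :+ y :* :0) refl _ _
      (true , zero) → solve 2 (λ x y → y := x :* :0 :+ y :* :1) refl _ _
    low-covers {ℕ.suc m} p off with p (false , zero) ≟ 0# | p (true , zero) ≟ 0# | tail-nonzero? p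
    ... | yes y≡0 | yes z≡0 | _ = let (l , l′ , a , b , v , v′ , e) = low-covers (λ (b , j) → p (b , suc j)) off-tail in
        lift l , lift l′ , a , b , v , v′ , λ where
          (false , zero) → trans y≡0 (solve 2 (λ a b → :0 := a :* :0 :+ b :* :0) refl a b)
          (true , zero) → trans z≡0 (solve 2 (λ a b → :0 := a :* :0 :+ b :* :0) refl a b)
          (b , suc j) → e (b , j)
      where
      off-tail : ¬ Conic (λ (b , j) → p (b , suc j))
      off-tail (c , c≢0 , on) = off (c , c≢0 , λ where
        zero → trans (cong _² y≡0) (trans (solve 1 (λ c → :0 :* :0 := c :* :0) refl c) (cong (c *_) (sym z≡0)))
        (suc j) → on j)
    ... | no y≢0 | no z≢0 | inj₂ tail≡0 = contradiction on off
      where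
      z⁻¹ = proj₁ (inverse (p (true , zero)) z≢0)
      zz⁻¹≡1 = proj₂ (inverse (p (true , zero)) z≢0)
      z⁻¹≢0 : z⁻¹ ≢ 0#
      z⁻¹≢0 e = 0≢1 (trans (solve 1 (λ z → :0 := z :* :0) refl _) (trans (cong (p (true , zero) *_) (sym e)) zz⁻¹≡1))

      on : Conic p
      on = p (false , zero) ² * z⁻¹ , *-≢0 (*-≢0 y≢0 y≢0) z⁻¹≢0 , λ where
        zero → +≡0⇒≡ (lc₁ (p (false , zero) ²) (solve 3 (λ y z d → y :* y :+ y :* y :* d :* z := y :* y :* (z :* d :+ :1)) refl _ _ _) (≡⇒+≡0 zz⁻¹≡1))
        (suc j) → trans (cong _² (tail≡0 false j)) (trans (solve 1 (λ c → :0 :* :0 := c :* :0) refl (p (false , zero) ² * z⁻¹)) (cong (p (false , zero) ² * z⁻¹ *_) (sym (tail≡0 true j))))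
    -- Since v₀ + v₁ = (1, 0), two arm points with a common parameter and equal weights cancel in
    -- the tail. The all-ones vector is just some nonzero parameter.
    ... | no y≢0 | yes z≡0 | inj₂ tail≡0 = armᴸ 0F 𝟙 , armᴸ 1F 𝟙 , y , y , 𝟙≢0 , 𝟙≢0 , λ where
        (false , zero) → solve 2 (λ y κ → y := y :* (:1 :* (κ :* κ) :+ :0 :* (κ :* κ :+ :1)) :+ y :* (:0 :* (κ :* κ) :+ :1 :* (κ :* κ :+ :1))) refl y κ
        (true , zero) → trans z≡0 (solve 1 (λ y → :0 := y :* (:1 :* :1 :+ :0 :* :1) :+ y :* (:0 :* :1 :+ :1 :* :1)) refl y)
        (b , suc j) → trans (tail≡0 b j) (sym (x+x≡0 _))
      where
      y = p (false , zero)
      𝟙 = replicate (ℕ.suc m) 1#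
      𝟙≢0 : NonZeroVec 𝟙
      𝟙≢0 = zero , 0≢1 ∘ sym
    ... | yes y≡0 | no z≢0 | inj₂ tail≡0 = pole , pole , p (true , zero) , 0# , tt , tt , λ where
        (false , zero) → trans y≡0 (solve 1 (λ z → :0 := z :* :0 :+ :0 :* :0) refl _)
        (true , zero) → solve 1 (λ z → z := z :* :1 :+ :0 :* :1) refl _
        (b , suc j) → trans (tail≡0 b j) (solve 1 (λ z → :0 := z :* :0 :+ :0 :* :0) refl _)
    ... | no y≢0 | no _ | inj₁ tail≢0 = arms-cover p tail≢0 (λ (y≡0 , _) → y≢0 y≡0)
    ... | no y≢0 | yes _ | inj₁ tail≢0 = arms-cover p tail≢0 (λ (y≡0 , _) → y≢0 y≡0)
    ... | yes _ | no z≢0 | inj₁ tail≢0 = arms-cover p tail≢0 (λ (_ , z≡0) → z≢0 z≡0)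

    low-points : ∀ m → Enumeration (Valid {m})
    low-points ℕ.zero = record
      { list = axis false ∷ axis true ∷ []
      ; unique = ((λ ()) ∷ []) ∷ [] ∷ []
      ; sound = λ { (here refl) → tt ; (there (here refl)) → tt }
      ; complete = λ { {axis false} _ → here refl ; {axis true} _ → there (here refl) }
      }
    low-points (ℕ.suc m) = record { list = pole ∷ rest ; unique = All.tabulate pole∉ ∷ rest-unique ; sound = sound′ ; complete = complete′ }
      where
      nz = nonzero-vectors (ℕ.suc m)
      arms = cartesianProductWith (armᴸ {m}) (allFin 3) (list nz)
      rest = arms ++ map lift (list (low-points m))

      rest-unique : Unique rest
      rest-unique = Unique.++⁺ (Unique.cartesianProductWith⁺ armᴸ (λ { refl → refl , refl }) (Unique.allFin⁺ 3) (unique nz))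
        (Unique.map⁺ (λ { refl → refl }) (unique (low-points m)))
        λ (∈arms , ∈lift) → disjoint (∈-cartesianProductWith⁻ armᴸ (allFin 3) (list nz) ∈arms) (∈-map⁻ lift ∈lift)
        where
        disjoint : ∀ {l} → (∃[ i ] ∃[ x ] (i ∈ allFin 3 × x ∈ list nz × l ≡ armᴸ i x)) → (∃[ l′ ] (l′ ∈ list (low-points m) × l ≡ lift l′)) → ⊥
        disjoint (_ , _ , _ , _ , refl) (_ , _ , ())

      pole∉ : ∀ {l} → l ∈ rest → pole ≢ l
      pole∉ ∈rest refl with ∈-++⁻ arms ∈rest
      ... | inj₁ ∈arms with ∈-cartesianProductWith⁻ armᴸ (allFin 3) (list nz) ∈arms
      ...   | _ , _ , _ , _ , ()
      pole∉ ∈rest refl | inj₂ ∈lift with ∈-map⁻ lift ∈lift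
      ...   | _ , _ , ()

      sound′ : ∀ {l} → l ∈ pole ∷ rest → Valid l
      sound′ (here refl) = tt
      sound′ (there ∈rest) with ∈-++⁻ arms ∈rest
      ... | inj₁ ∈arms with ∈-cartesianProductWith⁻ armᴸ (allFin 3) (list nz) ∈arms
      ...   | _ , _ , _ , x∈ , refl = sound nz x∈
      sound′ (there ∈rest) | inj₂ ∈lift with ∈-map⁻ lift ∈lift
      ...   | _ , l∈ , refl = sound (low-points m) l∈

      complete′ : ∀ {l} → Valid l → l ∈ pole ∷ rest
      complete′ {armᴸ i x} x≢0 = there (∈-++⁺ˡ (∈-cartesianProductWith⁺ armᴸ (∈-allFin i) (complete nz x≢0)))
      complete′ {pole} _ = here refl
      complete′ {lift l} v = there (∈-++⁺ʳ arms (∈-map⁺ lift (complete (low-points m) v)))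

    -- A level adds three arms, each short of the full power by one, and one pole: it stays 2 below
    -- 3q^(m+1). The shortfall is kept on the left to avoid subtraction.
    length-low-points : ∀ m → length (list (low-points m)) ℕ.+ 2 ℕ.* ℕ.suc m ℕ.≤ 3 ℕ.* sumPow q m ℕ.+ 4
    length-low-points ℕ.zero = ℕ.≤-refl
    length-low-points (ℕ.suc m) = begin
      ℕ.suc (length (arms ++ map lift low)) ℕ.+ 2 ℕ.* ℕ.suc (ℕ.suc m)
        ≡⟨ cong (λ n → ℕ.suc n ℕ.+ 2 ℕ.* ℕ.suc (ℕ.suc m)) (trans (List.length-++ arms) (cong₂ ℕ._+_ (length-cartesianProductWith (armᴸ {m}) (allFin 3) nz) (List.length-map lift low))) ⟩
      ℕ.suc (3 ℕ.* length nz ℕ.+ length low) ℕ.+ 2 ℕ.* ℕ.suc (ℕ.suc m)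
        ≡⟨ regroup (length nz) (length low) m ⟩
      3 ℕ.* ℕ.suc (length nz) ℕ.+ (length low ℕ.+ 2 ℕ.* ℕ.suc m)
        ≤⟨ ℕ.+-mono-≤ (ℕ.*-monoʳ-≤ 3 (length-nonzero-vectors (ℕ.suc m))) (length-low-points m) ⟩
      3 ℕ.* q ℕ.^ ℕ.suc m ℕ.+ (3 ℕ.* sumPow q m ℕ.+ 4)
        ≡⟨ collect (q ℕ.^ ℕ.suc m) (sumPow q m) ⟩
      3 ℕ.* sumPow q (ℕ.suc m) ℕ.+ 4 ∎
      where
      open ℕ.≤-Reasoning
      nz = list (nonzero-vectors (ℕ.suc m))
      low = list (low-points m)
      arms = cartesianProductWith (armᴸ {m}) (allFin 3) nz

      regroup : ∀ n l m → ℕ.suc (3 ℕ.* n ℕ.+ l) ℕ.+ 2 ℕ.* ℕ.suc (ℕ.suc m) ≡ 3 ℕ.* ℕ.suc n ℕ.+ (l ℕ.+ 2 ℕ.* ℕ.suc m)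
      regroup = solve-∀

      collect : ∀ a s → 3 ℕ.* a ℕ.+ (3 ℕ.* s ℕ.+ 4) ≡ 3 ℕ.* (s ℕ.+ a) ℕ.+ 4
      collect = solve-∀

-- Plane arcs and the scalars avoiding their differences

module PlaneArcs {q : ℕ} (F : FiniteField q) (2≡0 : HasChar2 F) where
  open FiniteField F
  open Field F
  open Char2 F 2≡0
  open Inverse enum using (to; from; strictlyInverseˡ)

  -- An affinely complete arc with X₀ normalised to 1 and then dropped: relations have weights
  -- summing to 0, coverings have weights summing to 1.
  record PlaneArc (t : ℕ) : Set where
    field
      K : Fin t → Bool → Carrier
      K-injective : ∀ {i j} → (∀ β → K i β ≡ K j β) → i ≡ j
      K-arc : ∀ {i j k} → i ≢ j → j ≢ k → i ≢ k → ∀ {a b c} → a ≢ 0# → b ≢ 0# → c ≢ 0# → a + b + c ≡ 0# →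
        ¬ (∀ β → a * K i β + b * K j β + c * K k β ≡ 0#)
      K-covers : ∀ (u : Bool → Carrier) → ∃[ i ] ∃[ j ] ∃[ a ] ∃[ b ] (a + b ≡ 1# × ∀ β → u β ≡ a * K i β + b * K j β)

  module Directions {t : ℕ} (arc : PlaneArc t) (t≤q : t ℕ.≤ q) (8<q : 8 ℕ.< q) (e : Bool → Carrier) (e≢0 : ∃[ β ] e β ≢ 0#) where
    open PlaneArc arc

    Chord : Carrier → Fin t → Fin t → Set
    Chord κ i j = ∀ β → κ * e β ≡ K i β + K j β

    chord? : ∀ κ i j → Dec (Chord κ i j)
    chord? κ i j = Dec.map′ (λ (p , p′) → λ { false → p ; true → p′ }) (λ p → p false , p true)
      ((κ * e false ≟ K i false + K j false) ×-dec (κ * e true ≟ K i true + K j true))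

    κe-injective : ∀ {κ κ′} → (∀ β → κ * e β ≡ κ′ * e β) → κ ≡ κ′
    κe-injective {κ} {κ′} eq = let (β , eβ≢0) = e≢0 in
      +≡0⇒≡ (*-cancel-0 eβ≢0 (trans (solve 3 (λ κ κ′ e → e :* (κ :+ κ′) := κ :* e :+ κ′ :* e) refl κ κ′ (e β)) (≡⇒+≡0 (eq β))))

    chord-proper : ∀ {κ i j} → κ ≢ 0# → Chord κ i j → i ≢ j
    chord-proper κ≢0 chord refl = let (β , eβ≢0) = e≢0 in *-≢0 κ≢0 eβ≢0 (trans (chord β) (x+x≡0 _))

    -- Two chords in the direction e with a common end would contain three collinear points of the arc.
    chords-disjoint : ∀ {κ κ′ i j j′} → κ ≢ 0# → κ′ ≢ 0# → Chord κ i j → Chord κ′ i j′ → κ ≡ κ′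
    chords-disjoint {κ} {κ′} {i} {j} {j′} κ≢0 κ′≢0 chord chord′ with j Fin.≟ j′ | κ ≟ κ′
    ... | yes refl | _ = κe-injective (λ β → trans (chord β) (sym (chord′ β)))
    ... | no _ | yes κ≡κ′ = κ≡κ′
    ... | no j≢j′ | no κ≢κ′ = contradiction relation
        (K-arc (chord-proper κ≢0 chord) j≢j′ (chord-proper κ′≢0 chord′) (κ≢κ′ ∘ +≡0⇒≡) κ′≢0 κ≢0 (solve 2 (λ x y → x :+ y :+ y :+ x := :0) refl κ κ′))
      where
      relation : ∀ β → (κ + κ′) * K i β + κ′ * K j β + κ * K j′ β ≡ 0#
      relation β = lc₂ κ′ κ (solve 6 (λ κ κ′ e u v w → (κ :+ κ′) :* u :+ κ′ :* v :+ κ :* w := κ′ :* (κ :* e :+ (u :+ v)) :+ κ :* (κ′ :* e :+ (u :+ w))) refl κ κ′ (e β) (K i β) (K j β) (K j′ β))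
        (≡⇒+≡0 (chord β)) (≡⇒+≡0 (chord′ β))

    -- Adding the equations of two roots gives (κ + ω)(κ + ω + 1) = 0, so ω + 1 is the only other
    -- root. Without a root the claim is vacuous and `0#` is a dummy.
    cube-root : ∃[ ω ] ∀ κ → κ ² + κ + 1# ≡ 0# → κ ≡ ω ⊎ κ ≡ ω + 1#
    cube-root with any? (λ ω → ω ² + ω + 1# ≟ 0#)
    ... | no none = 0# , λ κ root → contradiction (κ , root) none
    ... | yes (ω , rootω) = ω , λ κ root → split κ root
      where
      split : ∀ κ → κ ² + κ + 1# ≡ 0# → κ ≡ ω ⊎ κ ≡ ω + 1#
      split κ root with κ + ω ≟ 0#
      ... | yes κ+ω≡0 = inj₁ (+≡0⇒≡ κ+ω≡0)
      ... | no κ+ω≢0 = inj₂ (+≡0⇒≡ (*-cancel-0 κ+ω≢0 (lc₂ 1# 1#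
        (solve 2 (λ κ ω → (κ :+ ω) :* (κ :+ (ω :+ :1)) := :1 :* (κ :* κ :+ κ :+ :1) :+ :1 :* (ω :* ω :+ ω :+ :1)) refl κ ω) root rootω)))

    ω = proj₁ cube-root

    exceptional : Fin 4 → Carrier
    exceptional 0F = 0#
    exceptional 1F = 1#
    exceptional 2F = ω
    exceptional 3F = ω + 1#

    record Good (κ : Carrier) : Set where
      field
        κ≢0 : κ ≢ 0#
        κ≢1 : κ ≢ 1#
        κ²+κ+1≢0 : κ ² + κ + 1# ≢ 0#
        no-chord : ∀ i j → ¬ Chord κ i j

    Class : Carrier → Set
    Class κ = (∃[ p ] exceptional p ≡ κ) ⊎ (κ ≢ 0# × ∃[ i ] ∃[ j ] Chord κ i j)

    good-or-class : ∀ κ → Good κ ⊎ Class κ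
    good-or-class κ with Fin.any? (λ p → exceptional p ≟ κ) | Fin.any? (λ i → Fin.any? (chord? κ i))
    ... | yes exc | _ = inj₂ (inj₁ exc)
    ... | no ¬exc | yes chord = inj₂ (inj₂ ((λ κ≡0 → ¬exc (0F , sym κ≡0)) , chord))
    ... | no ¬exc | no ¬chord = inj₁ (record
      { κ≢0 = λ κ≡0 → ¬exc (0F , sym κ≡0)
      ; κ≢1 = λ κ≡1 → ¬exc (1F , sym κ≡1)
      ; κ²+κ+1≢0 = ¬root
      ; no-chord = λ i j chord → ¬chord (i , j , chord)
      })
      where
      ¬root : κ ² + κ + 1# ≢ 0#
      ¬root root with proj₂ cube-root κ root
      ... | inj₁ κ≡ω = ¬exc (2F , sym κ≡ω)
      ... | inj₂ κ≡ω+1 = ¬exc (3F , sym κ≡ω+1)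

    end : Fin t → Fin t → Fin 2 → Fin t
    end i j 0F = i
    end i j 1F = j

    chord-from : ∀ {κ i j} → Chord κ i j → ∀ b → ∃[ k ] Chord κ (end i j b) k
    chord-from {j = j} chord 0F = j , chord
    chord-from {i = i} chord 1F = i , λ β → trans (chord β) (solve 2 (λ x y → x :+ y := y :+ x) refl _ _)

    end-injective : ∀ {i j} → i ≢ j → ∀ b b′ → end i j b ≡ end i j b′ → b ≡ b′
    end-injective i≢j 0F 0F _ = refl
    end-injective i≢j 1F 1F _ = refl
    end-injective i≢j 0F 1F eq = contradiction eq i≢j
    end-injective i≢j 1F 0F eq = contradiction (sym eq) i≢j

    -- Double counting: a rejected scalar owns two codes, namely both ends of one of its chords, or
    -- two marks reserved for its place among the four exceptional values. Thus `t` points account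
    -- for at most t/2 scalars.
    code : ∀ {κ} → Class κ → Fin 2 → Fin t ⊎ Fin (4 ℕ.* 2)
    code (inj₁ (p , _)) b = inj₂ (combine p b)
    code (inj₂ (_ , i , j , _)) b = inj₁ (end i j b)

    -- `chord-from` turns both chords round so that they start at the shared end, where
    -- `chords-disjoint` applies.
    code-injective₁ : ∀ {κ κ′} (c : Class κ) (c′ : Class κ′) {b b′} → code c b ≡ code c′ b′ → κ ≡ κ′
    code-injective₁ (inj₁ (p , refl)) (inj₁ (p′ , refl)) {b} {b′} eq = cong exceptional (proj₁ (Fin.combine-injective p b p′ b′ (inj₂-injective eq)))
    code-injective₁ (inj₁ _) (inj₂ _) ()
    code-injective₁ (inj₂ _) (inj₁ _) ()
    code-injective₁ {κ} {κ′} (inj₂ (κ≢0 , i , j , chord)) (inj₂ (κ′≢0 , i′ , j′ , chord′)) {b} {b′} eq with chord-from chord b | chord-from chord′ b′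
    ... | k , c | k′ , c′ = chords-disjoint κ≢0 κ′≢0 c (subst (λ i → Chord κ′ i k′) (sym (inj₁-injective eq)) c′)

    code-injective₂ : ∀ {κ} (c : Class κ) {b b′} → code c b ≡ code c b′ → b ≡ b′
    code-injective₂ (inj₁ (p , _)) {b} {b′} eq = proj₂ (Fin.combine-injective p b p b′ (inj₂-injective eq))
    code-injective₂ (inj₂ (κ≢0 , i , j , chord)) {b} {b′} eq = end-injective (chord-proper κ≢0 chord) b b′ (inj₁-injective eq)

    -- Otherwise every non-exceptional κ owns two points of the arc, whence 2q ≤ t + 8 ≤ q + 8.
    all-classes-absurd : ¬ (∀ κ → Class κ)
    all-classes-absurd class = ℕ.<⇒≱ 8<q (ℕ.+-cancelˡ-≤ q q 8 (begin
      q ℕ.+ q   ≡⟨ cong (q ℕ.+_) (ℕ.+-identityʳ q) ⟨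
      2 ℕ.* q   ≡⟨ ℕ.*-comm 2 q ⟩
      q ℕ.* 2   ≤⟨ Fin.injective⇒≤ f-injective ⟩
      t ℕ.+ 8   ≤⟨ ℕ.+-monoˡ-≤ 8 t≤q ⟩
      q ℕ.+ 8   ∎))
      where
      open ℕ.≤-Reasoning
      g : Fin q × Fin 2 → Fin t ⊎ Fin 8
      g (i , b) = code (class (from i)) b

      f : Fin (q ℕ.* 2) → Fin (t ℕ.+ 8)
      f n = join t 8 (g (remQuot 2 n))

      g-injective : ∀ x y → g x ≡ g y → x ≡ y
      g-injective (i , b) (j , b′) eq with trans (sym (strictlyInverseˡ i)) (trans (cong to (code-injective₁ (class (from i)) (class (from j)) eq)) (strictlyInverseˡ j))
      ... | refl = cong (i ,_) (code-injective₂ (class (from i)) eq)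

      f-injective : Injective _≡_ _≡_ f
      f-injective {m} {n} eq = trans (sym (Fin.combine-remQuot {q} 2 m)) (trans (cong (λ (i , b) → combine i b) same) (Fin.combine-remQuot {q} 2 n))
        where
        same : remQuot {q} 2 m ≡ remQuot 2 n
        same = g-injective _ _ (trans (sym (Fin.splitAt-join t 8 _)) (trans (cong (splitAt t) eq) (Fin.splitAt-join t 8 _)))

    good-scalar : ∃ Good
    good-scalar with any? good?
      where
      good? : ∀ κ → Dec (Good κ)
      good? κ = Dec.map′ (λ (p , r , s , u) → record { κ≢0 = p ; κ≢1 = r ; κ²+κ+1≢0 = s ; no-chord = u })
        (λ g → Good.κ≢0 g , Good.κ≢1 g , Good.κ²+κ+1≢0 g , Good.no-chord g)
        (¬? (κ ≟ 0#) ×-dec ¬? (κ ≟ 1#) ×-dec ¬? (κ ² + κ + 1# ≟ 0#) ×-dec Fin.all? (λ i → Fin.all? (λ j → ¬? (chord? κ i j))))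
    ... | yes good = good
    ... | no none = contradiction class all-classes-absurd
      where
      class : ∀ κ → Class κ
      class κ with good-or-class κ
      ... | inj₁ good = contradiction (κ , good) none
      ... | inj₂ c = c

-- Choice of the vertices at infinity

module Frames {q : ℕ} (F : FiniteField q) (2≡0 : HasChar2 F) where
  open FiniteField F
  open Field F
  open Char2 F 2≡0
  open Vectors F 2≡0
  open PlaneArcs F 2≡0

  -- The vertices (ρ₀,0), (0,ρ₁) and κ(ρ₀,ρ₁) of the arms are to avoid the differences of the arc.
  record Frame {t : ℕ} (arc : PlaneArc t) : Set where
    open PlaneArc arc
    field
      ρ₀ ρ₁ κ : Carrier
      ρ₀≢0 : ρ₀ ≢ 0#
      ρ₁≢0 : ρ₁ ≢ 0#
      κ≢0 : κ ≢ 0#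
      κ≢1 : κ ≢ 1#
      κ²+κ+1≢0 : κ ² + κ + 1# ≢ 0#
      no-chord₀ : ∀ i j → ¬ (∀ β → ρ₀ * unit false β ≡ K i β + K j β)
      no-chord₁ : ∀ i j → ¬ (∀ β → ρ₁ * unit true β ≡ K i β + K j β)
      no-chord₂ : ∀ i j → ¬ (∀ β → κ * (ρ₀ * unit false β + ρ₁ * unit true β) ≡ K i β + K j β)

  -- The directions are the two axes and then (ρ₀, ρ₁), known only after the first two choices. The
  -- scalar found along the third is κ itself, so one element must both avoid the differences and
  -- satisfy κ³ ≠ 1.
  frame : ∀ {t} (arc : PlaneArc t) → t ℕ.≤ q → 8 ℕ.< q → Frame arc
  frame arc t≤q 8<q = record
    { ρ₀ = proj₁ good₀ ; ρ₁ = proj₁ good₁ ; κ = proj₁ good₂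
    ; ρ₀≢0 = D₀.Good.κ≢0 (proj₂ good₀) ; ρ₁≢0 = D₁.Good.κ≢0 (proj₂ good₁)
    ; κ≢0 = D₂.Good.κ≢0 (proj₂ good₂) ; κ≢1 = D₂.Good.κ≢1 (proj₂ good₂) ; κ²+κ+1≢0 = D₂.Good.κ²+κ+1≢0 (proj₂ good₂)
    ; no-chord₀ = D₀.Good.no-chord (proj₂ good₀) ; no-chord₁ = D₁.Good.no-chord (proj₂ good₁) ; no-chord₂ = D₂.Good.no-chord (proj₂ good₂)
    }
    where
    module D₀ = Directions arc t≤q 8<q (unit false) (false , 0≢1 ∘ sym)
    module D₁ = Directions arc t≤q 8<q (unit true) (true , 0≢1 ∘ sym)
    good₀ = D₀.good-scalar
    good₁ = D₁.good-scalar
    module D₂ = Directions arc t≤q 8<q (λ β → proj₁ good₀ * unit false β + proj₁ good₁ * unit true β)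
      (false , λ e → D₀.Good.κ≢0 (proj₂ good₀) (trans (solve 2 (λ p r → p := p :* :1 :+ r :* :0) refl (proj₁ good₀) (proj₁ good₁)) e))
    good₂ = D₂.good-scalar

-- The cap of PG(2m+4, q): independence, covering, size

module Construction {q : ℕ} (F : FiniteField q) (2≡0 : HasChar2 F)
  {t : ℕ} (arc : PlaneArcs.PlaneArc F 2≡0 t) (frm : Frames.Frame F 2≡0 arc) (4<q : 4 ℕ.< q) (m : ℕ) where
  open FiniteField F
  open Field F
  open Char2 F 2≡0
  open Parabola F 2≡0
  open Vectors F 2≡0
  open Caps F 2≡0
  open IsCapFamily
  open Enumeration
  open PlaneArcs F 2≡0
  open PlaneArc arc
  open Frames F 2≡0
  open Frame frm
  open CommutativeRing commutativeRing using (*-comm)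

  v₀ v₁ : Bool → Carrier
  v₀ β = ρ₀ * unit false β
  v₁ β = ρ₁ * unit true β

  independent : ∀ {α β} → (∀ b → α * v₀ b + β * v₁ b ≡ 0#) → α ≡ 0# × β ≡ 0#
  independent {α} {β} e =
    *-cancel-0 ρ₀≢0 (trans (solve 4 (λ α β p r → p :* α := α :* (p :* :1) :+ β :* (r :* :0)) refl α β ρ₀ ρ₁) (e false)) ,
    *-cancel-0 ρ₁≢0 (trans (solve 4 (λ α β p r → r :* β := α :* (p :* :0) :+ β :* (r :* :1)) refl α β ρ₀ ρ₁) (e true))

  open Vertices κ κ≢0 κ≢1 κ²+κ+1≢0
  open Arms v₀ v₁ independent
  open Lower 4<q κ κ≢0 κ≢1 κ²+κ+1≢0 using (Low; pointᴸ; low-cap; low-off-conic; low-covers; low-points; length-low-points; tail-nonzero?; +c*0; +b*0+c*0; 3≰toℕ)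
    renaming (Valid to Validᴸ)

  vertex-not-chord : ∀ i k l → ¬ (∀ β → vertex i β ≡ K k β + K l β)
  vertex-not-chord 0F k l e = no-chord₀ k l (λ β → trans (solve 2 (λ v w → v := :1 :* v :+ :0 :* w) refl (v₀ β) (v₁ β)) (e β))
  vertex-not-chord 1F k l e = no-chord₁ k l (λ β → trans (solve 2 (λ v w → w := :0 :* v :+ :1 :* w) refl (v₀ β) (v₁ β)) (e β))
  vertex-not-chord 2F k l e = no-chord₂ k l (λ β → trans (solve 3 (λ κ v w → κ :* (v :+ w) := κ :* v :+ κ :* w) refl κ (v₀ β) (v₁ β)) (e β))

  -- Coordinates of PG(2m+4,q): X₀ at nothing, the others in pairs as in Low.
  Coordinate : Set
  Coordinate = Maybe (Bool × Fin (ℕ.suc (ℕ.suc m)))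

  data Index : Set where
    affine : Fin t → Vec Carrier (ℕ.suc m) → Index
    armᵀ : Fin 3 → Vec Carrier (ℕ.suc m) → Index
    low : Low m → Index

  point : Index → Coordinate → Carrier
  point (affine k x) nothing = 1#
  point (affine k x) (just (b , zero)) = K k b
  point (affine k x) (just (b , suc j)) = sq b (lookup x j)
  point (armᵀ i x) nothing = 0#
  point (armᵀ i x) (just n) = arm i x n
  point (low l) nothing = 0#
  point (low l) (just (b , zero)) = 0#
  point (low l) (just (b , suc j)) = pointᴸ l (b , j)

  Valid : Index → Set
  Valid (affine k x) = ⊤
  Valid (armᵀ i x) = NonZeroVec x
  Valid (low l) = Validᴸ l

  rank : Index → ℕ
  rank (affine k x) = 0
  rank (armᵀ i x) = ℕ.suc (toℕ i)
  rank (low l) = 4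

  -- The X₀-coordinate makes the weights sum to zero, so the parabola parts coincide and the three
  -- points lie in one copy of the plane arc.
  affine-affine-affine : ∀ {i j k x y z} → affine i x ≢ affine j y → affine j y ≢ affine k z → affine i x ≢ affine k z →
    ∀ {a b c} → a ≢ 0# → b ≢ 0# → c ≢ 0# → ¬ (∀ n → a * point (affine i x) n + b * point (affine j y) n + c * point (affine k z) n ≡ 0#)
  affine-affine-affine {i} {j} {k} {x} {y} {z} i≢j j≢k i≢k {a} {b} {c} a≢0 b≢0 c≢0 e =
    K-arc (λ i≡j → i≢j (cong₂ affine i≡j x≡y)) (λ j≡k → j≢k (cong₂ affine j≡k y≡z)) (λ i≡k → i≢k (cong₂ affine i≡k (trans x≡y y≡z)))
      a≢0 b≢0 c≢0 sum≡0 (λ β → e (just (β , zero)))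
    where
    sum≡0 : a + b + c ≡ 0#
    sum≡0 = trans (solve 3 (λ a b c → a :+ b :+ c := a :* :1 :+ b :* :1 :+ c :* :1) refl a b c) (e nothing)

    equal : ∀ n → lookup x n ≡ lookup y n × lookup y n ≡ lookup z n
    equal n = parabola-triple a≢0 b≢0 c≢0 sum≡0 (e (just (false , suc n))) (e (just (true , suc n)))

    x≡y : x ≡ y
    x≡y = lookup-ext (λ n → proj₁ (equal n))

    y≡z : y ≡ z
    y≡z = lookup-ext (λ n → proj₂ (equal n))

  affine-weights : ∀ {a b c} → a * 1# + b * 1# + c * 0# ≡ 0# → a ≡ b
  affine-weights {a} {b} {c} e = +≡0⇒≡ (trans (solve 3 (λ a b c → a :+ b := a :* :1 :+ b :* :1 :+ c :* :0) refl a b c) e)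

  -- X₀ gives a = b, so the affine tails merge into one with parameter x + y. Against the nonzero
  -- tail of the arm this yields a = c, and the heads then express a vertex as a difference of the
  -- plane arc, which the frame excludes.
  affine-affine-arm : ∀ {i j k x y z} → NonZeroVec z → ∀ {a b c} → a ≢ 0# → c ≢ 0# →
    ¬ (∀ n → a * point (affine i x) n + b * point (affine j y) n + c * point (armᵀ k z) n ≡ 0#)
  affine-affine-arm {i} {j} {k} {x} {y} {z} (n , z≢0) {a} {b} {c} a≢0 c≢0 e = vertex-not-chord k i j (λ β → +≡0⇒≡ (*-cancel-0 c≢0 (scaled β)))
    where
    a≡b : a + b ≡ 0#
    a≡b = ≡⇒+≡0 (affine-weights {a} {b} {c} (e nothing))

    a≡c : a ≡ c
    a≡c = parabola-pair-weights {x = lookup x n + lookup y n} a≢0 c≢0 z≢0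
      (lc₂ 1# (lookup y n) (solve 6 (λ a b c x y z → a :* (x :+ y) :+ c :* z := :1 :* (a :* x :+ b :* y :+ c :* z) :+ y :* (a :+ b)) refl a b c _ _ _) (e (just (false , suc n))) a≡b)
      (lc₂ 1# (lookup y n ²) (solve 6 (λ a b c x y z → a :* ((x :+ y) :* (x :+ y)) :+ c :* (z :* z) := :1 :* (a :* (x :* x) :+ b :* (y :* y) :+ c :* (z :* z)) :+ y :* y :* (a :+ b)) refl a b c _ _ _) (e (just (true , suc n))) a≡b)

    scaled : ∀ β → c * (vertex k β + (K i β + K j β)) ≡ 0#
    scaled β = lc₃ 1# (K i β + K j β) (K j β)
      (solve 6 (λ a b c u v w → c :* (w :+ (u :+ v)) := :1 :* (a :* u :+ b :* v :+ c :* w) :+ (u :+ v) :* (a :+ c) :+ v :* (a :+ b)) refl a b c (K i β) (K j β) (vertex k β))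
      (e (just (β , zero))) (≡⇒+≡0 a≡c) a≡b

  cap-family : IsCapFamily Valid point
  cap-family = sorted⇒cap rank (λ {l} → nz {l}) pr tr
    where
    1≢0 : 1# ≢ 0#
    1≢0 = 0≢1 ∘ sym

    nz : ∀ {i} → Valid i → ∃[ n ] point i n ≢ 0#
    nz {affine k x} _ = nothing , 1≢0
    nz {armᵀ i x} (j , x≢0) = just (false , suc j) , x≢0
    nz {low l} v with nonzero (low-cap m) {l} v
    ... | (b , j) , p≢0 = just (b , suc j) , p≢0

    pr : ∀ {i j} → rank i ℕ.≤ rank j → Valid i → Valid j → i ≢ j → ∀ {a b} → a ≢ 0# → b ≢ 0# → ¬ (∀ n → a * point i n + b * point j n ≡ 0#)
    pr {affine i x} {affine j y} _ _ _ i≢j {a} {b} a≢0 b≢0 e = i≢j (cong₂ affine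
        (K-injective (λ β → +≡0⇒≡ (*-cancel-0 a≢0 (lc₂ 1# (K j β) (solve 4 (λ a b u v → a :* (u :+ v) := :1 :* (a :* u :+ b :* v) :+ v :* (a :+ b)) refl a b _ _) (e (just (β , zero))) a+b≡0))))
        (lookup-ext (λ n → parabola-pair a≢0 b≢0 (e (just (false , suc n))) (e (just (true , suc n))))))
      where
      a+b≡0 : a + b ≡ 0#
      a+b≡0 = trans (solve 2 (λ a b → a :+ b := a :* :1 :+ b :* :1) refl a b) (e nothing)
    pr {affine i x} {armᵀ j y} _ _ _ _ {b = b} a≢0 _ e = *-≢0 a≢0 1≢0 (trans (+c*0 b _) (e nothing))
    pr {affine i x} {low l} _ _ _ _ {b = b} a≢0 _ e = *-≢0 a≢0 1≢0 (trans (+c*0 b _) (e nothing))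
    pr {armᵀ i x} {armᵀ j y} _ _ _ i≢j a≢0 b≢0 e with arm-pair a≢0 b≢0 (e ∘ just)
    ... | refl , refl = i≢j refl
    pr {armᵀ i x} {low l} _ _ _ _ {b = b} a≢0 _ e = a≢0 (vertex≢0 i (λ β → trans (+c*0 b _) (e (just (β , zero)))))
    pr {low l} {low l′} _ v v′ i≢j a≢0 b≢0 e = pair (low-cap m) {l} {l′} v v′ (i≢j ∘ cong low) a≢0 b≢0 (λ (b , j) → e (just (b , suc j)))
    pr {armᵀ _ _} {affine _ _} ()
    pr {low _} {affine _ _} ()
    pr {low _} {armᵀ _ _} (ℕ.s≤s r) = contradiction r 3≰toℕ

    tr : ∀ {i j k} → rank i ℕ.≤ rank j → rank j ℕ.≤ rank k → Valid i → Valid j → Valid k → i ≢ j → j ≢ k → i ≢ k → ∀ {a b c} → a ≢ 0# → b ≢ 0# → c ≢ 0# →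
      ¬ (∀ n → a * point i n + b * point j n + c * point k n ≡ 0#)
    tr {affine i x} {affine j y} {affine k z} _ _ _ _ _ i≢j j≢k i≢k a≢0 b≢0 c≢0 e = affine-affine-affine i≢j j≢k i≢k a≢0 b≢0 c≢0 e
    tr {affine i x} {affine j y} {armᵀ k z} _ _ _ _ z≢0 _ _ _ a≢0 b≢0 c≢0 e = affine-affine-arm z≢0 a≢0 c≢0 e
    tr {affine i x} {affine j y} {low l} _ _ _ _ v _ _ _ {a} {b} {c} a≢0 b≢0 c≢0 e = low-off-conic {l = l} v
      (secant⇒conic {x = x} {y} a≢0 c≢0 (affine-weights {a} {b} {c} (e nothing)) (λ β j → e (just (β , suc j))))
    tr {affine i x} {armᵀ _ _} {armᵀ _ _} _ _ _ _ _ _ _ _ {b = b} {c} a≢0 _ _ e = *-≢0 a≢0 1≢0 (trans (+b*0+c*0 b c _) (e nothing))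
    tr {affine i x} {armᵀ _ _} {low _} _ _ _ _ _ _ _ _ {b = b} {c} a≢0 _ _ e = *-≢0 a≢0 1≢0 (trans (+b*0+c*0 b c _) (e nothing))
    tr {affine i x} {low _} {low _} _ _ _ _ _ _ _ _ {b = b} {c} a≢0 _ _ e = *-≢0 a≢0 1≢0 (trans (+b*0+c*0 b c _) (e nothing))
    tr {armᵀ i x} {armᵀ j y} {armᵀ k z} (ℕ.s≤s i≤j) (ℕ.s≤s j≤k) _ _ vz i≢j _ _ a≢0 b≢0 c≢0 e = arm-triple i≤j j≤k vz (λ i≡j x≡y → i≢j (cong₂ armᵀ i≡j x≡y)) a≢0 b≢0 c≢0 (e ∘ just)
    tr {armᵀ i x} {armᵀ j y} {low l} _ _ _ _ v _ _ _ {c = c} a≢0 b≢0 c≢0 e = low-off-conic {l = l} v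
      (secant⇒conic {x = x} {y} a≢0 c≢0 (proj₂ (same-vertex {i} {j} a≢0 (λ β → trans (+c*0 c _) (e (just (β , zero)))))) (λ β j → e (just (β , suc j))))
    tr {armᵀ i x} {low _} {low _} _ _ _ _ _ _ _ _ {b = b} {c} a≢0 _ _ e = a≢0 (vertex≢0 i (λ β → trans (+b*0+c*0 b c _) (e (just (β , zero)))))
    tr {low l} {low l′} {low l″} _ _ v v′ v″ i≢j j≢k i≢k a≢0 b≢0 c≢0 e =
      triple (low-cap m) {l} {l′} {l″} v v′ v″ (i≢j ∘ cong low) (j≢k ∘ cong low) (i≢k ∘ cong low) a≢0 b≢0 c≢0 (λ (b , j) → e (just (b , suc j)))
    tr {armᵀ _ _} {affine _ _} ()
    tr {low _} {affine _ _} ()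
    tr {low _} {armᵀ _ _} (ℕ.s≤s r) = contradiction r 3≰toℕ
    tr {_} {armᵀ _ _} {affine _ _} _ ()
    tr {_} {low _} {affine _ _} _ ()
    tr {_} {low _} {armᵀ _ _} _ (ℕ.s≤s r) = contradiction r 3≰toℕ

  InSpan : (Coordinate → Carrier) → Set
  InSpan p = ∃[ i ] ∃[ j ] ∃[ a ] ∃[ b ] (Valid i × Valid j × ∀ n → p n ≡ a * point i n + b * point j n)

  affine-chord : ∀ {i j l m} (p : Coordinate → Carrier) → l ≢ 0# → m ≢ 0# → p nothing ≢ 0# → l + m ≡ p nothing →
    (∀ β → p (just (β , zero)) ≡ l * K i β + m * K j β) → InSpan p
  affine-chord {i} {j} {l} {m} p l≢0 m≢0 p≢0 l+m≡p head =
    let (x , y , e) = parabola-chords l≢0 m≢0 (λ l+m≡0 → p≢0 (trans (sym l+m≡p) l+m≡0)) (λ (b , j) → p (just (b , suc j))) in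
    affine i x , affine j y , l , m , tt , tt , λ where
      nothing → trans (sym l+m≡p) (solve 2 (λ l m → l :+ m := l :* :1 :+ m :* :1) refl l m)
      (just (β , zero)) → head β
      (just (β , suc j)) → e β j

  -- The plane part is a point of the arc, so both ends are taken above it. The weight X₀ is split
  -- into two nonzero summands, hence the two forbidden values.
  affine-fibre : ∀ {i} (p : Coordinate → Carrier) → p nothing ≢ 0# → (∀ β → p (just (β , zero)) ≡ p nothing * K i β) → InSpan p
  affine-fibre {i} p p≢0 head = affine-chord {i} {i} {l} {l + p nothing} p (off 0F ∘ sym) (off 1F ∘ sym ∘ +≡0⇒≡) p≢0
      (solve 2 (λ l x → l :+ (l :+ x) := x) refl l _) (λ β → trans (head β) (solve 3 (λ l x k → x :* k := l :* k :+ (l :+ x) :* k) refl l _ _))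
    where
    bad : Fin 2 → Carrier
    bad 0F = 0#
    bad 1F = p nothing
    choice = fresh (ℕ.<-trans (ℕ.m≤m+n 3 1) 4<q) bad
    l = proj₁ choice
    off : ∀ i → bad i ≢ l
    off = proj₂ choice

  -- `K-covers` supplies the plane parts of the ends, and the parabolas then realise any tail with
  -- these weights. A zero weight leaves a single point of the arc, the case of `affine-fibre`.
  covers-affine : ∀ p → p nothing ≢ 0# → InSpan p
  covers-affine p p≢0 = by-weights (a ≟ 0#) (b ≟ 0#)
    where
    x₀ = p nothing
    d = proj₁ (inverse x₀ p≢0)
    x₀d+1≡0 : x₀ * d + 1# ≡ 0#
    x₀d+1≡0 = ≡⇒+≡0 (proj₂ (inverse x₀ p≢0))
    covering = K-covers (λ β → p (just (β , zero)) * d)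
    i = proj₁ covering
    j = proj₁ (proj₂ covering)
    a = proj₁ (proj₂ (proj₂ covering))
    b = proj₁ (proj₂ (proj₂ (proj₂ covering)))
    a+b≡1 : a + b ≡ 1#
    a+b≡1 = proj₁ (proj₂ (proj₂ (proj₂ (proj₂ covering))))
    covered : ∀ β → p (just (β , zero)) * d ≡ a * K i β + b * K j β
    covered = proj₂ (proj₂ (proj₂ (proj₂ (proj₂ covering))))

    head : ∀ β → p (just (β , zero)) ≡ x₀ * a * K i β + x₀ * b * K j β
    head β = +≡0⇒≡ (lc₂ x₀ (p (just (β , zero)))
      (solve 7 (λ x d a b w u v → w :+ (x :* a :* u :+ x :* b :* v) := x :* (w :* d :+ (a :* u :+ b :* v)) :+ w :* (x :* d :+ :1)) refl x₀ d a b _ (K i β) (K j β))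
      (≡⇒+≡0 (covered β)) x₀d+1≡0)

    by-weights : Dec (a ≡ 0#) → Dec (b ≡ 0#) → InSpan p
    by-weights (no a≢0) (no b≢0) = affine-chord p (*-≢0 p≢0 a≢0) (*-≢0 p≢0 b≢0) p≢0
      (+≡0⇒≡ (lc₁ x₀ (solve 3 (λ x a b → x :* a :+ x :* b :+ x := x :* (a :+ b :+ :1)) refl x₀ a b) (≡⇒+≡0 a+b≡1))) head
    by-weights (yes a≡0) _ = affine-fibre {j} p p≢0 (λ β → +≡0⇒≡ (lc₃ 1# (x₀ * K j β) (x₀ * (K i β + K j β))
      (solve 6 (λ x a b u v w → w :+ x :* v := :1 :* (w :+ (x :* a :* u :+ x :* b :* v)) :+ x :* v :* (a :+ b :+ :1) :+ x :* (u :+ v) :* a) refl x₀ a b (K i β) (K j β) _)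
      (≡⇒+≡0 (head β)) (≡⇒+≡0 a+b≡1) a≡0))
    by-weights _ (yes b≡0) = affine-fibre {i} p p≢0 (λ β → +≡0⇒≡ (lc₃ 1# (x₀ * K i β) (x₀ * (K i β + K j β))
      (solve 6 (λ x a b u v w → w :+ x :* u := :1 :* (w :+ (x :* a :* u :+ x :* b :* v)) :+ x :* u :* (a :+ b :+ :1) :+ x :* (u :+ v) :* b) refl x₀ a b (K i β) (K j β) _)
      (≡⇒+≡0 (head β)) (≡⇒+≡0 a+b≡1) b≡0))

  covers-arms : ∀ p → p nothing ≡ 0# → (∃[ b ] ∃[ j ] p (just (b , suc j)) ≢ 0#) → ¬ (∀ b → p (just (b , zero)) ≡ 0#) → InSpan p
  covers-arms p x₀≡0 tail≢0 head≢0 = let (i , j , x , y , a , b , x≢0 , y≢0 , e) = Cover.cover 4<q (p ∘ just) tail≢0 (w * d) (w′ * d′) nonzero′ head in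
      armᵀ i x , armᵀ j y , a , b , x≢0 , y≢0 , λ where
        nothing → trans x₀≡0 (solve 2 (λ a b → :0 := a :* :0 :+ b :* :0) refl a b)
        (just n) → e n
    where
    w = p (just (false , zero))
    w′ = p (just (true , zero))
    d = proj₁ (inverse ρ₀ ρ₀≢0)
    d′ = proj₁ (inverse ρ₁ ρ₁≢0)

    head : ∀ b → p (just (b , zero)) ≡ w * d * v₀ b + w′ * d′ * v₁ b
    head false = +≡0⇒≡ (lc₁ w (solve 6 (λ w w′ d d′ r r′ → w :+ (w :* d :* (r :* :1) :+ w′ :* d′ :* (r′ :* :0)) := w :* (r :* d :+ :1)) refl w w′ d d′ ρ₀ ρ₁) (≡⇒+≡0 (proj₂ (inverse ρ₀ ρ₀≢0))))
    head true = +≡0⇒≡ (lc₁ w′ (solve 6 (λ w w′ d d′ r r′ → w′ :+ (w :* d :* (r :* :0) :+ w′ :* d′ :* (r′ :* :1)) := w′ :* (r′ :* d′ :+ :1)) refl w w′ d d′ ρ₀ ρ₁) (≡⇒+≡0 (proj₂ (inverse ρ₁ ρ₁≢0))))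

    nonzero′ : ¬ (w * d ≡ 0# × w′ * d′ ≡ 0#)
    nonzero′ (α≡0 , β≡0) = head≢0 (λ b → lc₂ (v₀ b) (v₁ b) (trans (head b) (cong₂ _+_ (*-comm _ (v₀ b)) (*-comm _ (v₁ b)))) α≡0 β≡0)

  covers-low : ∀ p → p nothing ≡ 0# → (∀ b → p (just (b , zero)) ≡ 0#) → InSpan p
  covers-low p x₀≡0 head≡0 with any? (λ c → ¬? (c ≟ 0#) ×-dec onConic? c (λ (b , j) → p (just (b , suc j))))
  ... | no off = let (l , l′ , a , b , v , v′ , e) = low-covers (λ (b , j) → p (just (b , suc j))) off in
    low l , low l′ , a , b , v , v′ , λ where
      nothing → trans x₀≡0 (solve 2 (λ a b → :0 := a :* :0 :+ b :* :0) refl a b)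
      (just (β , zero)) → trans (head≡0 β) (solve 2 (λ a b → :0 := a :* :0 :+ b :* :0) refl a b)
      (just (β , suc j)) → e (β , j)
  -- Two affine points above the same point of the arc, with equal weights: X₀ and the plane parts
  -- cancel, and the tails at 0 and y/c give c (y/c, (y/c)²), which is the tail of `p` by the conic
  -- equation.
  ... | yes (c , c≢0 , on) = affine i (replicate _ 0#) , affine i x , c , c , tt , tt , λ where
      nothing → trans x₀≡0 (solve 1 (λ c → :0 := c :* :1 :+ c :* :1) refl c)
      (just (β , zero)) → trans (head≡0 β) (sym (x+x≡0 _))
      (just (β , suc j)) → trans (tail β j) (sym (cong₂ (λ u v → c * sq β u + c * sq β v) (Vec.lookup-replicate j 0#) (Vec.lookup∘tabulate (λ j → p (just (false , suc j)) * d) j)))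
    where
    -- Any point of the arc will do; covering the origin provides one.
    i = proj₁ (K-covers (λ _ → 0#))
    d = proj₁ (inverse c c≢0)
    cd+1≡0 : c * d + 1# ≡ 0#
    cd+1≡0 = ≡⇒+≡0 (proj₂ (inverse c c≢0))
    x = tabulate (λ j → p (just (false , suc j)) * d)

    tail : ∀ β j → p (just (β , suc j)) ≡ c * sq β 0# + c * sq β (p (just (false , suc j)) * d)
    tail false j = +≡0⇒≡ (lc₁ (p (just (false , suc j))) (solve 3 (λ c d y → y :+ (c :* :0 :+ c :* (y :* d)) := y :* (c :* d :+ :1)) refl c d _) cd+1≡0)
    tail true j = +≡0⇒≡ (lc₂ (c * d * d) (p (just (true , suc j)) * (c * d + 1#))
      (solve 4 (λ c d y z → z :+ (c :* (:0 :* :0) :+ c :* (y :* d :* (y :* d))) := c :* d :* d :* (y :* y :+ c :* z) :+ z :* (c :* d :+ :1) :* (c :* d :+ :1)) refl c d _ _) (≡⇒+≡0 (on j)) cd+1≡0)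

  OnLine∞ : (Coordinate → Carrier) → Set
  OnLine∞ p = p nothing ≡ 0# × (∀ b j → p (just (b , suc j)) ≡ 0#)

  covers-off-line∞ : ∀ p → InSpan p ⊎ OnLine∞ p
  covers-off-line∞ p with p nothing ≟ 0# | tail-nonzero? (p ∘ just) | p (just (false , zero)) ≟ 0# | p (just (true , zero)) ≟ 0#
  ... | no p≢0 | _ | _ | _ = inj₁ (covers-affine p p≢0)
  ... | yes p≡0 | inj₂ tail≡0 | _ | _ = inj₂ (p≡0 , tail≡0)
  ... | yes p≡0 | inj₁ tail≢0 | yes w≡0 | yes w′≡0 = inj₁ (covers-low p p≡0 λ { false → w≡0 ; true → w′≡0 })
  ... | yes p≡0 | inj₁ tail≢0 | no w≢0 | _ = inj₁ (covers-arms p p≡0 tail≢0 (λ head≡0 → w≢0 (head≡0 false)))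
  ... | yes p≡0 | inj₁ tail≢0 | _ | no w′≢0 = inj₁ (covers-arms p p≡0 tail≢0 (λ head≡0 → w′≢0 (head≡0 true)))

  covers-line∞ : ∀ p → OnLine∞ p → (∃[ i ] ∃[ j ] ∃[ c ] ∀ b → p (just (b , zero)) ≡ c * K i b + c * K j b) → InSpan p
  covers-line∞ p (p≡0 , tail≡0) (i , j , c , e) = affine i (replicate _ 0#) , affine j (replicate _ 0#) , c , c , tt , tt , λ where
    nothing → trans p≡0 (sym (x+x≡0 _))
    (just (b , zero)) → e b
    (just (b , suc j)) → trans (tail≡0 b j) (sym (x+x≡0 _))

  points : Enumeration Valid
  points = record { list = affines ++ (arms ++ lows) ; unique = unique′ ; sound = sound′ ; complete = complete′ }
    where
    nz = nonzero-vectors (ℕ.suc m)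
    affines = cartesianProductWith affine (allFin t) (vectors (ℕ.suc m))
    arms = cartesianProductWith armᵀ (allFin 3) (list nz)
    lows = map low (list (low-points m))

    ∈affines⇒ : ∀ {i} → i ∈ affines → ∃[ k ] ∃[ x ] i ≡ affine k x
    ∈affines⇒ i∈ with ∈-cartesianProductWith⁻ affine (allFin t) (vectors (ℕ.suc m)) i∈
    ... | k , x , _ , _ , eq = k , x , eq

    ∈arms⇒ : ∀ {i} → i ∈ arms → ∃[ k ] ∃[ x ] (i ≡ armᵀ k x × NonZeroVec x)
    ∈arms⇒ i∈ with ∈-cartesianProductWith⁻ armᵀ (allFin 3) (list nz) i∈
    ... | k , x , _ , x∈ , eq = k , x , eq , sound nz x∈

    ∈lows⇒ : ∀ {i} → i ∈ lows → ∃[ l ] (i ≡ low l × Validᴸ l)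
    ∈lows⇒ i∈ with ∈-map⁻ low i∈
    ... | l , l∈ , eq = l , eq , sound (low-points m) l∈

    affine≢ : ∀ {i} → i ∈ affines → ¬ (i ∈ arms ++ lows)
    affine≢ i∈ i∈′ with ∈affines⇒ i∈ | ∈-++⁻ arms i∈′
    ... | _ , _ , refl | inj₁ ∈arms with ∈arms⇒ ∈arms
    ...   | _ , _ , () , _
    affine≢ i∈ i∈′ | _ , _ , refl | inj₂ ∈lows with ∈lows⇒ ∈lows
    ...   | _ , () , _

    arm≢low : ∀ {i} → i ∈ arms → ¬ (i ∈ lows)
    arm≢low i∈ i∈′ with ∈arms⇒ i∈ | ∈lows⇒ i∈′
    ... | _ , _ , refl , _ | _ , () , _

    unique′ : Unique (affines ++ (arms ++ lows))
    unique′ = Unique.++⁺ (Unique.cartesianProductWith⁺ affine (λ { refl → refl , refl }) (Unique.allFin⁺ t) (vectors-unique (ℕ.suc m)))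
      (Unique.++⁺ (Unique.cartesianProductWith⁺ armᵀ (λ { refl → refl , refl }) (Unique.allFin⁺ 3) (unique nz))
        (Unique.map⁺ (λ { refl → refl }) (unique (low-points m))) (λ (i∈ , i∈′) → arm≢low i∈ i∈′))
      (λ (i∈ , i∈′) → affine≢ i∈ i∈′)

    sound′ : ∀ {i} → i ∈ affines ++ (arms ++ lows) → Valid i
    sound′ i∈ with ∈-++⁻ affines i∈
    ... | inj₁ ∈affines with ∈affines⇒ ∈affines
    ...   | _ , _ , refl = tt
    sound′ i∈ | inj₂ i∈′ with ∈-++⁻ arms i∈′
    ... | inj₁ ∈arms with ∈arms⇒ ∈arms
    ...   | _ , _ , refl , v = v
    sound′ i∈ | inj₂ i∈′ | inj₂ ∈lows with ∈lows⇒ ∈lows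
    ...   | _ , refl , v = v

    complete′ : ∀ {i} → Valid i → i ∈ affines ++ (arms ++ lows)
    complete′ {affine k x} _ = ∈-++⁺ˡ (∈-cartesianProductWith⁺ affine (∈-allFin k) (∈-vectors x))
    complete′ {armᵀ i x} x≢0 = ∈-++⁺ʳ affines (∈-++⁺ˡ (∈-cartesianProductWith⁺ armᵀ (∈-allFin i) (complete nz x≢0)))
    complete′ {low l} v = ∈-++⁺ʳ affines (∈-++⁺ʳ arms (∈-map⁺ low (complete (low-points m) v)))

  -- The top arms save 3 and the lower part saves 2(m + 1) - 4, in all N - 3 with N = 4 + 2m.
  length-points : length (list points) ℕ.+ (4 ℕ.+ 2 ℕ.* m) ℕ.≤ (t ℕ.+ 3) ℕ.* q ℕ.^ ℕ.suc m ℕ.+ 3 ℕ.* sumPow q m ℕ.+ 3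
  length-points = begin
    length (affines ++ (arms ++ lows)) ℕ.+ (4 ℕ.+ 2 ℕ.* m)
      ≡⟨ cong (ℕ._+ (4 ℕ.+ 2 ℕ.* m)) total ⟩
    t ℕ.* Q ℕ.+ (3 ℕ.* n ℕ.+ l) ℕ.+ (4 ℕ.+ 2 ℕ.* m)
      ≡⟨ regroup (t ℕ.* Q) n l m ⟩
    t ℕ.* Q ℕ.+ (3 ℕ.* n ℕ.+ (l ℕ.+ 2 ℕ.* ℕ.suc m)) ℕ.+ 2
      ≤⟨ ℕ.+-monoˡ-≤ 2 (ℕ.+-monoʳ-≤ (t ℕ.* Q) (ℕ.+-monoʳ-≤ (3 ℕ.* n) (length-low-points m))) ⟩
    t ℕ.* Q ℕ.+ (3 ℕ.* n ℕ.+ (3 ℕ.* S ℕ.+ 4)) ℕ.+ 2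
      ≡⟨ regroup′ (t ℕ.* Q) n S ⟩
    t ℕ.* Q ℕ.+ 3 ℕ.* ℕ.suc n ℕ.+ 3 ℕ.* S ℕ.+ 3
      ≤⟨ ℕ.+-monoˡ-≤ 3 (ℕ.+-monoˡ-≤ (3 ℕ.* S) (ℕ.+-monoʳ-≤ (t ℕ.* Q) (ℕ.*-monoʳ-≤ 3 (length-nonzero-vectors (ℕ.suc m))))) ⟩
    t ℕ.* Q ℕ.+ 3 ℕ.* Q ℕ.+ 3 ℕ.* S ℕ.+ 3
      ≡⟨ cong (λ z → z ℕ.+ 3 ℕ.* S ℕ.+ 3) (ℕ.*-distribʳ-+ Q t 3) ⟨
    (t ℕ.+ 3) ℕ.* Q ℕ.+ 3 ℕ.* S ℕ.+ 3 ∎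
    where
    open ℕ.≤-Reasoning
    affines = cartesianProductWith affine (allFin t) (vectors (ℕ.suc m))
    arms = cartesianProductWith armᵀ (allFin 3) (list (nonzero-vectors (ℕ.suc m)))
    lows = map low (list (low-points m))
    Q = q ℕ.^ ℕ.suc m
    S = sumPow q m
    n = length (list (nonzero-vectors (ℕ.suc m)))
    l = length (list (low-points m))

    total : length (affines ++ (arms ++ lows)) ≡ t ℕ.* Q ℕ.+ (3 ℕ.* n ℕ.+ l)
    total = trans (List.length-++ affines) (cong₂ ℕ._+_
      (trans (length-cartesianProductWith affine (allFin t) (vectors (ℕ.suc m))) (cong₂ ℕ._*_ (List.length-tabulate {n = t} (λ i → i)) (length-vectors (ℕ.suc m))))
      (trans (List.length-++ arms) (cong₂ ℕ._+_ (length-cartesianProductWith armᵀ (allFin 3) (list (nonzero-vectors (ℕ.suc m)))) (List.length-map low (list (low-points m))))))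

    regroup : ∀ x n l m → x ℕ.+ (3 ℕ.* n ℕ.+ l) ℕ.+ (4 ℕ.+ 2 ℕ.* m) ≡ x ℕ.+ (3 ℕ.* n ℕ.+ (l ℕ.+ 2 ℕ.* ℕ.suc m)) ℕ.+ 2
    regroup = solve-∀

    regroup′ : ∀ x n s → x ℕ.+ (3 ℕ.* n ℕ.+ (3 ℕ.* s ℕ.+ 4)) ℕ.+ 2 ≡ x ℕ.+ 3 ℕ.* ℕ.suc n ℕ.+ 3 ℕ.* s ℕ.+ 3
    regroup′ = solve-∀

-- Plane arcs in affine charts

module Charts {q : ℕ} (F : FiniteField q) (2≡0 : HasChar2 F) where
  open FiniteField F
  open Field F
  open Char2 F 2≡0
  open Geometry F
  open Caps F 2≡0
  open IsCapFamily
  open Parabola F 2≡0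
  open PlaneArcs F 2≡0
  open Inverse enum using (to; from; strictlyInverseˡ; strictlyInverseʳ)

  -- The substitute for arcs with more than q points. Every affine point is on a chord with weights
  -- l and l + 1, where l is neither 0 nor 1.
  parabola : 8 ℕ.< q → PlaneArc q
  parabola 8<q = record
    { K = λ i β → sq β (from i)
    ; K-injective = λ {i} {j} eq → from-injective (eq false)
    ; K-arc = λ i≢j j≢k i≢k a≢0 b≢0 c≢0 sum≡0 e → i≢j (from-injective (proj₁ (parabola-triple a≢0 b≢0 c≢0 sum≡0 (e false) (e true))))
    ; K-covers = covers
    }
    where
    from-injective : ∀ {i j} → from i ≡ from j → i ≡ j
    from-injective {i} {j} eq = trans (sym (strictlyInverseˡ i)) (trans (cong to eq) (strictlyInverseˡ j))

    bad : Fin 2 → Carrier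
    bad 0F = 0#
    bad 1F = 1#

    choice = fresh (ℕ.<-trans (ℕ.m≤m+n 3 5) 8<q) bad
    l = proj₁ choice

    covers : ∀ (u : Bool → Carrier) → ∃[ i ] ∃[ j ] ∃[ a ] ∃[ b ] (a + b ≡ 1# × ∀ β → u β ≡ a * sq β (from i) + b * sq β (from j))
    covers u = let (x , y , e , e′) = parabola-chord l (l + 1#) (proj₂ choice 0F ∘ sym) (proj₂ choice 1F ∘ sym ∘ +≡0⇒≡) (λ e → 0≢1 (sym (trans (sym sum≡1) e))) (u false) (u true) in
      to x , to y , l , l + 1# , sum≡1 , λ where
          false → subst₂ (λ x y → u false ≡ l * x + (l + 1#) * y) (sym (strictlyInverseʳ x)) (sym (strictlyInverseʳ y)) e
          true → subst₂ (λ x y → u true ≡ l * x ² + (l + 1#) * y ²) (sym (strictlyInverseʳ x)) (sym (strictlyInverseʳ y)) e′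
      where
      sum≡1 : l + (l + 1#) ≡ 1#
      sum≡1 = solve 1 (λ l → l :+ (l :+ :1) := :1) refl l

  -- An invertible linear change of coordinates, given by what is used of it: combinations go
  -- forward, relations come back. The line where the first coordinate of `f` vanishes becomes the
  -- line at infinity.
  record Chart : Set where
    field
      f : Vect 2 → Vect 2
      f-linear : ∀ {x u v a b} → (∀ n → x n ≡ a * u n + b * v n) → ∀ n → f x n ≡ a * f u n + b * f v n
      f-reflects : ∀ {u v w a b c} → (∀ n → a * f u n + b * f v n + c * f w n ≡ 0#) → ∀ n → a * u n + b * v n + c * w n ≡ 0#
      f-surjective : ∀ (z : Vect 2) → ∃[ x ] ∀ n → f x n ≡ z n

  identity-chart : Chart
  identity-chart = record { f = λ x → x ; f-linear = λ e → e ; f-reflects = λ e → e ; f-surjective = λ z → z , λ _ → refl }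

  -- Moves the line c X₀ + b X₁ + X₂ = 0 to infinity.
  shear-chart : Carrier → Carrier → Chart
  shear-chart c b = record { f = f ; f-linear = f-linear ; f-reflects = f-reflects ; f-surjective = f-surjective }
    where
    f : Vect 2 → Vect 2
    f x 0F = c * x 0F + (b * x 1F + x 2F)
    f x 1F = x 0F
    f x 2F = x 1F

    f-linear : ∀ {x u v l m} → (∀ n → x n ≡ l * u n + m * v n) → ∀ n → f x n ≡ l * f u n + m * f v n
    f-linear {x} {u} {v} {l} {m} e 0F = trans (cong₂ _+_ (cong (c *_) (e 0F)) (cong₂ _+_ (cong (b *_) (e 1F)) (e 2F)))
      (trans (cong₂ _+_ (distribute c (u 0F) (v 0F)) (cong (_+ (l * u 2F + m * v 2F)) (distribute b (u 1F) (v 1F))))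
        (trans (solve 6 (λ x y z x′ y′ z′ → x :+ x′ :+ (y :+ y′ :+ (z :+ z′)) := x :+ (y :+ z) :+ (x′ :+ (y′ :+ z′))) refl _ _ _ _ _ _)
          (cong₂ _+_ (sym (collect l c b (u 0F) (u 1F) (u 2F))) (sym (collect m c b (v 0F) (v 1F) (v 2F))))))
      where
      distribute : ∀ c x y → c * (l * x + m * y) ≡ l * (c * x) + m * (c * y)
      distribute c x y = solve 5 (λ c l m x y → c :* (l :* x :+ m :* y) := l :* (c :* x) :+ m :* (c :* y)) refl c l m x y
      collect : ∀ l c b x y z → l * (c * x + (b * y + z)) ≡ l * (c * x) + (l * (b * y) + l * z)
      collect = solve 6 (λ l c b x y z → l :* (c :* x :+ (b :* y :+ z)) := l :* (c :* x) :+ (l :* (b :* y) :+ l :* z)) refl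
    f-linear e 1F = e 0F
    f-linear e 2F = e 1F

    f-reflects : ∀ {u v w k l m} → (∀ n → k * f u n + l * f v n + m * f w n ≡ 0#) → ∀ n → k * u n + l * v n + m * w n ≡ 0#
    f-reflects e 0F = e 1F
    f-reflects e 1F = e 2F
    f-reflects {u} {v} {w} {k} {l} {m} e 2F = lc₃ c b 1#
      (trans (solve 6 (λ x y z x′ y′ z′ → x :+ y :+ z := x :+ x′ :+ (y :+ y′) :+ (z :+ z′) :+ (x′ :+ y′ :+ z′)) refl (k * u 2F) (l * v 2F) (m * w 2F) (k * (c * u 0F + b * u 1F)) (l * (c * v 0F + b * v 1F)) (m * (c * w 0F + b * w 1F)))
        (trans (cong₂ _+_ (cong₂ _+_ (cong₂ _+_ (collect k u) (collect l v)) (collect m w)) (spread k l m (u 0F) (u 1F) (v 0F) (v 1F) (w 0F) (w 1F)))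
          (solve 3 (λ x y z → x :+ (y :+ z) := y :+ z :+ :1 :* x) refl _ _ _)))
      (e 1F) (e 2F) (e 0F)
      where
      collect : ∀ k (u : Vect 2) → k * u 2F + k * (c * u 0F + b * u 1F) ≡ k * (c * u 0F + (b * u 1F + u 2F))
      collect k u = solve 6 (λ k c b x y z → k :* z :+ k :* (c :* x :+ b :* y) := k :* (c :* x :+ (b :* y :+ z))) refl k c b _ _ _
      spread : ∀ k l m x y x′ y′ x″ y″ → k * (c * x + b * y) + l * (c * x′ + b * y′) + m * (c * x″ + b * y″) ≡ c * (k * x + l * x′ + m * x″) + b * (k * y + l * y′ + m * y″)
      spread k l m x y x′ y′ x″ y″ = trans (cong₂ _+_ (cong₂ _+_ (one k x y) (one l x′ y′)) (one m x″ y″))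
        (solve 8 (λ c b p q r s t u → c :* p :+ b :* q :+ (c :* r :+ b :* s) :+ (c :* t :+ b :* u) := c :* (p :+ r :+ t) :+ b :* (q :+ s :+ u)) refl c b (k * x) (k * y) (l * x′) (l * y′) (m * x″) (m * y″))
        where
        one : ∀ k x y → k * (c * x + b * y) ≡ c * (k * x) + b * (k * y)
        one k x y = solve 5 (λ k c b x y → k :* (c :* x :+ b :* y) := c :* (k :* x) :+ b :* (k :* y)) refl k c b x y

    f-surjective : ∀ (z : Vect 2) → ∃[ x ] ∀ n → f x n ≡ z n
    f-surjective z = x , λ where
        0F → solve 5 (λ c b x y z → c :* x :+ (b :* y :+ (z :+ (c :* x :+ b :* y))) := z) refl c b (z 1F) (z 2F) (z 0F)
        1F → refl
        2F → refl
      where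
      x : Vect 2
      x 0F = z 1F
      x 1F = z 2F
      x 2F = z 0F + (c * z 1F + b * z 2F)

  module FromChart (chart : Chart) (C : List (Vect 2)) (cap : Cap 2 C)
    (off : ∀ i → Chart.f chart (List.lookup C i) 0F ≢ 0#)
    (covers : ∀ x → NonZeroV x → Chart.f chart x 0F ≢ 0# → Covered C x) where
    open Chart chart

    P : Fin (length C) → Vect 2
    P = List.lookup C

    family : IsCapFamily (λ _ → ⊤) P
    family = Cap⇒family {C = C} cap

    d : Fin (length C) → Carrier
    d i = proj₁ (inverse (f (P i) 0F) (off i))

    d-inverse : ∀ i → f (P i) 0F * d i + 1# ≡ 0#
    d-inverse i = ≡⇒+≡0 (proj₂ (inverse (f (P i) 0F) (off i)))

    d≢0 : ∀ i → d i ≢ 0#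
    d≢0 i e = 0≢1 (trans (solve 1 (λ x → :0 := x :* :0) refl (f (P i) 0F)) (trans (cong (f (P i) 0F *_) (sym e)) (proj₂ (inverse (f (P i) 0F) (off i)))))

    coordinate : Bool → Fin 3
    coordinate false = 1F
    coordinate true = 2F

    K : Fin (length C) → Bool → Carrier
    K i β = f (P i) (coordinate β) * d i

    -- Absorbing the normalising factors `d` into the weights turns an affine relation into a linear
    -- one between the chosen representatives. The condition on the sum supplies its first
    -- coordinate.
    relation : ∀ {i j k a b c} → a + b + c ≡ 0# → (∀ β → a * K i β + b * K j β + c * K k β ≡ 0#) →
      ∀ n → a * d i * P i n + b * d j * P j n + c * d k * P k n ≡ 0#
    relation {i} {j} {k} {a} {b} {c} sum≡0 e = f-reflects relation′
      where
      shuffle : ∀ (x y z : Carrier) → a * d i * x + b * d j * y + c * d k * z ≡ a * (x * d i) + b * (y * d j) + c * (z * d k)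
      shuffle x y z = cong₂ _+_ (cong₂ _+_ (one a (d i) x) (one b (d j) y)) (one c (d k) z)
        where
        one : ∀ a d x → a * d * x ≡ a * (x * d)
        one = solve 3 (λ a d x → a :* d :* x := a :* (x :* d)) refl

      relation′ : ∀ n → a * d i * f (P i) n + b * d j * f (P j) n + c * d k * f (P k) n ≡ 0#
      relation′ 0F = trans (shuffle _ _ _) (trans (cong₂ _+_ (cong₂ _+_ (cong (a *_) (+≡0⇒≡ (d-inverse i))) (cong (b *_) (+≡0⇒≡ (d-inverse j)))) (cong (c *_) (+≡0⇒≡ (d-inverse k))))
        (trans (solve 3 (λ a b c → a :* :1 :+ b :* :1 :+ c :* :1 := a :+ b :+ c) refl a b c) sum≡0))
      relation′ 1F = trans (shuffle _ _ _) (e false)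
      relation′ 2F = trans (shuffle _ _ _) (e true)

    f-combination : ∀ {x a b i j} → (∀ n → x n ≡ a * P i n + b * P j n) → ∀ β → f x (coordinate β) ≡ a * f (P i) 0F * K i β + b * f (P j) 0F * K j β
    f-combination {x} {a} {b} {i} {j} e β = trans (f-linear e (coordinate β)) (cong₂ _+_ (normalise a i) (normalise b j))
      where
      normalise : ∀ a i → a * f (P i) (coordinate β) ≡ a * f (P i) 0F * K i β
      normalise a i = +≡0⇒≡ (lc₁ (a * f (P i) (coordinate β)) (solve 4 (λ a x l d → a :* x :+ a :* l :* (x :* d) := a :* x :* (l :* d :+ :1)) refl a _ _ (d i)) (d-inverse i))

    preimage : ∀ (z : Vect 2) n → z n ≢ 0# → ∃[ x ] (NonZeroV x × ∀ n → f x n ≡ z n)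
    preimage z n z≢0 = x , Dec.decidable-stable (Fin.any? (λ n → ¬? (x n ≟ 0#))) x≢0 , proj₂ (f-surjective z)
      where
      x = proj₁ (f-surjective z)
      x≢0 : ¬ ¬ NonZeroV x
      x≢0 ¬nz = z≢0 (trans (sym (proj₂ (f-surjective z) n)) (trans (f-linear {x} {x} {x} {0#} {0#}
        (λ n → trans (¬nonZero⇒0 ¬nz n) (solve 1 (λ x → :0 := :0 :* x :+ :0 :* x) refl (x n))) n) (solve 1 (λ x → :0 :* x :+ :0 :* x := :0) refl (f x n))))

    homogeneous : Carrier → (Bool → Carrier) → Vect 2
    homogeneous x₀ u 0F = x₀
    homogeneous x₀ u 1F = u false
    homogeneous x₀ u 2F = u true

    homogeneous-coordinate : ∀ x₀ u β → homogeneous x₀ u (coordinate β) ≡ u β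
    homogeneous-coordinate x₀ u false = refl
    homogeneous-coordinate x₀ u true = refl

    planeArc : PlaneArc (length C)
    planeArc = record { K = K ; K-injective = injective ; K-arc = noncollinear ; K-covers = covers′ }
      where
      injective : ∀ {i j} → (∀ β → K i β ≡ K j β) → i ≡ j
      injective {i} {j} eq with i Fin.≟ j
      ... | yes i≡j = i≡j
      ... | no i≢j = contradiction (λ n → trans (solve 4 (λ d d′ x y → d :* x :+ d′ :* y := :1 :* d :* x :+ :1 :* d′ :* y :+ :0 :* d′ :* y) refl (d i) (d j) (P i n) (P j n))
          (relation {i} {j} {j} {1#} {1#} {0#} (solve 0 (:1 :+ :1 :+ :0 := :0) refl)
            (λ β → trans (solve 2 (λ x y → :1 :* x :+ :1 :* y :+ :0 :* y := x :+ y) refl (K i β) (K j β)) (≡⇒+≡0 (eq β))) n))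
        (pair family tt tt i≢j (d≢0 i) (d≢0 j))

      noncollinear : ∀ {i j k} → i ≢ j → j ≢ k → i ≢ k → ∀ {a b c} → a ≢ 0# → b ≢ 0# → c ≢ 0# → a + b + c ≡ 0# → ¬ (∀ β → a * K i β + b * K j β + c * K k β ≡ 0#)
      noncollinear {i} {j} {k} i≢j j≢k i≢k a≢0 b≢0 c≢0 sum≡0 e =
        triple family tt tt tt i≢j j≢k i≢k (*-≢0 a≢0 (d≢0 i)) (*-≢0 b≢0 (d≢0 j)) (*-≢0 c≢0 (d≢0 k)) (relation {i} {j} {k} sum≡0 e)

      covers′ : ∀ (u : Bool → Carrier) → ∃[ i ] ∃[ j ] ∃[ a ] ∃[ b ] (a + b ≡ 1# × ∀ β → u β ≡ a * K i β + b * K j β)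
      covers′ u =
        let (x , x≢0 , fx≡) = preimage (homogeneous 1# u) 0F (0≢1 ∘ sym)
            (i , j , a , b , e) = covers x x≢0 (λ fx≡0 → 0≢1 (trans (sym fx≡0) (fx≡ 0F)))
        in i , j , a * f (P i) 0F , b * f (P j) 0F , trans (sym (f-linear e 0F)) (fx≡ 0F) ,
          λ β → trans (sym (homogeneous-coordinate 1# u β)) (trans (sym (fx≡ (coordinate β))) (f-combination {x} {a} {b} {i} {j} e β))

    -- On a secant through a point at infinity, the vanishing first coordinate makes the two
    -- normalised weights equal.
    directions : (∀ x → NonZeroV x → Covered C x) → ∀ (w : Bool → Carrier) β → w β ≢ 0# → ∃[ i ] ∃[ j ] ∃[ c ] ∀ β → w β ≡ c * K i β + c * K j β
    directions covers w β w≢0 =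
      let (x , x≢0 , fx≡) = preimage (homogeneous 0# w) (coordinate β) (λ e → w≢0 (trans (sym (homogeneous-coordinate 0# w β)) e))
          (i , j , a , b , e) = covers x x≢0
          c≡c′ = +≡0⇒≡ (trans (sym (f-linear e 0F)) (fx≡ 0F))
      in i , j , a * f (P i) 0F , λ β → trans (sym (homogeneous-coordinate 0# w β)) (trans (sym (fx≡ (coordinate β)))
        (trans (f-combination {x} {a} {b} {i} {j} e β) (cong (λ c → a * f (P i) 0F * K i β + c * K j β) (sym c≡c′))))

-- A line missing a small complete arc

module ExternalLine {q : ℕ} (F : FiniteField q) (2≡0 : HasChar2 F) where
  open FiniteField F
  open Field F
  open Char2 F 2≡0
  open Geometry F
  open Caps F 2≡0
  open IsCapFamily
  open Parabola F 2≡0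
  open Charts F 2≡0

  -- The one value of the parameter for which the linear form vanishes at the point. If y = 0 the
  -- claim is vacuous and `0#` is a dummy.
  root : ∀ y z → ∃[ r ] ∀ {x} → y ≢ 0# → x * y + z ≡ 0# → r ≡ x
  root y z with y ≟ 0#
  ... | yes y≡0 = 0# , λ y≢0 → contradiction y≡0 y≢0
  ... | no y≢0 = let (d , yd≡1) = inverse y y≢0 in
    z * d , λ {x} _ e → +≡0⇒≡ (lc₂ d x (solve 4 (λ x y z d → z :* d :+ x := d :* (x :* y :+ z) :+ x :* (y :* d :+ :1)) refl x y z d) e (≡⇒+≡0 yd≡1))

  fresh-except : ∀ {t} → t ℕ.≤ q → (f : Fin t → Carrier) (i₀ : Fin t) → ∃[ x ] ∀ i → i ≢ i₀ → f i ≢ x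
  fresh-except {ℕ.suc t} t<q f i₀ = let (x , off) = fresh t<q (f ∘ punchIn i₀) in
    x , λ i i≢i₀ fi≡x → off (punchOut (i≢i₀ ∘ sym)) (trans (cong f (Fin.punchIn-punchOut (i≢i₀ ∘ sym))) fi≡x)

  -- A line c X₀ + b X₁ + X₂ = 0 missing the arc: first b is chosen for the points on X₀ = 0, then c for the others; both choices
  -- leave out one point of the arc, so that t ≤ q suffices.
  external-chart : ∀ (C : List (Vect 2)) → Cap 2 C → length C ℕ.≤ q → (∀ x → NonZeroV x → Covered C x) →
    ∃[ chart ] ∀ i → Chart.f chart (List.lookup C i) 0F ≢ 0#
  external-chart C cap t≤q covers with Fin.any? (λ i → List.lookup C i 0F ≟ 0#)
  ... | no none = identity-chart , λ i e → none (i , e)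
  ... | yes (i₀ , i₀≡0) = shear-chart c b , λ i → nonzero-at i
    where
    P = List.lookup C

    e₀ : Vect 2
    e₀ 0F = 1#
    e₀ 1F = 0#
    e₀ 2F = 0#

    -- Otherwise all secants would lie in X₀ = 0 and none would cover (1, 0, 0).
    affine-point : ∃[ j ] P j 0F ≢ 0#
    affine-point = Dec.decidable-stable (Fin.any? (λ j → ¬? (P j 0F ≟ 0#))) (λ none →
      let (i , j , a , b , e) = covers e₀ (0F , 0≢1 ∘ sym) in
      0≢1 (sym (trans (e 0F) (trans (cong₂ (λ x y → a * x + b * y) (¬nonZero⇒0 none i) (¬nonZero⇒0 none j)) (solve 2 (λ a b → a :* :0 :+ b :* :0 := :0) refl a b)))))

    j₀ = proj₁ affine-point

    choice-b = fresh-except t≤q (λ i → proj₁ (root (P i 1F) (P i 2F))) j₀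
    b = proj₁ choice-b

    -- At `i₀` the first coordinate is zero, so the value of the form there is already settled by
    -- `b`.
    choice-c = fresh-except t≤q (λ i → proj₁ (root (P i 0F) (b * P i 1F + P i 2F))) i₀
    c = proj₁ choice-c

    at-infinity : ∀ i → P i 0F ≡ 0# → b * P i 1F + P i 2F ≢ 0#
    at-infinity i P₀≡0 e with P i 1F ≟ 0#
    ... | no P₁≢0 = proj₂ choice-b i (λ { refl → proj₂ affine-point P₀≡0 }) (proj₂ (root (P i 1F) (P i 2F)) P₁≢0 e)
    ... | yes P₁≡0 = let (n , P≢0) = proj₁ cap i in P≢0 (all-zero n)
      where
      all-zero : ∀ n → P i n ≡ 0#
      all-zero 0F = P₀≡0
      all-zero 1F = P₁≡0
      all-zero 2F = lc₂ 1# b (solve 3 (λ b x y → y := :1 :* (b :* x :+ y) :+ b :* x) refl b (P i 1F) (P i 2F)) e P₁≡0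

    nonzero-at : ∀ i → c * P i 0F + (b * P i 1F + P i 2F) ≢ 0#
    nonzero-at i e with P i 0F ≟ 0#
    ... | no P₀≢0 = proj₂ choice-c i (λ { refl → P₀≢0 i₀≡0 }) (proj₂ (root (P i 0F) (b * P i 1F + P i 2F)) P₀≢0 e)
    ... | yes P₀≡0 = at-infinity i P₀≡0 (lc₂ 1# c (solve 3 (λ c x y → y := :1 :* (c :* x :+ y) :+ c :* x) refl c (P i 0F) (b * P i 1F + P i 2F)) e P₀≡0)

  -- The weight of `x` cannot vanish, because two distinct points of the arc are independent;
  -- dividing by it solves for `x`.
  affinely-complete⇒covers : ∀ {C} → AffinelyComplete C → ∀ x → NonZeroV x → x 0F ≢ 0# → Covered C x
  affinely-complete⇒covers {C} ((cap , _) , full) x x≢0 x₀≢0 with full x x≢0 x₀≢0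
  ... | i , j , i≢j , a , b , c , abc≢0 , e with a ≟ 0# | b ≟ 0# | c ≟ 0#
  ...   | no a≢0 | _ | _ = let (d , ad≡1) = inverse a a≢0 in i , j , d * b , d * c , λ n → +≡0⇒≡ (lc₂ d (x n)
          (solve 7 (λ a b c d x y z → x :+ (d :* b :* y :+ d :* c :* z) := d :* (a :* x :+ b :* y :+ c :* z) :+ x :* (a :* d :+ :1)) refl a b c d _ _ _) (e n) (≡⇒+≡0 ad≡1))
  ...   | yes a≡0 | yes b≡0 | yes c≡0 = contradiction (a≡0 , b≡0 , c≡0) abc≢0
  ...   | yes refl | yes refl | no c≢0 = let (n , P≢0) = proj₁ cap j in
          contradiction (trans (solve 4 (λ c x y z → c :* z := :0 :* x :+ :0 :* y :+ c :* z) refl c (x n) (List.lookup C i n) (List.lookup C j n)) (e n)) (*-≢0 c≢0 P≢0)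
  ...   | yes refl | no b≢0 | yes refl = let (n , P≢0) = proj₁ cap i in
          contradiction (trans (solve 4 (λ b x y z → b :* y := :0 :* x :+ b :* y :+ :0 :* z) refl b (x n) (List.lookup C i n) (List.lookup C j n)) (e n)) (*-≢0 b≢0 P≢0)
  ...   | yes refl | no b≢0 | no c≢0 = contradiction
          (λ n → trans (solve 5 (λ b c x y z → b :* y :+ c :* z := :0 :* x :+ b :* y :+ c :* z) refl b c (x n) (List.lookup C i n) (List.lookup C j n)) (e n))
          (pair (Cap⇒family {C = C} cap) tt tt i≢j b≢0 c≢0)

-- Completing a cap along a line

module Completion {q : ℕ} (F : FiniteField q) (2≡0 : HasChar2 F) where
  open FiniteField F
  open Field F
  open Char2 F 2≡0
  open Geometry F
  open Caps F 2≡0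

  module _ {n : ℕ} (u v : Vect n) where
    onLine : Carrier → Carrier → Vect n
    onLine a b k = a * u k + b * v k

    CoversOffLine : List (Vect n) → Set
    CoversOffLine C = ∀ x → NonZeroV x → Covered C x ⊎ (∃[ a ] ∃[ b ] ∀ k → x k ≡ onLine a b k)

    weaken : ∀ {C : List (Vect n)} {x y} → Covered C x → Covered (y ∷ C) x
    weaken (i , j , a , b , e) = suc i , suc j , a , b , e

    extendable? : ∀ C → (∀ a b → NonZeroV (onLine a b) → Covered C (onLine a b)) ⊎
      (∃[ a ] ∃[ b ] (NonZeroV (onLine a b) × ¬ Covered C (onLine a b)))
    extendable? C with any? (λ a → any? (λ b → Fin.any? (λ k → ¬? (onLine a b k ≟ 0#)) ×-dec ¬? (covered? C (onLine a b))))
    ... | yes found = inj₂ found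
    ... | no none = inj₁ (λ a b nz → Dec.decidable-stable (covered? C (onLine a b)) (λ uncovered → none (a , b , nz , uncovered)))

    line-covered⇒complete : ∀ {C} → Cap n C → CoversOffLine C → (∀ a b → NonZeroV (onLine a b) → Covered C (onLine a b)) → CompleteCap n C
    line-covered⇒complete {C} cap off line = covering⇒complete {C = C} cap cover
      where
      cover : ∀ x → NonZeroV x → Covered C x
      cover x x≢0 with off x x≢0
      ... | inj₁ covered = covered
      ... | inj₂ (a , b , e) = let (k , xk≢0) = x≢0
                                   (i , j , a′ , b′ , e′) = line a b (k , λ z → xk≢0 (trans (e k) z))
                               in i , j , a′ , b′ , λ k → trans (e k) (e′ k)

    -- If the determinant ad + bc is nonzero, Cramer's rule applies. If it is zero, the second point
    -- is a multiple of the first and was covered already.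
    two-points-span : ∀ {C a b c d} → NonZeroV (onLine a b) → ¬ Covered (onLine a b ∷ C) (onLine c d) →
      ∀ a′ b′ → Covered (onLine c d ∷ onLine a b ∷ C) (onLine a′ b′)
    two-points-span {C} {a} {b} {c} {d} (k , nz) uncovered a′ b′ with a * d + b * c ≟ 0#
    ... | no det≢0 = let (δ , detδ≡1) = inverse (a * d + b * c) det≢0 in
      suc zero , zero , (a′ * d + b′ * c) * δ , (a * b′ + b * a′) * δ , λ k → cramer δ detδ≡1 (u k) (v k)
      where
      cramer : ∀ δ → (a * d + b * c) * δ ≡ 1# → ∀ x y → a′ * x + b′ * y ≡ (a′ * d + b′ * c) * δ * (a * x + b * y) + (a * b′ + b * a′) * δ * (c * x + d * y)
      cramer δ detδ≡1 x y = +≡0⇒≡ (lc₁ (a′ * x + b′ * y) (trans (cong (a′ * x + b′ * y +_) (factor x y)) (solve 2 (λ z e → z :+ z :* e := z :* (e :+ :1)) refl (a′ * x + b′ * y) ((a * d + b * c) * δ))) (≡⇒+≡0 detδ≡1))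
        where
        adjugate : ∀ x y → (a′ * d + b′ * c) * (a * x + b * y) + (a * b′ + b * a′) * (c * x + d * y) ≡ (a′ * x + b′ * y) * (a * d + b * c)
        adjugate x y = solve 8 (λ a b c d a′ b′ x y → (a′ :* d :+ b′ :* c) :* (a :* x :+ b :* y) :+ (a :* b′ :+ b :* a′) :* (c :* x :+ d :* y) := (a′ :* x :+ b′ :* y) :* (a :* d :+ b :* c)) refl a b c d a′ b′ x y
        factor : ∀ x y → (a′ * d + b′ * c) * δ * (a * x + b * y) + (a * b′ + b * a′) * δ * (c * x + d * y) ≡ (a′ * x + b′ * y) * ((a * d + b * c) * δ)
        factor x y = trans (solve 5 (λ p r s t δ → p :* δ :* r :+ s :* δ :* t := (p :* r :+ s :* t) :* δ) refl _ _ _ _ δ)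
          (trans (cong (_* δ) (adjugate x y)) (solve 3 (λ p r δ → p :* r :* δ := p :* (r :* δ)) refl _ _ δ))
    ... | yes det≡0 = contradiction (proportional (a ≟ 0#) (b ≟ 0#)) uncovered
      where
      proportional : Dec (a ≡ 0#) → Dec (b ≡ 0#) → Covered (onLine a b ∷ C) (onLine c d)
      proportional (yes refl) (yes refl) = contradiction (solve 2 (λ x y → :0 :* x :+ :0 :* y := :0) refl (u k) (v k)) nz
      proportional (no a≢0) _ = let (δ , aδ≡1) = inverse a a≢0 in zero , zero , c * δ , 0# , λ k → +≡0⇒≡ (lc₂ (c * u k + d * v k) (δ * v k)
        (solve 7 (λ a b c d δ x y → c :* x :+ d :* y :+ (c :* δ :* (a :* x :+ b :* y) :+ :0 :* (a :* x :+ b :* y)) := (c :* x :+ d :* y) :* (a :* δ :+ :1) :+ δ :* y :* (a :* d :+ b :* c)) refl a b c d δ (u k) (v k)) (≡⇒+≡0 aδ≡1) det≡0)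
      proportional _ (no b≢0) = let (δ , bδ≡1) = inverse b b≢0 in zero , zero , d * δ , 0# , λ k → +≡0⇒≡ (lc₂ (c * u k + d * v k) (δ * u k)
        (solve 7 (λ a b c d δ x y → c :* x :+ d :* y :+ (d :* δ :* (a :* x :+ b :* y) :+ :0 :* (a :* x :+ b :* y)) := (c :* x :+ d :* y) :* (b :* δ :+ :1) :+ δ :* x :* (a :* d :+ b :* c)) refl a b c d δ (u k) (v k)) (≡⇒+≡0 bδ≡1) det≡0)

    -- Greedy extension by uncovered points of the line stops after two steps, since two added
    -- points span the line.
    complete-on-line : ∀ C → Cap n C → CoversOffLine C → ∃[ C′ ] (CompleteCap n C′ × length C′ ℕ.≤ 2 ℕ.+ length C)
    complete-on-line C cap off with extendable? C
    ... | inj₁ line = C , line-covered⇒complete cap off line , ℕ.m≤n+m _ 2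
    ... | inj₂ (a , b , nz , uncovered) with extendable? (onLine a b ∷ C)
    ...   | inj₁ line = onLine a b ∷ C , line-covered⇒complete cap₁ off₁ line , ℕ.n≤1+n _
      where
      cap₁ = extend-cap {C = C} cap nz uncovered
      off₁ : CoversOffLine (onLine a b ∷ C)
      off₁ x x≢0 = Sum.map₁ (weaken {C} {x}) (off x x≢0)
    ...   | inj₂ (c , d , nz₁ , uncovered₁) = onLine c d ∷ onLine a b ∷ C , line-covered⇒complete cap₂ off₂ (λ a′ b′ _ → two-points-span {C} nz uncovered₁ a′ b′) , ℕ.≤-refl
      where
      cap₂ = extend-cap {C = onLine a b ∷ C} (extend-cap {C = C} cap nz uncovered) nz₁ uncovered₁
      off₂ : CoversOffLine (onLine c d ∷ onLine a b ∷ C)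
      off₂ x x≢0 = Sum.map₁ (weaken {onLine a b ∷ C} {x} ∘ weaken {C} {x}) (off x x≢0)

-- From labelled coordinates to lists of vectors

module Embedding {q : ℕ} (F : FiniteField q) (2≡0 : HasChar2 F)
  {t : ℕ} (arc : PlaneArcs.PlaneArc F 2≡0 t) (frm : Frames.Frame F 2≡0 arc) (4<q : 4 ℕ.< q) (m : ℕ) where
  open FiniteField F
  open Field F
  open Char2 F 2≡0
  open Geometry F
  open Caps F 2≡0
  open Vectors F 2≡0 using (unit)
  open Enumeration
  open PlaneArcs F 2≡0
  open PlaneArc arc
  open Completion F 2≡0
  open Construction F 2≡0 arc frm 4<q m

  h : ℕ
  h = ℕ.suc (ℕ.suc m)

  -- The order is X₀, then the block of first members of the pairs, then the block of second
  -- members; thus h + h is the projective dimension.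
  decode : Fin (ℕ.suc (h ℕ.+ h)) → Coordinate
  decode zero = nothing
  decode (suc n) = just (Sum.[ false ,_ , true ,_ ] (splitAt h n))

  encode : Coordinate → Fin (ℕ.suc (h ℕ.+ h))
  encode nothing = zero
  encode (just (false , i)) = suc (i ↑ˡ h)
  encode (just (true , i)) = suc (h ↑ʳ i)

  decode-encode : ∀ c → decode (encode c) ≡ c
  decode-encode nothing = refl
  decode-encode (just (false , i)) = cong (just ∘ Sum.[ false ,_ , true ,_ ]) (Fin.splitAt-↑ˡ h i h)
  decode-encode (just (true , i)) = cong (just ∘ Sum.[ false ,_ , true ,_ ]) (Fin.splitAt-↑ʳ h h i)

  encode-decode : ∀ n → encode (decode n) ≡ n
  encode-decode zero = refl
  encode-decode (suc n) = trans (encode-tag (splitAt h n)) (cong suc (Fin.join-splitAt h h n))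
    where
    encode-tag : ∀ s → encode (just (Sum.[ false ,_ , true ,_ ] s)) ≡ suc (join h h s)
    encode-tag (inj₁ i) = refl
    encode-tag (inj₂ i) = refl

  vector : Index → Vect (h ℕ.+ h)
  vector i = point i ∘ decode

  C : List (Vect (h ℕ.+ h))
  C = map vector (list points)

  open Labels vector

  cap : Cap (h ℕ.+ h) C
  cap = family⇒Cap {C = C} (reindex (label (list points)) encode (λ {i} _ → sound points (label-∈ (list points) i))
    (λ {i} {j} _ _ → label-injective (unique points) i j)
    (λ i n → trans (cong (λ v → v (encode n)) (lookup-label (list points) i)) (cong (point (label (list points) i)) (decode-encode n))) cap-family)

  span⇒covered : ∀ x → InSpan (x ∘ encode) → Covered C x
  span⇒covered x (i , j , a , b , vi , vj , e) =
    let (k , k≡) = label-surjective (complete points {i} vi)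
        (l , l≡) = label-surjective (complete points {j} vj)
    in k , l , a , b , λ n → trans (cong x (sym (encode-decode n))) (trans (e (decode n))
      (sym (cong₂ (λ u v → a * u n + b * v n) (trans (lookup-label (list points) k) (cong vector k≡)) (trans (lookup-label (list points) l) (cong vector l≡)))))

  line∞ : Bool → Vect (h ℕ.+ h)
  line∞ b n = on (decode n)
    where
    on : Coordinate → Carrier
    on (just (b′ , zero)) = unit b b′
    on _ = 0#

  off-line : CoversOffLine (line∞ false) (line∞ true) C
  off-line x x≢0 with covers-off-line∞ (x ∘ encode)
  ... | inj₁ span = inj₁ (span⇒covered x span)
  ... | inj₂ (x₀≡0 , tail≡0) = inj₂ (w , w′ , λ n → trans (cong x (sym (encode-decode n))) (on-line n))
    where
    w = x (encode (just (false , zero)))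
    w′ = x (encode (just (true , zero)))
    on-line : ∀ n → x (encode (decode n)) ≡ w * line∞ false n + w′ * line∞ true n
    on-line n with decode n
    ... | nothing = trans x₀≡0 (solve 2 (λ w w′ → :0 := w :* :0 :+ w′ :* :0) refl w w′)
    ... | just (false , zero) = solve 2 (λ w w′ → w := w :* :1 :+ w′ :* :0) refl w w′
    ... | just (true , zero) = solve 2 (λ w w′ → w′ := w :* :0 :+ w′ :* :1) refl w w′
    ... | just (b , suc j) = trans (tail≡0 b j) (solve 2 (λ w w′ → :0 := w :* :0 :+ w′ :* :0) refl w w′)

  length-C : length C ℕ.+ (h ℕ.+ h) ℕ.≤ (t ℕ.+ 3) ℕ.* q ℕ.^ ℕ.suc m ℕ.+ 3 ℕ.* sumPow q m ℕ.+ 3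
  length-C = ℕ.≤-trans (ℕ.≤-reflexive (cong₂ ℕ._+_ (List.length-map vector (list points)) (dimension m))) length-points
    where
    dimension : ∀ m → ℕ.suc (ℕ.suc m) ℕ.+ ℕ.suc (ℕ.suc m) ≡ 4 ℕ.+ 2 ℕ.* m
    dimension = solve-∀

  complete-cap₅ : ∃[ C′ ] (CompleteCap (h ℕ.+ h) C′ × length C′ ℕ.+ (h ℕ.+ h) ℕ.≤ (t ℕ.+ 3) ℕ.* q ℕ.^ ℕ.suc m ℕ.+ 3 ℕ.* sumPow q m ℕ.+ 5)
  complete-cap₅ = let (C′ , complete′ , length′) = complete-on-line (line∞ false) (line∞ true) C cap off-line in
    C′ , complete′ , ℕ.≤-trans (ℕ.+-monoˡ-≤ (h ℕ.+ h) length′) (ℕ.≤-trans (ℕ.+-monoʳ-≤ 2 length-C) (ℕ.≤-reflexive (+2 ((t ℕ.+ 3) ℕ.* q ℕ.^ ℕ.suc m) (3 ℕ.* sumPow q m))))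
    where
    +2 : ∀ x y → 2 ℕ.+ (x ℕ.+ y ℕ.+ 3) ≡ x ℕ.+ y ℕ.+ 5
    +2 = solve-∀

  -- If the differences of the plane arc fill all directions, then the affine points with zero
  -- parabola part already cover the line (w; 0), and no point has to be added.
  complete-cap₃ : (∀ (w : Bool → Carrier) β → w β ≢ 0# → ∃[ i ] ∃[ j ] ∃[ c ] ∀ β → w β ≡ c * K i β + c * K j β) → CompleteCap (h ℕ.+ h) C
  complete-cap₃ directions = covering⇒complete {C = C} cap cover
    where
    cover : ∀ x → NonZeroV x → Covered C x
    cover x (n , x≢0) with covers-off-line∞ (x ∘ encode)
    ... | inj₁ span = span⇒covered x span
    ... | inj₂ on@(x₀≡0 , tail≡0) = span⇒covered x (covers-line∞ (x ∘ encode) on (in-direction (decode n) (λ e → x≢0 (trans (cong x (sym (encode-decode n))) e))))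
      where
      in-direction : ∀ c → x (encode c) ≢ 0# → ∃[ i ] ∃[ j ] ∃[ c ] ∀ b → x (encode (just (b , zero))) ≡ c * K i b + c * K j b
      in-direction nothing ≢0 = contradiction x₀≡0 ≢0
      in-direction (just (b , suc j)) ≢0 = contradiction (tail≡0 b j) ≢0
      in-direction (just (b , zero)) ≢0 = directions (λ b → x (encode (just (b , zero)))) b ≢0

-- Upper bounds from a given plane arc

module Bounds {q : ℕ} (F : FiniteField q) (2≡0 : HasChar2 F) (8<q : 8 ℕ.< q) (m : ℕ) where
  open Geometry F
  open Caps F 2≡0
  open PlaneArcs F 2≡0
  open Frames F 2≡0
  open Charts F 2≡0
  open ExternalLine F 2≡0

  h : ℕ
  h = ℕ.suc (ℕ.suc m)

  size : ℕ → ℕ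
  size t = (t ℕ.+ 3) ℕ.* q ℕ.^ ℕ.suc m ℕ.+ 3 ℕ.* sumPow q m

  CapWithin : ℕ → Set
  CapWithin n = ∃[ C ] (CompleteCap (h ℕ.+ h) C × length C ℕ.+ (h ℕ.+ h) ℕ.≤ n)

  4<q : 4 ℕ.< q
  4<q = ℕ.<-trans (ℕ.m≤m+n 5 3) 8<q

  size-mono : ∀ {s t} → s ℕ.≤ t → size s ℕ.≤ size t
  size-mono s≤t = ℕ.+-monoˡ-≤ (3 ℕ.* sumPow q m) (ℕ.*-monoˡ-≤ (q ℕ.^ ℕ.suc m) (ℕ.+-monoˡ-≤ 3 s≤t))

  2≤q^ : 2 ℕ.≤ q ℕ.^ ℕ.suc m
  2≤q^ = ℕ.≤-trans (ℕ.≤-trans (ℕ.m≤m+n 2 3) 4<q) (ℕ.≤-trans (ℕ.≤-reflexive (sym (ℕ.^-identityʳ q))) (ℕ.^-monoʳ-≤ q ⦃ ℕ.>-nonZero (ℕ.<-trans (ℕ.s≤s ℕ.z≤n) 4<q) ⦄ {1} {ℕ.suc m} (ℕ.s≤s ℕ.z≤n)))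

  -- One more point of the arc is worth q^(m+1) ≥ 2, which pays for the two points added on the line
  -- (w; 0).
  size-suc : ∀ t → size t ℕ.+ 2 ℕ.≤ size (ℕ.suc t)
  size-suc t = begin
    a ℕ.+ s ℕ.+ 2            ≡⟨ ℕ.+-comm (a ℕ.+ s) 2 ⟩
    2 ℕ.+ (a ℕ.+ s)          ≡⟨ ℕ.+-assoc 2 a s ⟨
    2 ℕ.+ a ℕ.+ s            ≤⟨ ℕ.+-monoˡ-≤ s (ℕ.+-monoˡ-≤ a 2≤q^) ⟩
    q ℕ.^ ℕ.suc m ℕ.+ a ℕ.+ s ∎
    where
    open ℕ.≤-Reasoning
    a = (t ℕ.+ 3) ℕ.* q ℕ.^ ℕ.suc m
    s = 3 ℕ.* sumPow q m

  planeArc⇒cap : ∀ {t} → PlaneArc t → t ℕ.≤ q → CapWithin (size t ℕ.+ 5)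
  planeArc⇒cap arc t≤q = Embedding.complete-cap₅ F 2≡0 arc (frame arc t≤q 8<q) 4<q m

  parabola-cap : CapWithin (size q ℕ.+ 5)
  parabola-cap = planeArc⇒cap (parabola 8<q) ℕ.≤-refl

  within-mono : ∀ {n n′} → n ℕ.≤ n′ → CapWithin n → CapWithin n′
  within-mono n≤n′ (C , complete , bound) = C , complete , ℕ.≤-trans bound n≤n′

  affinely-complete⇒cap : ∀ C → AffinelyComplete C → CapWithin (size (length C) ℕ.+ 5)
  affinely-complete⇒cap C complete@((cap , affine) , _) with length C ℕ.≤? q
  ... | yes t≤q = planeArc⇒cap (FromChart.planeArc identity-chart C cap affine (affinely-complete⇒covers {C} complete)) t≤q
  ... | no t≰q = within-mono (ℕ.+-monoˡ-≤ 5 (size-mono (ℕ.<⇒≤ (ℕ.≰⇒> t≰q)))) parabola-cap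

  -- Up to q points the arc has an external line, and being complete it covers that line too, which
  -- gives the constant 3. Beyond q, the parabola gives only the constant 5, but with at least one
  -- point less.
  complete⇒cap : ∀ C → CompleteCap 2 C → CapWithin (size (length C) ℕ.+ 3)
  complete⇒cap C complete@(cap , _) with length C ℕ.≤? q
  ... | no t≰q = within-mono bound parabola-cap
    where
    open ℕ.≤-Reasoning
    bound : size q ℕ.+ 5 ℕ.≤ size (length C) ℕ.+ 3
    bound = begin
      size q ℕ.+ (2 ℕ.+ 3) ≡⟨ ℕ.+-assoc (size q) 2 3 ⟨
      size q ℕ.+ 2 ℕ.+ 3   ≤⟨ ℕ.+-monoˡ-≤ 3 (ℕ.≤-trans (size-suc q) (size-mono (ℕ.≰⇒> t≰q))) ⟩
      size (length C) ℕ.+ 3 ∎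
  ... | yes t≤q with external-chart C cap t≤q (complete⇒covering complete)
  ...   | chart , off = Emb.C , Emb.complete-cap₃ (directions (complete⇒covering complete)) , Emb.length-C
    where
    open FromChart chart C cap off (λ x x≢0 _ → complete⇒covering complete x x≢0)
    module Emb = Embedding F 2≡0 planeArc (frame planeArc t≤q 8<q) 4<q m

-- The bounds for the smallest complete caps

open import Data.Nat using (_+_; _*_; _∸_; _^_; _≤_; _<_; ⌊_/2⌋)

⌊2*n/2⌋≡n : ∀ n → ⌊ 2 * n /2⌋ ≡ n
⌊2*n/2⌋≡n n = trans (cong (λ k → ⌊ n + k /2⌋) (ℕ.+-identityʳ n)) (sym (ℕ.n≡⌊n+n/2⌋ n))

theorem3p15 : (q N : ℕ) → (∃[ k ] (q ≡ 2 ^ k)) → 8 < q →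
    (∃[ h ] (N ≡ 2 * h)) → 2 < N →
    (F : FiniteField q) → (tN t tA : ℕ) →
    Geometry.IsT2 F N tN → Geometry.IsT2 F 2 t → Geometry.IsT2A F tA →
    (tN ≤ ((t + 3) * q ^ ⌊ N ∸ 2 /2⌋ + 3 * sumPow q ⌊ N ∸ 4 /2⌋ + 3) ∸ N) ×
    (tN ≤ ((tA + 3) * q ^ ⌊ N ∸ 2 /2⌋ + 3 * sumPow q ⌊ N ∸ 4 /2⌋ + 5) ∸ N)
theorem3p15 q N _ _ (0 , refl) () F tN t tA _ _ _
theorem3p15 q N _ _ (1 , refl) (ℕ.s≤s (ℕ.s≤s ())) F tN t tA _ _ _
theorem3p15 q N (k , q≡2^k) 8<q (ℕ.suc (ℕ.suc m) , N≡2h) _ F tN t tA (_ , smallest) ((C , complete , refl) , _) ((CA , completeA , refl) , _) =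
  bound 3 (length C) (complete⇒cap C complete) , bound 5 (length CA) (affinely-complete⇒cap CA completeA)
  where
  open Field F using (even⇒char2)
  open Bounds F (even⇒char2 k q≡2^k) 8<q m

  N≡h+h : N ≡ h + h
  N≡h+h = trans N≡2h (cong (h +_) (ℕ.+-identityʳ h))

  N≡4+2m : N ≡ 4 + 2 * m
  N≡4+2m = trans N≡2h (double m)
    where
    double : ∀ m → 2 * ℕ.suc (ℕ.suc m) ≡ 4 + 2 * m
    double = solve-∀

  half₂ : ⌊ N ∸ 2 /2⌋ ≡ ℕ.suc m
  half₂ = trans (cong (λ n → ⌊ n ∸ 2 /2⌋) N≡4+2m) (cong ℕ.suc (⌊2*n/2⌋≡n m))

  half₄ : ⌊ N ∸ 4 /2⌋ ≡ m
  half₄ = trans (cong (λ n → ⌊ n ∸ 4 /2⌋) N≡4+2m) (⌊2*n/2⌋≡n m)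

  bound : ∀ c t → CapWithin (size t + c) → tN ≤ ((t + 3) * q ^ ⌊ N ∸ 2 /2⌋ + 3 * sumPow q ⌊ N ∸ 4 /2⌋ + c) ∸ N
  bound c t (C′ , complete′ , within) = subst₂ (λ a b → tN ≤ ((t + 3) * q ^ a + 3 * sumPow q b + c) ∸ N) (sym half₂) (sym half₄)
    -- The estimate was kept in the form size + N ≤ total, so moving N across is safe for truncated
    -- subtraction.
    (ℕ.m+n≤o⇒m≤o∸n tN (ℕ.≤-trans (ℕ.+-mono-≤ tN≤ (ℕ.≤-reflexive N≡h+h)) within))
    where
    tN≤ : tN ≤ length C′
    -- The type of a cap depends on the dimension, so the equation is eliminated with the dimension
    -- generalised to a variable.
    tN≤ = transport N≡h+h smallest
      where
      transport : ∀ {N} → N ≡ h + h → (∀ C → Geometry.CompleteCap F N C → tN ≤ length C) → tN ≤ length C′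
      transport refl smallest = smallest C′ complete′
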